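{- Let $a_9(n)$ be defined by $\sum_{n\geq 0}a_9(n)q^n=\frac{f_9f_{18}}{f_1f_2}$, where $f_k=\prod_{m\geq1}(1-q^{km})$. Define integers $m_{i,j}$ for $i,j\geq 1$ as follows: $m_{i,j}=0$ whenever $j>i$; $m_{1,1}=3$; $m_{2,1}=2$, $m_{2,2}=3^3$; $m_{3,1}=1$, $m_{3,2}=3^3$, $m_{3,3}=3^5$; and for $i\geq 4$, $m_{i,1}=0$ and for $j\geq 2$, \[m_{i,j}=9m_{i-1,j-1}+3m_{i-2,j-1}+m_{i-3,j-1}.\] Define the infinite matrix $C=(c_{i,j})_{i,j\geq1}$ by $c_{i,j}=m_{4i,\,i+j}$, and row vectors $\mathbf{Y}_\alpha=(y_{\alpha,1},y_{\alpha,2},\dots)$ by $\mathbf{Y}_0=(3,0,0,\dots)$ and $\mathbf{Y}_{\alpha+1}=\mathbf{Y}_\alpha C$. Then for each $\alpha\geq 0$, \[\sum_{n\geq0}a_9\left(3^{\alpha+1}n+3^{\alpha+1}-1\right)q^n=\sum_{i\geq1}y_{\alpha,i}\,q^{i-1}\left(\frac{f_3f_6}{f_1f_2}\right)^{4i}.\]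
   Context: $a_9(n)$ counts 9-regular cubic partitions of $n$. The products $\mathbf{Y}_\alpha C$ are finite sums since each $\mathbf{Y}_\alpha$ has finitely many nonzero entries. -}

module Defs where

open import Data.Nat.Base as ℕ using (ℕ; zero; suc; NonZero; s≤s; s<s⁻¹)
import Data.Nat.Properties as ℕₚ
open import Data.Integer.Base using (ℤ; +_; -_; _+_; _-_; _*_; 0ℤ; 1ℤ)
import Data.Integer.Properties as ℤₚ
open import Data.Fin.Base as Fin using (Fin; toℕ)
open import Data.Vec.Base using (Vec; []; _∷_; head; lookup)
open import Relation.Binary.PropositionalEquality
  using (_≡_; refl; sym; trans; cong; cong₂; module ≡-Reasoning)
open import Algebra.Properties.Semiring.Sum ℤₚ.+-*-semiring public
  using (sum-syntax; sum⁺-syntax; sum-cong-≗)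

------------------------------------------------------------------------
-- Formal power series in q over ℤ, given by their coefficients and
-- compared coefficientwise (_≗_).

Series : Set
Series = ℕ → ℤ

infixl 7 _⊛_ _⊘_
infixl 6 _⊖_
infixr 8 _^ˢ_
infix  9 q^_

q^_ : ℕ → Series
(q^ zero)  zero    = 1ℤ
(q^ zero)  (suc n) = 0ℤ
(q^ suc d) zero    = 0ℤ
(q^ suc d) (suc n) = (q^ d) n

one : Series
one = q^ 0

_⊖_ : Series → Series → Series
(A ⊖ B) n = A n - B n

_⊛_ : Series → Series → Series
(A ⊛ B) n = ∑[ i ≤ n ] (A (toℕ i) * B (n ℕ.∸ toℕ i))

_^ˢ_ : Series → ℕ → Series
A ^ˢ zero  = one
A ^ˢ suc k = A ⊛ A ^ˢ k

-- If B has constant term 1, its inverse b is given by b₀ = 1 and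
-- bₙ = - ∑_{i<n} B_{i+1} b_{n-1-i} for n ≥ 1.  The vector
-- inverse-prefix B n is (bₙ , … , b₀).

inverse-prefix : Series → (n : ℕ) → Vec ℤ (suc n)
inverse-prefix B zero    = 1ℤ ∷ []
inverse-prefix B (suc n) =
  - (∑[ i ≤ n ] (B (suc (toℕ i)) * lookup (inverse-prefix B n) i))
  ∷ inverse-prefix B n

-- Meaningful only when the constant term is 1; see ⊛-inverse.

inverse : Series → Series
inverse B n = head (inverse-prefix B n)

_⊘_ : Series → Series → Series
A ⊘ B = A ⊛ inverse B

lookup-inverse-prefix : ∀ B n (i : Fin (suc n)) →
  lookup (inverse-prefix B n) i ≡ inverse B (n ℕ.∸ toℕ i)
lookup-inverse-prefix B zero    Fin.zero    = refl
lookup-inverse-prefix B (suc n) Fin.zero    = refl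
lookup-inverse-prefix B (suc n) (Fin.suc i) = lookup-inverse-prefix B n i

⊛-inverse : ∀ B → B 0 ≡ 1ℤ → ∀ n → (B ⊛ inverse B) n ≡ one n
⊛-inverse B B₀≡1 zero    = cong (λ b → b * 1ℤ + 0ℤ) B₀≡1
⊛-inverse B B₀≡1 (suc n) = begin
  B 0 * - S + ∑[ i ≤ n ] (B (suc (toℕ i)) * inverse B (n ℕ.∸ toℕ i))
    ≡⟨ cong₂ _+_ (trans (cong (_* - S) B₀≡1) (ℤₚ.*-identityˡ (- S)))
                 (sum-cong-≗ {suc n} λ i →
                   cong (B (suc (toℕ i)) *_) (sym (lookup-inverse-prefix B n i))) ⟩
  - S + S
    ≡⟨ ℤₚ.+-inverseˡ S ⟩
  0ℤ ∎
  where
  open ≡-Reasoning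
  S = ∑[ i ≤ n ] (B (suc (toℕ i)) * lookup (inverse-prefix B n) i)

------------------------------------------------------------------------
-- f k = ∏_{m≥1} (1 - q^{km})

partial-product : ℕ → ℕ → Series
partial-product k zero    = one
partial-product k (suc N) = partial-product k N ⊛ (one ⊖ q^ (k ℕ.* suc N))

-- The factors with m > n do not affect the coefficient of qⁿ, so it is
-- read off from the product over m ≤ n; see f-limit.

f : (k : ℕ) .{{_ : NonZero k}} → Series
f k n = partial-product k n n

q^-below : ∀ {d n} → n ℕ.< d → (q^ d) n ≡ 0ℤ
q^-below {suc d} {zero}  _   = refl
q^-below {suc d} {suc n} n<d = q^-below {d} {n} (s<s⁻¹ n<d)

⊛-identityʳ-below : ∀ A E n → (∀ i → i ℕ.≤ n → E i ≡ one i) → (A ⊛ E) n ≡ A n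
⊛-identityʳ-below A E zero    E≡one = begin
  A 0 * E 0 + 0ℤ ≡⟨ ℤₚ.+-identityʳ _ ⟩
  A 0 * E 0      ≡⟨ cong (A 0 *_) (E≡one 0 ℕ.z≤n) ⟩
  A 0 * 1ℤ       ≡⟨ ℤₚ.*-identityʳ (A 0) ⟩
  A 0            ∎
  where open ≡-Reasoning
⊛-identityʳ-below A E (suc n) E≡one = begin
  A 0 * E (suc n) + ((λ i → A (suc i)) ⊛ E) n
    ≡⟨ cong₂ _+_
         (trans (cong (A 0 *_) (E≡one (suc n) ℕₚ.≤-refl)) (ℤₚ.*-zeroʳ (A 0)))
         (⊛-identityʳ-below (λ i → A (suc i)) E n
           (λ i i≤n → E≡one i (ℕₚ.m≤n⇒m≤1+n i≤n))) ⟩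
  0ℤ + A (suc n)
    ≡⟨ ℤₚ.+-identityˡ (A (suc n)) ⟩
  A (suc n) ∎
  where open ≡-Reasoning

f-limit : ∀ k .{{_ : NonZero k}} n d → partial-product k (d ℕ.+ n) n ≡ f k n
f-limit k n zero    = refl
f-limit k n (suc d) = trans
  (⊛-identityʳ-below (partial-product k (d ℕ.+ n)) _ n λ i i≤n →
    trans (cong (λ z → one i - z) (q^-below (i<kN i i≤n))) (ℤₚ.+-identityʳ (one i)))
  (f-limit k n d)
  where
  i<kN : ∀ i → i ℕ.≤ n → i ℕ.< k ℕ.* suc (d ℕ.+ n)
  i<kN i i≤n = ℕₚ.≤-trans
    (s≤s (ℕₚ.≤-trans i≤n (ℕₚ.m≤n+m n d)))
    (ℕₚ.m≤n*m (suc (d ℕ.+ n)) k)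

a₉ : ℕ → ℤ
a₉ = f 9 ⊛ f 18 ⊘ (f 1 ⊛ f 2)

------------------------------------------------------------------------
-- The arrays.  All indices start at 1; values at index 0 are never used.

m : ℕ → ℕ → ℤ
m 1 1 = + 3
m 2 1 = + 2
m 2 2 = + (3 ℕ.^ 3)
m 3 1 = + 1
m 3 2 = + (3 ℕ.^ 3)
m 3 3 = + (3 ℕ.^ 5)
m (suc (suc (suc (suc i)))) (suc (suc j)) =
    + 9 * m (suc (suc (suc i))) (suc j)
  + + 3 * m (suc (suc i)) (suc j)
  + m (suc i) (suc j)
m _ _ = 0ℤ

m-above-diagonal : ∀ i j → i ℕ.< j → m i j ≡ 0ℤ
m-above-diagonal 0 j _ = refl
m-above-diagonal 1 1 (s≤s ())
m-above-diagonal 1 (suc (suc j)) _ = refl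
m-above-diagonal 2 1 (s≤s ())
m-above-diagonal 2 2 (s≤s (s≤s ()))
m-above-diagonal 2 (suc (suc (suc j))) _ = refl
m-above-diagonal 3 1 (s≤s ())
m-above-diagonal 3 2 (s≤s (s≤s ()))
m-above-diagonal 3 3 (s≤s (s≤s (s≤s ())))
m-above-diagonal 3 (suc (suc (suc (suc j)))) _ = refl
m-above-diagonal (suc (suc (suc (suc i)))) 1 (s≤s ())
m-above-diagonal (suc (suc (suc (suc i)))) (suc (suc j)) (s≤s p) =
  cong₂ _+_
    (cong₂ (λ x y → + 9 * x + + 3 * y)
      (m-above-diagonal (suc (suc (suc i))) (suc j) p)
      (m-above-diagonal (suc (suc i)) (suc j) (ℕₚ.<⇒≤ p)))
    (m-above-diagonal (suc i) (suc j) (ℕₚ.<⇒≤ (ℕₚ.<⇒≤ p)))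

c : ℕ → ℕ → ℤ
c i j = m (4 ℕ.* i) (i ℕ.+ j)

c-row-finite : ∀ i j → 3 ℕ.* i ℕ.< j → c i j ≡ 0ℤ
c-row-finite i j 3i<j =
  m-above-diagonal (4 ℕ.* i) (i ℕ.+ j) (ℕₚ.+-monoʳ-< i 3i<j)

-- ∑_{i=1}^{N} x i

sum₁ : ℕ → (ℕ → ℤ) → ℤ
sum₁ N x = ∑[ i < N ] x (suc (toℕ i))

sum₁-zero : ∀ N x → (∀ i → i ℕ.≤ N → x i ≡ 0ℤ) → sum₁ N x ≡ 0ℤ
sum₁-zero zero    x x≡0 = refl
sum₁-zero (suc N) x x≡0 = cong₂ _+_ (x≡0 1 (s≤s ℕ.z≤n))
  (sum₁-zero N (λ i → x (suc i)) λ i i≤N → x≡0 (suc i) (s≤s i≤N))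

-- A row vector with finitely many nonzero entries: all entries of index
-- larger than bound vanish, so sums over all i ≥ 1 are sums over
-- 1 ≤ i ≤ bound.

record Row : Set where
  field
    entry  : ℕ → ℤ
    bound  : ℕ
    finite : ∀ i → bound ℕ.< i → entry i ≡ 0ℤ

open Row public

infixl 7 _·C

_·C : Row → Row
(y ·C) .entry j = sum₁ (bound y) λ i → entry y i * c i j
(y ·C) .bound   = 3 ℕ.* bound y
(y ·C) .finite j 3b<j = sum₁-zero (bound y) _ λ i i≤b →
  trans (cong (entry y i *_)
          (c-row-finite i j (ℕₚ.≤-<-trans (ℕₚ.*-monoʳ-≤ 3 i≤b) 3b<j)))
        (ℤₚ.*-zeroʳ (entry y i))

Y₀ : Row
Y₀ .entry 1 = + 3
Y₀ .entry _ = 0ℤ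
Y₀ .bound   = 1
Y₀ .finite 1 (s≤s ())
Y₀ .finite (suc (suc i)) _ = refl

Y : ℕ → Row
Y zero    = Y₀
Y (suc α) = Y α ·C

-- ∑_{i≥1} yᵢ Sᵢ

combination : Row → (ℕ → Series) → Series
combination y S n = sum₁ (bound y) λ i → entry y i * S i n

{-# OPTIONS --safe #-}
module Submission where

-- Put F = f₁f₂, P = f₃f₆ and R = f₉f₁₈, so that P = F(q³) and R = P(q³), and ζ = q R / F.  As F = φ(-q)ψ(q), the
-- 3-dissections of the theta functions φ(-q) and ψ(q), with coefficients evaluated by Jacobi's triple product, give
-- F = a(q³) + q b(q³) + q² d(q³) with b = -P and a d = -2 P².  It follows that F³ + 3 q R F² + 9 q² R² F = N, where N is
-- the norm of F over ℤ[[q³]]; computed factor by factor, N = P⁴ / R.  In terms of ζ this cubic equation reads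
-- ζ³ = T (9 ζ² + 3 ζ + 1) with T = q³ (R / P)⁴.  Extracting the exponents divisible by 3 commutes with multiplication
-- by T, so the extracts of the ζⁱ obey the recurrence of the rows of m: they are ∑ⱼ m i j Tʲ.  The theorem follows by
-- induction on α, since (q (P / F)⁴)ⁱ = ζ⁴ⁱ T⁻ⁱ.

open import Defs
open import Data.Nat.Base as ℕ using (ℕ; zero; suc; _+_; _*_; _∸_; _^_; _≤_; _<_; z≤n; s≤s; NonZero)
import Data.Nat.Properties as ℕₚ
open import Data.Nat.DivMod using (_divMod_; result)
import Data.Nat.Tactic.RingSolver as ℕ-RingSolver
open import Data.Integer.Base as ℤ using (ℤ; +_; 0ℤ; 1ℤ; -1ℤ)
import Data.Integer.Properties as ℤₚ
import Data.Integer.Solver as ℤ-Solver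
open import Data.Fin.Base using (Fin; toℕ)
open import Data.Fin.Patterns using (0F; 1F; 2F)
import Data.Fin.Properties as Finₚ
open import Data.Product.Base using (_,_)
open import Data.Sum.Base using (_⊎_; inj₁; inj₂)
open import Data.Maybe.Base using (Maybe; just; nothing)
open import Data.Empty using (⊥-elim)
open import Function.Base using (_∘_; _$_)
open import Level using (0ℓ)
open import Relation.Nullary.Decidable using (yes; no)
open import Relation.Binary.Bundles using (Setoid)
open import Relation.Binary.Structures using (IsEquivalence)
import Relation.Binary.Reasoning.Setoid as SetoidReasoning
open import Relation.Binary.PropositionalEquality
  using (_≡_; _≗_; refl; sym; trans; cong; cong₂; subst; module ≡-Reasoning)
open import Algebra.Solver.Ring.AlmostCommutativeRing
  using (AlmostCommutativeRing; IsAlmostCommutativeRing; _-Raw-AlmostCommutative⟶_)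
import Algebra.Solver.Ring as RingSolver

-- The ring of power series

-- The cubic is the characteristic polynomial of F/q over the series in q³. The conjugates come from
-- q → ωq with ω³ = 1, so with the parts a, b, d taken at q³ the elementary symmetric functions of
-- F/q are 3b, 3(b² - ad) and N/q³. The relations on the parts give b² - ad = 3b², so the middle one
-- is 9b². The root ω itself is avoided: each such fact is checked as a polynomial identity in a, b,
-- d and q. Keeping the exponents divisible by 3 is a third of the trace, so the rows of `m` are
-- thirds of power sums of the roots of the equation for ζ. Newton's identities with e₁ = 9T, e₂ =
-- -3T, e₃ = T produce 3T, 2T + 27T², T + 27T² + 243T³, which are the exceptional rows 1 to 3. Every
-- limit is a congruence modulo qⁿ at stage n. The triple product is obtained from its finite form;
-- the difficulty is that the Gaussian binomials are far from their limit near both ends of the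
-- range, and there the growth of the theta exponents makes up for the lost precision. Division by T
-- is avoided as well: extracts are compared after multiplication by powers of q and P/F, which
-- cancel.

tail : Series → Series
tail A n = A (suc n)

ι : ℤ → Series
ι k zero    = k
ι k (suc n) = 0ℤ

ι-zero : ∀ n → ι 0ℤ n ≡ 0ℤ
ι-zero zero    = refl
ι-zero (suc n) = refl

infix 4 _≈_

-- A record, so that the two series can be inferred from a proof; `_≗_` unfolds to a family of
-- equations from which they cannot.
record _≈_ (A B : Series) : Set where
  constructor ⟨_⟩
  field coeff : A ≗ B
open _≈_ public

infixl 6 _⊕_
infixl 7 _∙_
infix  8 ⊝_

-- Opaque, so that unification never unfolds a convolution.
opaque
  _⊕_ _∙_ : Series → Series → Series
  (A ⊕ B) n = A n ℤ.+ B n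
  _∙_ = _⊛_

  ⊝_ : Series → Series
  (⊝ A) n = ℤ.- A n

module _ where
  open ℤ-Solver.+-*-Solver
  open ≡-Reasoning

  ⊛-cong-below : ∀ {A A′ B B′} n → (∀ i → i ≤ n → A i ≡ A′ i) → (∀ i → i ≤ n → B i ≡ B′ i) →
    (A ⊛ B) n ≡ (A′ ⊛ B′) n
  ⊛-cong-below zero    p r = cong (ℤ._+ 0ℤ) (cong₂ ℤ._*_ (p 0 z≤n) (r 0 z≤n))
  ⊛-cong-below (suc n) p r = cong₂ ℤ._+_
    (cong₂ ℤ._*_ (p 0 z≤n) (r (suc n) ℕₚ.≤-refl))
    (⊛-cong-below n (λ i i≤n → p (suc i) (s≤s i≤n)) (λ i i≤n → r i (ℕₚ.m≤n⇒m≤1+n i≤n)))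

  ⊛-cong : ∀ {A A′ B B′} → A ≗ A′ → B ≗ B′ → A ⊛ B ≗ A′ ⊛ B′
  ⊛-cong p r n = ⊛-cong-below n (λ i _ → p i) (λ i _ → r i)

  -- `_⊛_` recurses on the left factor. Peeling off the last summand instead gives the mirror-image
  -- recursion, and matching the two proves commutativity.
  ⊛-peelʳ : ∀ A B n → (A ⊛ B) (suc n) ≡ (A ⊛ tail B) n ℤ.+ A (suc n) ℤ.* B 0
  ⊛-peelʳ A B zero    = solve 4 (λ a b x y → a :* y :+ (b :* x :+ con 0ℤ) := a :* y :+ con 0ℤ :+ b :* x) refl
    (A 0) (A 1) (B 0) (B 1)
  ⊛-peelʳ A B (suc n) = begin
    A 0 ℤ.* B (2 + n) ℤ.+ (tail A ⊛ B) (suc n)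
      ≡⟨ cong (ℤ._+_ (A 0 ℤ.* B (2 + n))) (⊛-peelʳ (tail A) B n) ⟩
    A 0 ℤ.* B (2 + n) ℤ.+ ((tail A ⊛ tail B) n ℤ.+ A (2 + n) ℤ.* B 0)
      ≡⟨ sym (ℤₚ.+-assoc (A 0 ℤ.* B (2 + n)) _ _) ⟩
    (A ⊛ tail B) (suc n) ℤ.+ A (2 + n) ℤ.* B 0 ∎

  ⊛-comm : ∀ A B → A ⊛ B ≗ B ⊛ A
  ⊛-comm A B zero    = cong (ℤ._+ 0ℤ) (ℤₚ.*-comm (A 0) (B 0))
  ⊛-comm A B (suc n) = begin
    A 0 ℤ.* B (suc n) ℤ.+ (tail A ⊛ B) n ≡⟨ cong₂ ℤ._+_ (ℤₚ.*-comm (A 0) _) (⊛-comm (tail A) B n) ⟩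
    B (suc n) ℤ.* A 0 ℤ.+ (B ⊛ tail A) n ≡⟨ ℤₚ.+-comm (B (suc n) ℤ.* A 0) _ ⟩
    (B ⊛ tail A) n ℤ.+ B (suc n) ℤ.* A 0 ≡⟨ sym (⊛-peelʳ B A n) ⟩
    (B ⊛ A) (suc n)                      ∎

  ⊛-distribʳ : ∀ C A B n → ((λ i → A i ℤ.+ B i) ⊛ C) n ≡ (A ⊛ C) n ℤ.+ (B ⊛ C) n
  ⊛-distribʳ C A B zero = solve 3 (λ a b x → (a :+ b) :* x :+ con 0ℤ := (a :* x :+ con 0ℤ) :+ (b :* x :+ con 0ℤ)) refl
    (A 0) (B 0) (C 0)
  ⊛-distribʳ C A B (suc n) = trans
    (cong (ℤ._+_ ((A 0 ℤ.+ B 0) ℤ.* C (suc n))) (⊛-distribʳ C (tail A) (tail B) n))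
    (solve 5 (λ a b x y z → (a :+ b) :* x :+ (y :+ z) := (a :* x :+ y) :+ (b :* x :+ z)) refl
      (A 0) (B 0) (C (suc n)) ((tail A ⊛ C) n) ((tail B ⊛ C) n))

  ⊛-scale : ∀ k A B n → ((λ i → k ℤ.* A i) ⊛ B) n ≡ k ℤ.* (A ⊛ B) n
  ⊛-scale k A B zero = solve 3 (λ k a b → k :* a :* b :+ con 0ℤ := k :* (a :* b :+ con 0ℤ)) refl k (A 0) (B 0)
  ⊛-scale k A B (suc n) = trans
    (cong (ℤ._+_ (k ℤ.* A 0 ℤ.* B (suc n))) (⊛-scale k (tail A) B n))
    (solve 4 (λ k a b c → k :* a :* b :+ k :* c := k :* (a :* b :+ c)) refl k (A 0) (B (suc n)) ((tail A ⊛ B) n))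

  ⊛-assoc : ∀ A B C → (A ⊛ B) ⊛ C ≗ A ⊛ (B ⊛ C)
  ⊛-assoc A B C zero = solve 3 (λ a b c → (a :* b :+ con 0ℤ) :* c :+ con 0ℤ := a :* (b :* c :+ con 0ℤ) :+ con 0ℤ) refl
    (A 0) (B 0) (C 0)
  ⊛-assoc A B C (suc n) = begin
    (A ⊛ B) 0 ℤ.* C (suc n) ℤ.+ (tail (A ⊛ B) ⊛ C) n
      ≡⟨ cong (ℤ._+_ ((A ⊛ B) 0 ℤ.* C (suc n))) (trans
           (⊛-distribʳ C (λ i → A 0 ℤ.* B (suc i)) (tail A ⊛ B) n)
           (cong₂ ℤ._+_ (⊛-scale (A 0) (tail B) C n) (⊛-assoc (tail A) B C n))) ⟩
    (A ⊛ B) 0 ℤ.* C (suc n) ℤ.+ (A 0 ℤ.* (tail B ⊛ C) n ℤ.+ (tail A ⊛ (B ⊛ C)) n)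
      ≡⟨ solve 5 (λ a b c x y → (a :* b :+ con 0ℤ) :* c :+ (a :* x :+ y) := a :* (b :* c :+ x) :+ y) refl
           (A 0) (B 0) (C (suc n)) ((tail B ⊛ C) n) ((tail A ⊛ (B ⊛ C)) n) ⟩
    A 0 ℤ.* (B ⊛ C) (suc n) ℤ.+ (tail A ⊛ (B ⊛ C)) n ∎

  ⊛-zeroˡ : ∀ B n → ((λ _ → 0ℤ) ⊛ B) n ≡ 0ℤ
  ⊛-zeroˡ B zero    = refl
  ⊛-zeroˡ B (suc n) = trans (ℤₚ.+-identityˡ _) (⊛-zeroˡ B n)

  ι-⊛ : ∀ k B n → (ι k ⊛ B) n ≡ k ℤ.* B n
  ι-⊛ k B zero    = ℤₚ.+-identityʳ _
  ι-⊛ k B (suc n) = trans (cong (ℤ._+_ (k ℤ.* B (suc n))) (⊛-zeroˡ B n)) (ℤₚ.+-identityʳ _)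

  ⊛-neg : ∀ A B n → ((λ i → ℤ.- A i) ⊛ B) n ≡ ℤ.- (A ⊛ B) n
  ⊛-neg A B n = begin
    ((λ i → ℤ.- A i) ⊛ B) n      ≡⟨ ⊛-cong {B = B} (λ i → sym (ℤₚ.-1*i≡-i (A i))) (λ _ → refl) n ⟩
    ((λ i → -1ℤ ℤ.* A i) ⊛ B) n  ≡⟨ ⊛-scale -1ℤ A B n ⟩
    -1ℤ ℤ.* (A ⊛ B) n            ≡⟨ ℤₚ.-1*i≡-i _ ⟩
    ℤ.- (A ⊛ B) n                ∎

≈-isEquivalence : IsEquivalence _≈_
≈-isEquivalence = record
  { refl  = ⟨ (λ _ → refl) ⟩
  ; sym   = λ p → ⟨ (λ n → sym (coeff p n)) ⟩
  ; trans = λ p r → ⟨ (λ n → trans (coeff p n) (coeff r n)) ⟩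
  }

open IsEquivalence ≈-isEquivalence public
  renaming (refl to ≈-refl; sym to ≈-sym; trans to ≈-trans; reflexive to ≡⇒≈)

opaque
  unfolding _⊕_

  ⊕-coeff : ∀ A B n → (A ⊕ B) n ≡ A n ℤ.+ B n
  ⊕-coeff A B n = refl

  ∙≡⊛ : ∀ A B → A ∙ B ≡ A ⊛ B
  ∙≡⊛ A B = refl

  isAlmostCommutativeRing : IsAlmostCommutativeRing _≈_ _⊕_ _∙_ ⊝_ (ι 0ℤ) (ι 1ℤ)
  isAlmostCommutativeRing = record
    { isCommutativeSemiring = record
      { isSemiring = record
        { isSemiringWithoutAnnihilatingZero = record
          { +-isCommutativeMonoid = record
            { isMonoid = record
              { isSemigroup = record
                { isMagma = record
                  { isEquivalence = ≈-isEquivalence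
                  ; ∙-cong = λ p r → ⟨ (λ n → cong₂ ℤ._+_ (coeff p n) (coeff r n)) ⟩ }
                ; assoc = λ A B C → ⟨ (λ n → ℤₚ.+-assoc (A n) (B n) (C n)) ⟩ }
              ; identity = (λ A → ⟨ (λ n → trans (cong (ℤ._+ A n) (ι-zero n)) (ℤₚ.+-identityˡ (A n))) ⟩)
                         , (λ A → ⟨ (λ n → trans (cong (ℤ._+_ (A n)) (ι-zero n)) (ℤₚ.+-identityʳ (A n))) ⟩) }
            ; comm = λ A B → ⟨ (λ n → ℤₚ.+-comm (A n) (B n)) ⟩ }
          ; *-cong = λ p r → ⟨ ⊛-cong (coeff p) (coeff r) ⟩
          ; *-assoc = λ A B C → ⟨ ⊛-assoc A B C ⟩
          ; *-identity = (λ A → ⟨ idˡ A ⟩) , (λ A → ⟨ (λ n → trans (⊛-comm A (ι 1ℤ) n) (idˡ A n)) ⟩)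
          ; distrib = (λ A B C → ⟨ (λ n → trans (⊛-comm A (B ⊕ C) n) (trans (⊛-distribʳ A B C n)
                        (cong₂ ℤ._+_ (⊛-comm B A n) (⊛-comm C A n)))) ⟩)
                    , (λ A B C → ⟨ ⊛-distribʳ A B C ⟩) }
        ; zero = (λ A → ⟨ zeˡ A ⟩) , (λ A → ⟨ (λ n → trans (⊛-comm A (ι 0ℤ) n) (zeˡ A n)) ⟩) }
      ; *-comm = λ A B → ⟨ ⊛-comm A B ⟩ }
    ; -‿cong = λ p → ⟨ (λ n → cong ℤ.-_ (coeff p n)) ⟩
    ; -‿*-distribˡ = λ A B → ⟨ ⊛-neg A B ⟩
    ; -‿+-comm = λ A B → ⟨ (λ n → sym (ℤₚ.neg-distrib-+ (A n) (B n))) ⟩ }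
    where
    idˡ : ∀ A n → (ι 1ℤ ⊛ A) n ≡ A n
    idˡ A n = trans (ι-⊛ 1ℤ A n) (ℤₚ.*-identityˡ (A n))
    zeˡ : ∀ A n → (ι 0ℤ ⊛ A) n ≡ ι 0ℤ n
    zeˡ A n = trans (ι-⊛ 0ℤ A n) (sym (ι-zero n))

  ι-+ : ∀ j k → ι (j ℤ.+ k) ≈ ι j ⊕ ι k
  ι-+ j k = ⟨ (λ { zero → refl ; (suc n) → refl }) ⟩

  ι-* : ∀ j k → ι (j ℤ.* k) ≈ ι j ∙ ι k
  ι-* j k = ⟨ (λ { zero → sym (ℤₚ.+-identityʳ _)
                 ; (suc n) → sym (trans (ι-⊛ j (ι k) (suc n)) (ℤₚ.*-zeroʳ j)) }) ⟩

  ι-neg : ∀ k → ι (ℤ.- k) ≈ ⊝ ι k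
  ι-neg k = ⟨ (λ { zero → refl ; (suc n) → refl }) ⟩

seriesRing : AlmostCommutativeRing 0ℓ 0ℓ
seriesRing = record { isAlmostCommutativeRing = isAlmostCommutativeRing }

open AlmostCommutativeRing seriesRing public
  using () renaming
  ( +-cong to ⊕-cong; *-cong to ∙-cong; *-assoc to ∙-assoc
  ; *-identityˡ to ∙-identityˡ; *-identityʳ to ∙-identityʳ; +-identityˡ to ⊕-identityˡ; +-identityʳ to ⊕-identityʳ
  ; distribˡ to ∙-distribˡ; distribʳ to ∙-distribʳ; zeroʳ to ∙-zeroʳ; -‿cong to ⊝-cong
  ; +-assoc to ⊕-assoc)

seriesSetoid : Setoid 0ℓ 0ℓ
seriesSetoid = record { isEquivalence = ≈-isEquivalence }

ι-homomorphism : ℤ.+-*-rawRing -Raw-AlmostCommutative⟶ seriesRing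
ι-homomorphism = record
  { ⟦_⟧ = ι ; +-homo = ι-+ ; *-homo = ι-* ; -‿homo = ι-neg ; 0-homo = ≈-refl ; 1-homo = ≈-refl }

ι-≟ : ∀ j k → Maybe (ι j ≈ ι k)
ι-≟ j k with j ℤₚ.≟ k
... | yes p = just (≡⇒≈ (cong ι p))
... | no  _ = nothing

module SeriesSolver = RingSolver ℤ.+-*-rawRing seriesRing ι-homomorphism ι-≟
module ≈-Reasoning = SetoidReasoning seriesSetoid

-- Congruence modulo q^n and limits

infix 4 _≈[_]_ _⟶_

record _≈[_]_ (A : Series) (n : ℕ) (B : Series) : Set where
  constructor ⟪_⟫
  field below : ∀ i → i < n → A i ≡ B i
open _≈[_]_ public

≈[]-setoid : ℕ → Setoid 0ℓ 0ℓ
≈[]-setoid n = record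
  { _≈_ = _≈[ n ]_
  ; isEquivalence = record
    { refl  = ⟪ (λ _ _ → refl) ⟫
    ; sym   = λ p → ⟪ (λ i i<n → sym (below p i i<n)) ⟫
    ; trans = λ p r → ⟪ (λ i i<n → trans (below p i i<n) (below r i i<n)) ⟫ } }

module Mod {n} = Setoid (≈[]-setoid n)
module Mod-Reasoning n = SetoidReasoning (≈[]-setoid n)

≈⇒≈[] : ∀ {n A B} → A ≈ B → A ≈[ n ] B
≈⇒≈[] p = ⟪ (λ i _ → coeff p i) ⟫

≈[]⇒≈ : ∀ {A B} → (∀ n → A ≈[ n ] B) → A ≈ B
≈[]⇒≈ p = ⟨ (λ n → below (p (suc n)) n ℕₚ.≤-refl) ⟩

weaken : ∀ {n n′ A B} → n′ ≤ n → A ≈[ n ] B → A ≈[ n′ ] B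
weaken n′≤n p = ⟪ (λ i i<n′ → below p i (ℕₚ.≤-trans i<n′ n′≤n)) ⟫

opaque
  unfolding _⊕_

  ⊕-cong[] : ∀ {n A A′ B B′} → A ≈[ n ] A′ → B ≈[ n ] B′ → A ⊕ B ≈[ n ] A′ ⊕ B′
  ⊕-cong[] p r = ⟪ (λ i i<n → cong₂ ℤ._+_ (below p i i<n) (below r i i<n)) ⟫

  ⊝-cong[] : ∀ {n A A′} → A ≈[ n ] A′ → ⊝ A ≈[ n ] ⊝ A′
  ⊝-cong[] p = ⟪ (λ i i<n → cong ℤ.-_ (below p i i<n)) ⟫

  ∙-cong[] : ∀ {n A A′ B B′} → A ≈[ n ] A′ → B ≈[ n ] B′ → A ∙ B ≈[ n ] A′ ∙ B′
  ∙-cong[] {A′ = A′} {B′ = B′} p r = ⟪ (λ i i<n → ⊛-cong-below {A′ = A′} {B′ = B′} i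
    (λ j j≤i → below p j (ℕₚ.≤-<-trans j≤i i<n)) (λ j j≤i → below r j (ℕₚ.≤-<-trans j≤i i<n))) ⟫

  q^suc-∙ : ∀ d A n → (q^ suc d ∙ A) (suc n) ≡ (q^ d ∙ A) n
  q^suc-∙ d A n = ℤₚ.+-identityˡ _

  q^suc-∙-zero : ∀ d A → (q^ suc d ∙ A) 0 ≡ 0ℤ
  q^suc-∙-zero d A = refl

  ∙-constant : ∀ A B → (A ∙ B) 0 ≡ A 0 ℤ.* B 0
  ∙-constant A B = ℤₚ.+-identityʳ _

  ι-∙ : ∀ k A n → (ι k ∙ A) n ≡ k ℤ.* A n
  ι-∙ = ι-⊛

  ∙-inverse : ∀ A → A 0 ≡ 1ℤ → A ∙ inverse A ≈ ι 1ℤ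
  ∙-inverse A p = ⟨ (λ n → trans (⊛-inverse A p n) (one≡ι n)) ⟩
    where
    one≡ι : one ≗ ι 1ℤ
    one≡ι zero    = refl
    one≡ι (suc n) = refl

q^0≈1 : q^ 0 ≈ ι 1ℤ
q^0≈1 = ⟨ (λ { zero → refl ; (suc n) → refl }) ⟩

q^-+ : ∀ d e → q^ (d + e) ≈ q^ d ∙ q^ e
q^-+ zero    e = ≈-sym (≈-trans (∙-cong q^0≈1 ≈-refl) (∙-identityˡ (q^ e)))
q^-+ (suc d) e = ⟨ (λ { zero    → sym (q^suc-∙-zero d (q^ e))
                      ; (suc n) → trans (coeff (q^-+ d e) n) (sym (q^suc-∙ d (q^ e) n)) }) ⟩

q^-∙-coeff : ∀ d A n → (q^ d ∙ A) (d + n) ≡ A n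
q^-∙-coeff zero    A n = coeff (≈-trans (∙-cong q^0≈1 ≈-refl) (∙-identityˡ A)) n
q^-∙-coeff (suc d) A n = trans (q^suc-∙ d A (d + n)) (q^-∙-coeff d A n)

q^-cancel : ∀ d {A B} → q^ d ∙ A ≈ q^ d ∙ B → A ≈ B
q^-cancel d {A} {B} p = ⟨ (λ n →
  trans (sym (q^-∙-coeff d A n)) (trans (coeff p (d + n)) (q^-∙-coeff d B n))) ⟩

-- A factor q^d raises the precision by d. This gain is what saves the ends of the theta series in
-- `absorb`.
q^-cong[] : ∀ d {n A B} → A ≈[ n ] B → q^ d ∙ A ≈[ d + n ] q^ d ∙ B
q^-cong[] zero    p = ∙-cong[] Mod.refl p
q^-cong[] (suc d) {n} {A} {B} p = ⟪ go ⟫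
  where
  go : ∀ i → i < suc (d + n) → (q^ suc d ∙ A) i ≡ (q^ suc d ∙ B) i
  go zero    _         = trans (q^suc-∙-zero d A) (sym (q^suc-∙-zero d B))
  go (suc i) (s≤s i<) = trans (q^suc-∙ d A i) (trans (below (q^-cong[] d p) i i<) (sym (q^suc-∙ d B i)))

q^≈[]0 : ∀ {d n} → n ≤ d → q^ d ≈[ n ] ι 0ℤ
q^≈[]0 {d} n≤d = ⟪ (λ i i<n → trans (q^-below (ℕₚ.≤-trans i<n n≤d)) (sym (ι-zero i))) ⟫

∙-cancelˡ[] : ∀ {n A B D} → A 0 ≡ 1ℤ → A ∙ B ≈[ n ] A ∙ D → B ≈[ n ] D
∙-cancelˡ[] {n} {A} {B} {D} A₀≡1 p = begin
  B                      ≈⟨ ≈⇒≈[] (unfold B) ⟩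
  inverse A ∙ (A ∙ B)    ≈⟨ ∙-cong[] Mod.refl p ⟩
  inverse A ∙ (A ∙ D)    ≈⟨ ≈⇒≈[] (≈-sym (unfold D)) ⟩
  D                      ∎
  where
  open Mod-Reasoning n
  open SeriesSolver
  unfold : ∀ B → B ≈ inverse A ∙ (A ∙ B)
  unfold B = ≈-trans (≈-sym (∙-identityˡ B)) (≈-trans (∙-cong (≈-sym (∙-inverse A A₀≡1)) ≈-refl)
    (solve 3 (λ a i b → a :* i :* b := i :* (a :* b)) ≈-refl A (inverse A) B))

∙-cancelˡ : ∀ A {B D} → A 0 ≡ 1ℤ → A ∙ B ≈ A ∙ D → B ≈ D
∙-cancelˡ A A₀≡1 p = ≈[]⇒≈ (λ n → ∙-cancelˡ[] A₀≡1 (≈⇒≈[] p))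

ι-cancel : ∀ k .{{_ : ℤ.NonZero k}} {A B} → ι k ∙ A ≈ ι k ∙ B → A ≈ B
ι-cancel k {A} {B} p = ⟨ (λ n → ℤₚ.*-cancelˡ-≡ k _ _
  (trans (sym (ι-∙ k A n)) (trans (coeff p n) (ι-∙ k B n)))) ⟩

-- The rate is fixed in advance: stage n is correct below qⁿ. Limits then need no choice of an
-- index, and products and subsequences keep the rate.
_⟶_ : (ℕ → Series) → Series → Set
A ⟶ L = ∀ n → A n ≈[ n ] L

⟶-unique : ∀ {A L M} → A ⟶ L → A ⟶ M → L ≈ M
⟶-unique p r = ≈[]⇒≈ λ n → Mod.trans (Mod.sym (p n)) (r n)

⟶-cong : ∀ {A B L} → (∀ n → A n ≈ B n) → A ⟶ L → B ⟶ L
⟶-cong A≈B p n = Mod.trans (≈⇒≈[] (≈-sym (A≈B n))) (p n)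

⟶-∙ : ∀ {A B L M} → A ⟶ L → B ⟶ M → (λ n → A n ∙ B n) ⟶ L ∙ M
⟶-∙ p r n = ∙-cong[] (p n) (r n)

⟶-subsequence : ∀ k .{{_ : NonZero k}} {A L} → A ⟶ L → (λ n → A (n * k)) ⟶ L
⟶-subsequence k p n = weaken (ℕₚ.m≤m*n n k) (p (n * k))

-- ∏_{j<n} (1 + ε q^(ej+d)) and its limit

products : ℤ → ℕ → ℕ → ℕ → Series
products ε e d zero    = ι 1ℤ
products ε e d (suc n) = products ε e d n ∙ (ι 1ℤ ⊕ ι ε ∙ q^ (e * n + d))

product∞ : ℤ → ℕ → ℕ → Series
product∞ ε e d n = products ε e d n n

1+O : ∀ ε {n d} → n ≤ d → ι 1ℤ ⊕ ι ε ∙ q^ d ≈[ n ] ι 1ℤ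
1+O ε n≤d = Mod.trans (⊕-cong[] Mod.refl (∙-cong[] Mod.refl (q^≈[]0 n≤d)))
  (≈⇒≈[] (≈-trans (⊕-cong ≈-refl (∙-zeroʳ (ι ε))) (⊕-identityʳ (ι 1ℤ))))

n<en+d : ∀ n e d .{{_ : NonZero e}} .{{_ : NonZero d}} → suc n ≤ e * n + d
n<en+d n e d = subst (_≤ e * n + d) (ℕₚ.+-comm n 1) (ℕₚ.+-mono-≤ (ℕₚ.m≤n*m n e) (ℕ.>-nonZero⁻¹ d))

module _ (ε : ℤ) (e d : ℕ) .{{_ : NonZero e}} .{{_ : NonZero d}} where

  products-stable : ∀ n k → products ε e d (k + n) ≈[ suc n ] products ε e d n
  products-stable n zero    = Mod.refl
  products-stable n (suc k) = Mod.trans (∙-cong[] (products-stable n k)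
      (1+O ε (ℕₚ.≤-trans (s≤s (ℕₚ.m≤n+m n k)) (n<en+d (k + n) e d))))
    (≈⇒≈[] (∙-identityʳ _))

  products-limit : ∀ n → products ε e d n ≈[ suc n ] product∞ ε e d
  products-limit n = ⟪ (λ { i (s≤s i≤n) → subst (λ k → products ε e d k i ≡ products ε e d i i)
    (ℕₚ.m∸n+n≡m i≤n) (below (products-stable i (n ∸ i)) i ℕₚ.≤-refl) }) ⟫

  products⟶ : products ε e d ⟶ product∞ ε e d
  products⟶ n = weaken (ℕₚ.n≤1+n n) (products-limit n)

opaque
  unfolding _⊕_

  partial-product-products : ∀ k n → partial-product k n ≈ products -1ℤ k k n
  partial-product-products k zero    = q^0≈1
  partial-product-products k (suc n) = ∙-cong (partial-product-products k n)
    ⟨ (λ i → cong₂ ℤ._+_ (coeff q^0≈1 i) (trans (cong (λ e → ℤ.- (q^ e) i) (trans (ℕₚ.*-suc k n) (ℕₚ.+-comm k (k * n))))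
        (sym (trans (ι-⊛ -1ℤ (q^ (k * n + k)) i) (ℤₚ.-1*i≡-i _))))) ⟩

f≈product∞ : ∀ k .{{_ : NonZero k}} → f k ≈ product∞ -1ℤ k k
f≈product∞ k = ⟨ (λ n → coeff (partial-product-products k n) n) ⟩

-- Gaussian binomials and the finite triple product

open SeriesSolver using (solve; con; _:=_; _:+_; _:*_; _:-_; :-_)

infixr 8 _↑_

_↑_ : Series → ℕ → Series
A ↑ zero  = ι 1ℤ
A ↑ suc n = A ∙ A ↑ n

↑-+ : ∀ A m n → A ↑ (m + n) ≈ A ↑ m ∙ A ↑ n
↑-+ A zero    n = ≈-sym (∙-identityˡ _)
↑-+ A (suc m) n = ≈-trans (∙-cong ≈-refl (↑-+ A m n)) (≈-sym (∙-assoc A _ _))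

-- Both indices are carried along so that q-binomial sums over i + l = N need no truncated
-- subtraction.
diagonal : ℕ → (ℕ → ℕ → Series) → Series
diagonal zero    h = h 0 0
diagonal (suc N) h = h 0 (suc N) ⊕ diagonal N (h ∘ suc)

diagonal-cong[] : ∀ {n} N {h h′} → (∀ i l → i + l ≡ N → h i l ≈[ n ] h′ i l) → diagonal N h ≈[ n ] diagonal N h′
diagonal-cong[] zero    p = p 0 0 refl
diagonal-cong[] (suc N) p = ⊕-cong[] (p 0 (suc N) refl) (diagonal-cong[] N λ i l e → p (suc i) l (cong suc e))

diagonal-cong : ∀ N {h h′} → (∀ i l → i + l ≡ N → h i l ≈ h′ i l) → diagonal N h ≈ diagonal N h′
diagonal-cong N p = ≈[]⇒≈ λ n → diagonal-cong[] N λ i l e → ≈⇒≈[] (p i l e)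

diagonal-⊕ : ∀ N h h′ → diagonal N (λ i l → h i l ⊕ h′ i l) ≈ diagonal N h ⊕ diagonal N h′
diagonal-⊕ zero    h h′ = ≈-refl
diagonal-⊕ (suc N) h h′ = ≈-trans (⊕-cong ≈-refl (diagonal-⊕ N (h ∘ suc) (h′ ∘ suc)))
  (solve 4 (λ a b x y → a :+ b :+ (x :+ y) := a :+ x :+ (b :+ y)) ≈-refl
    (h 0 (suc N)) (h′ 0 (suc N)) (diagonal N (h ∘ suc)) (diagonal N (h′ ∘ suc)))

diagonal-∙ : ∀ A N {h} → A ∙ diagonal N h ≈ diagonal N (λ i l → A ∙ h i l)
diagonal-∙ A zero    = ≈-refl
diagonal-∙ A (suc N) = ≈-trans (∙-distribˡ A _ _) (⊕-cong ≈-refl (diagonal-∙ A N))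

diagonal-peelʳ : ∀ N h → diagonal (suc N) h ≈ diagonal N (λ i l → h i (suc l)) ⊕ h (suc N) 0
diagonal-peelʳ zero    h = ≈-refl
diagonal-peelʳ (suc N) h = ≈-trans (⊕-cong ≈-refl (diagonal-peelʳ N (h ∘ suc))) (≈-sym (⊕-assoc _ _ _))

module GaussianBinomial (Q : Series) (Q₀≡0 : Q 0 ≡ 0ℤ) where

  pochhammer : ℕ → Series
  pochhammer zero    = ι 1ℤ
  pochhammer (suc n) = pochhammer n ∙ (ι 1ℤ ⊕ ι -1ℤ ∙ Q ↑ suc n)

  pochhammer-constant : ∀ n → pochhammer n 0 ≡ 1ℤ
  pochhammer-constant zero    = refl
  pochhammer-constant (suc n) = begin
    pochhammer (suc n) 0                                     ≡⟨ ∙-constant (pochhammer n) _ ⟩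
    pochhammer n 0 ℤ.* (ι 1ℤ ⊕ ι -1ℤ ∙ Q ↑ suc n) 0          ≡⟨ cong₂ ℤ._*_ (pochhammer-constant n) (⊕-coeff (ι 1ℤ) _ 0) ⟩
    1ℤ ℤ.* (1ℤ ℤ.+ (ι -1ℤ ∙ Q ↑ suc n) 0)                    ≡⟨ cong (λ x → 1ℤ ℤ.* (1ℤ ℤ.+ x)) (ι-∙ -1ℤ (Q ↑ suc n) 0) ⟩
    1ℤ ℤ.* (1ℤ ℤ.+ -1ℤ ℤ.* (Q ∙ Q ↑ n) 0)
      ≡⟨ cong (λ x → 1ℤ ℤ.* (1ℤ ℤ.+ -1ℤ ℤ.* x)) (trans (∙-constant Q (Q ↑ n)) (cong (ℤ._* (Q ↑ n) 0) Q₀≡0)) ⟩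
    1ℤ                                                       ∎
    where open ≡-Reasoning

  -- [k + l choose k] at Q
  binomial : ℕ → ℕ → Series
  binomial zero    l       = ι 1ℤ
  binomial (suc k) zero    = ι 1ℤ
  binomial (suc k) (suc l) = binomial (suc k) l ⊕ Q ↑ suc l ∙ binomial k (suc l)

  binomial-zeroʳ : ∀ k → binomial k 0 ≈ ι 1ℤ
  binomial-zeroʳ zero    = ≈-refl
  binomial-zeroʳ (suc k) = ≈-refl

  -- Over the common product, Pascal's rule amounts to (1 - y) + y(1 - x) = 1 - xy with x = Q^(k+1)
  -- and y = Q^(l+1).
  binomial-pochhammer : ∀ k l → binomial k l ∙ (pochhammer k ∙ pochhammer l) ≈ pochhammer (k + l)
  binomial-pochhammer zero    l    = solve 1 (λ x → con 1ℤ :* (con 1ℤ :* x) := x) ≈-refl (pochhammer l)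
  binomial-pochhammer (suc k) zero = ≈-trans
    (solve 1 (λ x → con 1ℤ :* (x :* con 1ℤ) := x) ≈-refl (pochhammer (suc k)))
    (≡⇒≈ (cong pochhammer (sym (ℕₚ.+-identityʳ (suc k)))))
  binomial-pochhammer (suc k) (suc l) = begin
    (G₁ ⊕ y ∙ G₂) ∙ (pochhammer (suc k) ∙ pochhammer (suc l))
      ≈⟨ solve 6 (λ g₁ g₂ p r x y → (g₁ :+ y :* g₂) :* (p :* (con 1ℤ :+ con -1ℤ :* x) :* (r :* (con 1ℤ :+ con -1ℤ :* y)))
           := g₁ :* (p :* (con 1ℤ :+ con -1ℤ :* x) :* r) :* (con 1ℤ :+ con -1ℤ :* y)
              :+ y :* (g₂ :* (p :* (r :* (con 1ℤ :+ con -1ℤ :* y)))) :* (con 1ℤ :+ con -1ℤ :* x)) ≈-refl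
           G₁ G₂ (pochhammer k) (pochhammer l) x y ⟩
    G₁ ∙ (pochhammer (suc k) ∙ pochhammer l) ∙ (ι 1ℤ ⊕ ι -1ℤ ∙ y)
      ⊕ y ∙ (G₂ ∙ (pochhammer k ∙ pochhammer (suc l))) ∙ (ι 1ℤ ⊕ ι -1ℤ ∙ x)
      ≈⟨ ⊕-cong (∙-cong (≈-trans (binomial-pochhammer (suc k) l) (≡⇒≈ (cong pochhammer (sym (ℕₚ.+-suc k l))))) ≈-refl)
                (∙-cong (∙-cong ≈-refl (binomial-pochhammer k (suc l))) ≈-refl) ⟩
    P ∙ (ι 1ℤ ⊕ ι -1ℤ ∙ y) ⊕ y ∙ P ∙ (ι 1ℤ ⊕ ι -1ℤ ∙ x)
      ≈⟨ solve 3 (λ p x y → p :* (con 1ℤ :+ con -1ℤ :* y) :+ y :* p :* (con 1ℤ :+ con -1ℤ :* x)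
           := p :* (con 1ℤ :+ con -1ℤ :* (x :* y))) ≈-refl P x y ⟩
    P ∙ (ι 1ℤ ⊕ ι -1ℤ ∙ (x ∙ y))
      ≈⟨ ∙-cong ≈-refl (⊕-cong ≈-refl (∙-cong ≈-refl (≈-sym (↑-+ Q (suc k) (suc l))))) ⟩
    pochhammer (suc k + suc l) ∎
    where
    open ≈-Reasoning
    G₁ = binomial (suc k) l
    G₂ = binomial k (suc l)
    x  = Q ↑ suc k
    y  = Q ↑ suc l
    P  = pochhammer (k + suc l)

  -- Pascal's rule in the definition is lopsided, but the quotient of Pochhammer products is
  -- symmetric, and these products cancel because their constant term is 1. Symmetry then supplies
  -- the second Pascal rule.
  binomial-sym : ∀ k l → binomial k l ≈ binomial l k
  binomial-sym k l = ∙-cancelˡ (pochhammer k) (pochhammer-constant k) $ ∙-cancelˡ (pochhammer l) (pochhammer-constant l) $ begin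
    pochhammer l ∙ (pochhammer k ∙ binomial k l)
      ≈⟨ solve 3 (λ x y g → y :* (x :* g) := g :* (x :* y)) ≈-refl (pochhammer k) (pochhammer l) (binomial k l) ⟩
    binomial k l ∙ (pochhammer k ∙ pochhammer l)  ≈⟨ binomial-pochhammer k l ⟩
    pochhammer (k + l)                            ≡⟨ cong pochhammer (ℕₚ.+-comm k l) ⟩
    pochhammer (l + k)                            ≈⟨ ≈-sym (binomial-pochhammer l k) ⟩
    binomial l k ∙ (pochhammer l ∙ pochhammer k)
      ≈⟨ solve 3 (λ x y g → g :* (y :* x) := y :* (x :* g)) ≈-refl (pochhammer k) (pochhammer l) (binomial l k) ⟩
    pochhammer l ∙ (pochhammer k ∙ binomial l k)  ∎
    where open ≈-Reasoning

  binomial-pascal′ : ∀ k l → binomial (suc k) (suc l) ≈ binomial k (suc l) ⊕ Q ↑ suc k ∙ binomial (suc k) l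
  binomial-pascal′ k l = ≈-trans (binomial-sym (suc k) (suc l))
    (⊕-cong (binomial-sym (suc l) k) (∙-cong ≈-refl (binomial-sym l (suc k))))

  module _ (u : ℕ → Series) (v : Series) where

    -- The new factor 1 + v adds to each term its translate: `v` carries `u i` to `u (suc i)` up to
    -- the power Q^l, which is precisely the weight in Pascal's rule. The sum grows at its upper
    -- end.
    diagonal-stepʳ : ∀ N → (∀ i l → i + l ≡ N → v ∙ u i ≈ Q ↑ l ∙ u (suc i)) →
      diagonal N (λ i l → binomial i l ∙ u i) ∙ (ι 1ℤ ⊕ v) ≈ diagonal (suc N) (λ i l → binomial i l ∙ u i)
    diagonal-stepʳ N vu = ≈-sym (begin
      diagonal (suc N) (λ i l → binomial i l ∙ u i)  ≈⟨ diagonal-cong (suc N) split ⟩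
      diagonal (suc N) (λ i l → α i l ⊕ β i l)       ≈⟨ diagonal-⊕ (suc N) α β ⟩
      diagonal (suc N) α ⊕ (ι 0ℤ ⊕ diagonal N (β ∘ suc))
        ≈⟨ ⊕-cong (≈-trans (diagonal-peelʳ N α) (⊕-identityʳ D))
                  (≈-trans (⊕-identityˡ _) (≈-trans (diagonal-cong N Qu) (≈-sym (diagonal-∙ v N)))) ⟩
      D ⊕ v ∙ D                                      ≈⟨ solve 2 (λ d v → d :+ v :* d := d :* (con 1ℤ :+ v)) ≈-refl D v ⟩
      D ∙ (ι 1ℤ ⊕ v)                                 ∎)
      where
      open ≈-Reasoning
      D = diagonal N (λ i l → binomial i l ∙ u i)
      -- `α` and `β` are the two halves of Pascal's rule. `α` is zero at l = 0 and `β` at i = 0, so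
      -- each is really a sum over the shorter diagonal.
      α β : ℕ → ℕ → Series
      α i zero    = ι 0ℤ
      α i (suc l) = binomial i l ∙ u i
      β zero    l = ι 0ℤ
      β (suc i) l = binomial i l ∙ (Q ↑ l ∙ u (suc i))
      split : ∀ i l → i + l ≡ suc N → binomial i l ∙ u i ≈ α i l ⊕ β i l
      split zero    (suc l) _ = ≈-sym (⊕-identityʳ _)
      split (suc i) zero    _ = ≈-trans
        (solve 1 (λ u → con 1ℤ :* u := con 0ℤ :+ con 1ℤ :* (con 1ℤ :* u)) ≈-refl (u (suc i)))
        (⊕-cong ≈-refl (∙-cong (≈-sym (binomial-zeroʳ i)) ≈-refl))
      split (suc i) (suc l) _ = solve 4 (λ g h y u → (g :+ y :* h) :* u := g :* u :+ h :* (y :* u)) ≈-refl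
        (binomial (suc i) l) (binomial i (suc l)) (Q ↑ suc l) (u (suc i))
      Qu : ∀ i l → i + l ≡ N → β (suc i) l ≈ v ∙ (binomial i l ∙ u i)
      Qu i l e = ≈-trans (∙-cong ≈-refl (≈-sym (vu i l e)))
        (solve 3 (λ g v u → g :* (v :* u) := v :* (g :* u)) ≈-refl (binomial i l) v (u i))

    -- Growth at the lower end: now `v` carries `u (suc i)` back to `u i` with weight Q^i, which
    -- calls for the other Pascal rule.
    diagonal-stepˡ : ∀ N → (∀ i l → i + l ≡ N → v ∙ u (suc i) ≈ Q ↑ i ∙ u i) →
      diagonal N (λ i l → binomial i l ∙ u (suc i)) ∙ (ι 1ℤ ⊕ v) ≈ diagonal (suc N) (λ i l → binomial i l ∙ u i)
    diagonal-stepˡ N vu = ≈-sym (begin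
      diagonal (suc N) (λ i l → binomial i l ∙ u i)  ≈⟨ diagonal-cong (suc N) split ⟩
      diagonal (suc N) (λ i l → α i l ⊕ β i l)       ≈⟨ diagonal-⊕ (suc N) α β ⟩
      diagonal (suc N) α ⊕ (ι 0ℤ ⊕ D)
        ≈⟨ ⊕-cong (≈-trans (diagonal-peelʳ N α) (≈-trans (⊕-identityʳ _) (≈-trans (diagonal-cong N Qu) (≈-sym (diagonal-∙ v N)))))
                  (⊕-identityˡ D) ⟩
      v ∙ D ⊕ D                                      ≈⟨ solve 2 (λ d v → v :* d :+ d := d :* (con 1ℤ :+ v)) ≈-refl D v ⟩
      D ∙ (ι 1ℤ ⊕ v)                                 ∎)
      where
      open ≈-Reasoning
      D = diagonal N (λ i l → binomial i l ∙ u (suc i))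
      α β : ℕ → ℕ → Series
      α i zero    = ι 0ℤ
      α i (suc l) = binomial i l ∙ (Q ↑ i ∙ u i)
      β zero    l = ι 0ℤ
      β (suc i) l = binomial i l ∙ u (suc i)
      split : ∀ i l → i + l ≡ suc N → binomial i l ∙ u i ≈ α i l ⊕ β i l
      split zero    (suc l) _ = solve 1 (λ u → con 1ℤ :* u := con 1ℤ :* (con 1ℤ :* u) :+ con 0ℤ) ≈-refl (u 0)
      split (suc i) zero    _ = ≈-trans (∙-cong (≈-sym (binomial-zeroʳ i)) ≈-refl) (≈-sym (⊕-identityˡ _))
      split (suc i) (suc l) _ = ≈-trans (∙-cong (binomial-pascal′ i l) ≈-refl)
        (solve 4 (λ g h y u → (h :+ y :* g) :* u := g :* (y :* u) :+ h :* u) ≈-refl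
          (binomial (suc i) l) (binomial i (suc l)) (Q ↑ suc i) (u (suc i)))
      Qu : ∀ i l → i + l ≡ N → α i (suc l) ≈ v ∙ (binomial i l ∙ u (suc i))
      Qu i l e = ≈-trans (∙-cong ≈-refl (≈-sym (vu i l e)))
        (solve 3 (λ g v u → g :* (v :* u) := v :* (g :* u)) ≈-refl (binomial i l) v (u (suc i)))

  rising : Series → ℕ → Series
  rising z zero    = ι 1ℤ
  rising z (suc n) = rising z n ∙ (ι 1ℤ ⊕ z ∙ Q ↑ n)

  -- z^j Q^(j(j-1)/2)
  term : Series → ℕ → Series
  term z zero    = ι 1ℤ
  term z (suc j) = z ∙ Q ↑ j ∙ term z j

  module _ (z w : Series) (zw≈Q : z ∙ w ≈ Q) where

    -- The terms of the bilateral series ∑_j z^j Q^(j(j-1)/2), in which z^-j Q^(j(j+1)/2) = w^j Q^(j(j-1)/2),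
    -- listed from index j = -t on.
    bilateral : ℕ → ℕ → Series
    bilateral zero    i       = term z i
    bilateral (suc t) zero    = term w (suc t)
    bilateral (suc t) (suc i) = bilateral t i

    bilateral-first : ∀ t → bilateral t 0 ≈ term w t
    bilateral-first zero    = ≈-refl
    bilateral-first (suc t) = ≈-refl

    -- The term of index j + 1 is z Q^j times that of index j. Here j = i - t, and i + l = s + t
    -- gives s = j + l. At negative j the ratio consumes a factor w, through zw = Q.
    bilateral-z : ∀ s t i l → i + l ≡ s + t → z ∙ Q ↑ s ∙ bilateral t i ≈ Q ↑ l ∙ bilateral t (suc i)
    bilateral-z s zero i l e = begin
      z ∙ Q ↑ s ∙ term z i             ≡⟨ cong (λ k → z ∙ Q ↑ k ∙ term z i) (sym (trans e (ℕₚ.+-identityʳ s))) ⟩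
      z ∙ Q ↑ (i + l) ∙ term z i       ≈⟨ ∙-cong (∙-cong ≈-refl (↑-+ Q i l)) ≈-refl ⟩
      z ∙ (Q ↑ i ∙ Q ↑ l) ∙ term z i
        ≈⟨ solve 4 (λ z x y u → z :* (x :* y) :* u := y :* (z :* x :* u)) ≈-refl z (Q ↑ i) (Q ↑ l) (term z i) ⟩
      Q ↑ l ∙ (z ∙ Q ↑ i ∙ term z i)   ∎
      where open ≈-Reasoning
    bilateral-z s (suc t) zero l e = begin
      z ∙ Q ↑ s ∙ (w ∙ Q ↑ t ∙ term w t)
        ≈⟨ solve 5 (λ z w x y u → z :* x :* (w :* y :* u) := x :* (z :* w :* y) :* u) ≈-refl z w (Q ↑ s) (Q ↑ t) (term w t) ⟩
      Q ↑ s ∙ (z ∙ w ∙ Q ↑ t) ∙ term w t  ≈⟨ ∙-cong (∙-cong ≈-refl (∙-cong zw≈Q ≈-refl)) (≈-sym (bilateral-first t)) ⟩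
      Q ↑ s ∙ Q ↑ suc t ∙ bilateral t 0   ≈⟨ ∙-cong (≈-sym (↑-+ Q s (suc t))) ≈-refl ⟩
      Q ↑ (s + suc t) ∙ bilateral t 0     ≡⟨ cong (λ k → Q ↑ k ∙ bilateral t 0) (sym e) ⟩
      Q ↑ l ∙ bilateral t 0               ∎
      where open ≈-Reasoning
    bilateral-z s (suc t) (suc i) l e = bilateral-z s t i l (ℕₚ.suc-injective (trans e (ℕₚ.+-suc s t)))

    -- The reverse step, from index j = i - t to j - 1: the ratio is w Q^(-j), and t = i - j clears
    -- the negative power.
    bilateral-w : ∀ t i l → i + l ≡ t → w ∙ Q ↑ t ∙ bilateral t i ≈ Q ↑ i ∙ bilateral (suc t) i
    bilateral-w zero    zero    l e = ≈-sym (∙-identityˡ _)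
    bilateral-w (suc t) zero    l e = ≈-sym (∙-identityˡ _)
    bilateral-w (suc t) (suc i) l e = begin
      w ∙ (Q ∙ Q ↑ t) ∙ bilateral t i
        ≈⟨ solve 4 (λ w q x u → w :* (q :* x) :* u := q :* (w :* x :* u)) ≈-refl w Q (Q ↑ t) (bilateral t i) ⟩
      Q ∙ (w ∙ Q ↑ t ∙ bilateral t i)      ≈⟨ ∙-cong ≈-refl (bilateral-w t i l (ℕₚ.suc-injective e)) ⟩
      Q ∙ (Q ↑ i ∙ bilateral (suc t) i)    ≈⟨ ≈-sym (∙-assoc Q _ _) ⟩
      Q ↑ suc i ∙ bilateral (suc t) i      ∎
      where open ≈-Reasoning

    -- A further factor in z appends a term at the upper end of the bilateral sum, a further factor
    -- in w one at the lower end.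
    finite-triple-product : ∀ s t →
      rising z s ∙ rising w t ≈ diagonal (s + t) (λ i l → binomial i l ∙ bilateral t i)
    finite-triple-product zero    zero    = ≈-refl
    finite-triple-product zero    (suc t) = begin
      ι 1ℤ ∙ (rising w t ∙ (ι 1ℤ ⊕ w ∙ Q ↑ t))  ≈⟨ ≈-sym (∙-assoc _ _ _) ⟩
      ι 1ℤ ∙ rising w t ∙ (ι 1ℤ ⊕ w ∙ Q ↑ t)    ≈⟨ ∙-cong (finite-triple-product zero t) ≈-refl ⟩
      diagonal t (λ i l → binomial i l ∙ bilateral t i) ∙ (ι 1ℤ ⊕ w ∙ Q ↑ t)
        ≈⟨ diagonal-stepˡ (bilateral (suc t)) _ t (bilateral-w t) ⟩
      diagonal (suc t) (λ i l → binomial i l ∙ bilateral (suc t) i)  ∎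
      where open ≈-Reasoning
    finite-triple-product (suc s) t = begin
      rising z s ∙ (ι 1ℤ ⊕ z ∙ Q ↑ s) ∙ rising w t
        ≈⟨ solve 3 (λ x v y → x :* v :* y := x :* y :* v) ≈-refl (rising z s) (ι 1ℤ ⊕ z ∙ Q ↑ s) (rising w t) ⟩
      rising z s ∙ rising w t ∙ (ι 1ℤ ⊕ z ∙ Q ↑ s)    ≈⟨ ∙-cong (finite-triple-product s t) ≈-refl ⟩
      diagonal (s + t) (λ i l → binomial i l ∙ bilateral t i) ∙ (ι 1ℤ ⊕ z ∙ Q ↑ s)
        ≈⟨ diagonal-stepʳ (bilateral t) _ (s + t) (bilateral-z s t) ⟩
      diagonal (suc s + t) (λ i l → binomial i l ∙ bilateral t i)  ∎
      where open ≈-Reasoning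

    symmetric-sum : ℕ → Series
    symmetric-sum n = diagonal (n + n) (λ i _ → bilateral n i)

    symmetric-sum-suc : ∀ n → symmetric-sum (suc n) ≈ symmetric-sum n ⊕ (term z (suc n) ⊕ term w (suc n))
    symmetric-sum-suc n = begin
      term w (suc n) ⊕ diagonal (n + suc n) (λ i _ → bilateral n i)
        ≡⟨ cong (λ k → term w (suc n) ⊕ diagonal k (λ i _ → bilateral n i)) (ℕₚ.+-suc n n) ⟩
      term w (suc n) ⊕ diagonal (suc (n + n)) (λ i _ → bilateral n i)
        ≈⟨ ⊕-cong ≈-refl (diagonal-peelʳ (n + n) (λ i _ → bilateral n i)) ⟩
      term w (suc n) ⊕ (symmetric-sum n ⊕ bilateral n (suc (n + n)))
        ≡⟨ cong (λ x → term w (suc n) ⊕ (symmetric-sum n ⊕ x)) (last n) ⟩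
      term w (suc n) ⊕ (symmetric-sum n ⊕ term z (suc n))
        ≈⟨ solve 3 (λ x y s → y :+ (s :+ x) := s :+ (x :+ y)) ≈-refl (term z (suc n)) (term w (suc n)) (symmetric-sum n) ⟩
      symmetric-sum n ⊕ (term z (suc n) ⊕ term w (suc n)) ∎
      where
      open ≈-Reasoning
      last : ∀ n {j} → bilateral n (suc (n + j)) ≡ term z (suc j)
      last zero    = refl
      last (suc n) = last n

-- Jacobi's triple product

triangular : ℕ → ℕ
triangular zero    = 0
triangular (suc n) = triangular n + n

-- This crude bound suffices in `absorb`: at index j the precision r + 1 has to be raised to r + j,
-- hence by j - 1.
triangular-bound : ∀ n → n ≤ suc (triangular n)
triangular-bound zero          = z≤n
triangular-bound (suc zero)    = s≤s z≤n
triangular-bound (suc (suc n)) = s≤s (ℕₚ.m≤n+m (suc n) (triangular n + n))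

exponent : ℕ → ℕ → ℕ → ℕ
exponent a b j = a * triangular j + b * j

exponent-suc : ∀ a b j → b + a * j + exponent a b j ≡ exponent a b (suc j)
exponent-suc a b j = identity a b j (triangular j)
  where
  identity : ∀ a b j t → b + a * j + (a * t + b * j) ≡ a * (t + j) + b * (1 + j)
  identity = ℕ-RingSolver.solve-∀

q^-↑ : ∀ a n → (q^ a) ↑ n ≈ q^ (a * n)
q^-↑ a zero    = ≈-trans (≈-sym q^0≈1) (≡⇒≈ (cong q^_ (sym (ℕₚ.*-zeroʳ a))))
q^-↑ a (suc n) = ≈-trans (∙-cong ≈-refl (q^-↑ a n))
  (≈-trans (≈-sym (q^-+ a (a * n))) (≡⇒≈ (cong q^_ (sym (ℕₚ.*-suc a n)))))

theta-summand : ℤ → ℕ → ℕ → ℕ → Series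
theta-summand ε b c j =
  ι (ε ℤ.^ j) ∙ q^ exponent (b + c) b j ⊕ ι (ε ℤ.^ suc j) ∙ q^ exponent (b + c) c (suc j)

-- The sum of ε^j q^((b+c)j(j-1)/2+bj) over -n ≤ j < n; the index -j-1 is paired with j.
theta : ℤ → ℕ → ℕ → ℕ → Series
theta ε b c zero    = ι 0ℤ
theta ε b c (suc n) = theta ε b c n ⊕ theta-summand ε b c n

-- ε² = 1 gives zw = Q. `c` may be 0, as it is for ψ; the product side then contains the factor 1 +
-- ε. Positivity of `b` makes the leftover top term small in `term-small`.
module TripleProduct (ε : ℤ) (ε²≡1 : ε ℤ.* ε ≡ 1ℤ) (b c : ℕ) .{{_ : NonZero b}} .{{_ : NonZero (b + c)}} where

  private
    a = b + c
    Q = q^ a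
    z = ι ε ∙ q^ b
    w = ι ε ∙ q^ c

  open GaussianBinomial Q (q^-below (ℕ.>-nonZero⁻¹ a))

  zw≈Q : z ∙ w ≈ Q
  zw≈Q = begin
    ι ε ∙ q^ b ∙ (ι ε ∙ q^ c)    ≈⟨ solve 3 (λ e x y → e :* x :* (e :* y) := e :* e :* (x :* y)) ≈-refl (ι ε) (q^ b) (q^ c) ⟩
    ι ε ∙ ι ε ∙ (q^ b ∙ q^ c)    ≈⟨ ∙-cong (≈-sym (ι-* ε ε)) (≈-sym (q^-+ b c)) ⟩
    ι (ε ℤ.* ε) ∙ Q              ≡⟨ cong (λ k → ι k ∙ Q) ε²≡1 ⟩
    ι 1ℤ ∙ Q                     ≈⟨ ∙-identityˡ Q ⟩
    Q                            ∎
    where open ≈-Reasoning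

  term-monomial : ∀ d j → term (ι ε ∙ q^ d) j ≈ ι (ε ℤ.^ j) ∙ q^ exponent a d j
  term-monomial d zero    = ≈-sym (≈-trans (∙-identityˡ _)
    (≈-trans (≡⇒≈ (cong q^_ (cong₂ _+_ (ℕₚ.*-zeroʳ a) (ℕₚ.*-zeroʳ d)))) q^0≈1))
  term-monomial d (suc j) = begin
    ι ε ∙ q^ d ∙ Q ↑ j ∙ term (ι ε ∙ q^ d) j
      ≈⟨ ∙-cong (∙-cong ≈-refl (q^-↑ a j)) (term-monomial d j) ⟩
    ι ε ∙ q^ d ∙ q^ (a * j) ∙ (ι (ε ℤ.^ j) ∙ q^ exponent a d j)
      ≈⟨ solve 5 (λ e x y k v → e :* x :* y :* (k :* v) := e :* k :* (x :* y :* v)) ≈-refl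
           (ι ε) (q^ d) (q^ (a * j)) (ι (ε ℤ.^ j)) (q^ exponent a d j) ⟩
    ι ε ∙ ι (ε ℤ.^ j) ∙ (q^ d ∙ q^ (a * j) ∙ q^ exponent a d j)
      ≈⟨ ∙-cong (≈-sym (ι-* ε (ε ℤ.^ j))) (≈-trans (∙-cong (≈-sym (q^-+ d (a * j))) ≈-refl)
           (≈-trans (≈-sym (q^-+ (d + a * j) _)) (≡⇒≈ (cong q^_ (exponent-suc a d j))))) ⟩
    ι (ε ℤ.^ suc j) ∙ q^ exponent a d (suc j) ∎
    where open ≈-Reasoning

  rising-products : ∀ d n → rising (ι ε ∙ q^ d) n ≈ products ε a d n
  rising-products d zero    = ≈-refl
  rising-products d (suc n) = ∙-cong (rising-products d n) (⊕-cong ≈-refl (begin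
    ι ε ∙ q^ d ∙ Q ↑ n           ≈⟨ ∙-cong ≈-refl (q^-↑ a n) ⟩
    ι ε ∙ q^ d ∙ q^ (a * n)      ≈⟨ solve 3 (λ e x y → e :* x :* y := e :* (y :* x)) ≈-refl (ι ε) (q^ d) (q^ (a * n)) ⟩
    ι ε ∙ (q^ (a * n) ∙ q^ d)    ≈⟨ ∙-cong ≈-refl (≈-sym (q^-+ (a * n) d)) ⟩
    ι ε ∙ q^ (a * n + d)         ∎))
    where open ≈-Reasoning

  pochhammer-products : ∀ n → pochhammer n ≈ products -1ℤ a a n
  pochhammer-products zero    = ≈-refl
  pochhammer-products (suc n) = ∙-cong (pochhammer-products n) (⊕-cong ≈-refl (∙-cong ≈-refl
    (≈-trans (q^-↑ a (suc n)) (≡⇒≈ (cong q^_ (trans (ℕₚ.*-suc a n) (ℕₚ.+-comm a (a * n))))))))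

  pochhammer-limit : ∀ {r} n → r ≤ n → pochhammer n ≈[ suc r ] f a
  pochhammer-limit n r≤n = Mod.trans (≈⇒≈[] (pochhammer-products n))
    (Mod.trans (weaken (s≤s r≤n) (products-limit -1ℤ a a n)) (≈⇒≈[] (≈-sym (f≈product∞ a))))

  -- As i and l grow, the Gaussian binomial tends to the reciprocal of the infinite product, and the
  -- smaller of the two indices governs the precision.
  binomial-limit : ∀ {r} i l → r ≤ i → r ≤ l → f a ∙ binomial i l ≈[ suc r ] ι 1ℤ
  binomial-limit {r} i l r≤i r≤l =
    ∙-cancelˡ[] (pochhammer-constant i) $ ∙-cancelˡ[] (pochhammer-constant l) $ begin
    pochhammer l ∙ (pochhammer i ∙ (f a ∙ binomial i l))
      ≈⟨ ≈⇒≈[] (solve 4 (λ x y u g → y :* (x :* (u :* g)) := u :* (g :* (x :* y))) ≈-refl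
           (pochhammer i) (pochhammer l) (f a) (binomial i l)) ⟩
    f a ∙ (binomial i l ∙ (pochhammer i ∙ pochhammer l))  ≈⟨ ≈⇒≈[] (∙-cong ≈-refl (binomial-pochhammer i l)) ⟩
    f a ∙ pochhammer (i + l)
      ≈⟨ ∙-cong[] (Mod.sym (pochhammer-limit l r≤l)) (pochhammer-limit (i + l) (ℕₚ.≤-trans r≤i (ℕₚ.m≤m+n i l))) ⟩
    pochhammer l ∙ f a                                    ≈⟨ ∙-cong[] Mod.refl (Mod.sym (pochhammer-limit i r≤i)) ⟩
    pochhammer l ∙ pochhammer i                           ≈⟨ ∙-cong[] Mod.refl (≈⇒≈[] (≈-sym (∙-identityʳ _))) ⟩
    pochhammer l ∙ (pochhammer i ∙ ι 1ℤ)                  ∎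
    where open Mod-Reasoning (suc r)

  -- At distance j from the centre the shorter side of the binomial is only r = n - j, so the
  -- binomial is under control only modulo q^(r+1). The term itself carries q^e with e at least j -
  -- 1, which restores precision n.
  absorb : ∀ {n r j A d} → r + j ≡ n → A ≈[ suc r ] ι 1ℤ → A ∙ term (ι ε ∙ q^ d) j ≈[ n ] term (ι ε ∙ q^ d) j
  absorb {n} {r} {j} {A} {d} r+j≡n p = begin
    A ∙ term (ι ε ∙ q^ d) j  ≈⟨ ≈⇒≈[] (∙-cong ≈-refl (term-monomial d j)) ⟩
    A ∙ (κ ∙ q^ e)           ≈⟨ ≈⇒≈[] (solve 3 (λ a k x → a :* (k :* x) := k :* (x :* a)) ≈-refl A κ (q^ e)) ⟩
    κ ∙ (q^ e ∙ A)           ≈⟨ ∙-cong[] Mod.refl (weaken n≤ (q^-cong[] e p)) ⟩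
    κ ∙ (q^ e ∙ ι 1ℤ)        ≈⟨ ≈⇒≈[] (∙-cong ≈-refl (∙-identityʳ _)) ⟩
    κ ∙ q^ e                 ≈⟨ ≈⇒≈[] (≈-sym (term-monomial d j)) ⟩
    term (ι ε ∙ q^ d) j      ∎
    where
    open Mod-Reasoning n
    κ = ι (ε ℤ.^ j)
    e = exponent a d j
    j≤ : j ≤ suc e
    j≤ = ℕₚ.≤-trans (triangular-bound j) (s≤s (ℕₚ.≤-trans (ℕₚ.m≤n*m (triangular j) a) (ℕₚ.m≤m+n _ (d * j))))
    n≤ : n ≤ e + suc r
    n≤ = subst (_≤ e + suc r) r+j≡n (ℕₚ.≤-trans (ℕₚ.+-monoʳ-≤ r j≤)
      (ℕₚ.≤-reflexive (trans (ℕₚ.+-suc r e) (trans (cong suc (ℕₚ.+-comm r e)) (sym (ℕₚ.+-suc e r))))))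

  bilateral-right : ∀ n j → bilateral z w zw≈Q n (n + j) ≡ term z j
  bilateral-right zero    j = refl
  bilateral-right (suc n) j = bilateral-right n j

  bilateral-left : ∀ i j → bilateral z w zw≈Q (i + j) i ≈ term w j
  bilateral-left zero    j = bilateral-first z w zw≈Q j
  bilateral-left (suc i) j = bilateral-left i j

  absorb-bilateral : ∀ n i l → i + l ≡ n + n →
    f a ∙ (binomial i l ∙ bilateral z w zw≈Q n i) ≈[ n ] bilateral z w zw≈Q n i
  absorb-bilateral n i l i+l≡2n = Mod.trans (≈⇒≈[] (≈-sym (∙-assoc _ _ _))) (case (ℕₚ.≤-total n i))
    where
    -- The bilateral index i - n is j or -j. The shorter side of the binomial is l in the right half
    -- and i in the left, of length n - j either way.
    case : n ≤ i ⊎ i ≤ n → f a ∙ binomial i l ∙ bilateral z w zw≈Q n i ≈[ n ] bilateral z w zw≈Q n i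
    case (inj₁ n≤i) = subst (λ u → f a ∙ binomial i l ∙ u ≈[ n ] u)
      (trans (sym (bilateral-right n j)) (cong (bilateral z w zw≈Q n) (ℕₚ.m+[n∸m]≡n n≤i)))
      (absorb {d = b} l+j≡n (binomial-limit i l (ℕₚ.≤-trans l≤n n≤i) ℕₚ.≤-refl))
      where
      j = i ∸ n
      l+j≡n : l + j ≡ n
      l+j≡n = ℕₚ.+-cancelˡ-≡ n _ _ (begin
        n + (l + j)  ≡⟨ cong (_+_ n) (ℕₚ.+-comm l j) ⟩
        n + (j + l)  ≡⟨ sym (ℕₚ.+-assoc n j l) ⟩
        n + j + l    ≡⟨ cong (_+ l) (ℕₚ.m+[n∸m]≡n n≤i) ⟩
        i + l        ≡⟨ i+l≡2n ⟩
        n + n        ∎)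
        where open ≡-Reasoning
      l≤n : l ≤ n
      l≤n = subst (l ≤_) l+j≡n (ℕₚ.m≤m+n l j)
    case (inj₂ i≤n) = Mod.trans (∙-cong[] Mod.refl (≈⇒≈[] u≈)) (Mod.trans
      (absorb {d = c} i+j≡n (binomial-limit i l ℕₚ.≤-refl (ℕₚ.≤-trans i≤n n≤l))) (≈⇒≈[] (≈-sym u≈)))
      where
      j = n ∸ i
      i+j≡n : i + j ≡ n
      i+j≡n = ℕₚ.m+[n∸m]≡n i≤n
      u≈ : bilateral z w zw≈Q n i ≈ term w j
      u≈ = subst (λ k → bilateral z w zw≈Q k i ≈ term w j) i+j≡n (bilateral-left i j)
      n≤l : n ≤ l
      n≤l = ℕₚ.+-cancelˡ-≤ n _ _ (subst (_≤ n + l) i+l≡2n (ℕₚ.+-monoˡ-≤ l i≤n))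

  -- The bilateral sum runs over -n ≤ j ≤ n, whereas `theta` stops before n so that j pairs with
  -- -j-1. The excess term at j = n disappears in the limit.
  symmetric-sum-theta : ∀ n → symmetric-sum z w zw≈Q n ≈ theta ε b c n ⊕ term z n
  symmetric-sum-theta zero    = ≈-sym (⊕-identityˡ _)
  symmetric-sum-theta (suc n) = begin
    symmetric-sum z w zw≈Q (suc n)                               ≈⟨ symmetric-sum-suc z w zw≈Q n ⟩
    symmetric-sum z w zw≈Q n ⊕ (term z (suc n) ⊕ term w (suc n)) ≈⟨ ⊕-cong (symmetric-sum-theta n) ≈-refl ⟩
    theta ε b c n ⊕ term z n ⊕ (term z (suc n) ⊕ term w (suc n))
      ≈⟨ solve 4 (λ s x y t → s :+ x :+ (y :+ t) := s :+ (x :+ t) :+ y) ≈-refl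
           (theta ε b c n) (term z n) (term z (suc n)) (term w (suc n)) ⟩
    theta ε b c n ⊕ (term z n ⊕ term w (suc n)) ⊕ term z (suc n)
      ≈⟨ ⊕-cong (⊕-cong ≈-refl (⊕-cong (term-monomial b n) (term-monomial c (suc n)))) ≈-refl ⟩
    theta ε b c (suc n) ⊕ term z (suc n)                         ∎
    where open ≈-Reasoning

  term-small : ∀ n → term z n ≈[ n ] ι 0ℤ
  term-small n = Mod.trans (≈⇒≈[] (term-monomial b n)) (Mod.trans
    (∙-cong[] Mod.refl (q^≈[]0 (ℕₚ.≤-trans (ℕₚ.m≤n*m n b) (ℕₚ.m≤n+m (b * n) (a * triangular n)))))
    (≈⇒≈[] (∙-zeroʳ _)))

  triple-product : ∀ n → theta ε b c n ≈[ n ] f a ∙ (products ε a b n ∙ products ε a c n)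
  triple-product n = Mod.sym (begin
    f a ∙ (products ε a b n ∙ products ε a c n)
      ≈⟨ ≈⇒≈[] (∙-cong ≈-refl (∙-cong (≈-sym (rising-products b n)) (≈-sym (rising-products c n)))) ⟩
    f a ∙ (rising z n ∙ rising w n)                    ≈⟨ ≈⇒≈[] (∙-cong ≈-refl (finite-triple-product z w zw≈Q n n)) ⟩
    f a ∙ diagonal (n + n) (λ i l → binomial i l ∙ bilateral z w zw≈Q n i)
      ≈⟨ ≈⇒≈[] (diagonal-∙ (f a) (n + n)) ⟩
    diagonal (n + n) (λ i l → f a ∙ (binomial i l ∙ bilateral z w zw≈Q n i))
      ≈⟨ diagonal-cong[] (n + n) (absorb-bilateral n) ⟩
    symmetric-sum z w zw≈Q n                           ≈⟨ ≈⇒≈[] (symmetric-sum-theta n) ⟩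
    theta ε b c n ⊕ term z n                           ≈⟨ ⊕-cong[] Mod.refl (term-small n) ⟩
    theta ε b c n ⊕ ι 0ℤ                               ≈⟨ ≈⇒≈[] (⊕-identityʳ _) ⟩
    theta ε b c n                                      ∎)
    where open Mod-Reasoning n

-- Splitting products by residue classes of the factors

products-split₂ : ∀ ε e d n → products ε e d (n * 2) ≈ products ε (e * 2) d n ∙ products ε (e * 2) (e + d) n
products-split₂ ε e d zero    = ≈-sym (∙-identityˡ _)
products-split₂ ε e d (suc n) = ≈-trans
  (∙-cong (∙-cong (products-split₂ ε e d n) (factor (e₀ e d n))) (factor (e₁ e d n)))
  (solve 4 (λ x y u v → x :* y :* u :* v := x :* u :* (y :* v)) ≈-refl
    (products ε (e * 2) d n) (products ε (e * 2) (e + d) n) _ _)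
  where
  factor : ∀ {x y} → x ≡ y → ι 1ℤ ⊕ ι ε ∙ q^ x ≈ ι 1ℤ ⊕ ι ε ∙ q^ y
  factor p = ≡⇒≈ (cong (λ x → ι 1ℤ ⊕ ι ε ∙ q^ x) p)
  e₀ : ∀ e d n → e * (n * 2) + d ≡ e * 2 * n + d
  e₀ = ℕ-RingSolver.solve-∀
  e₁ : ∀ e d n → e * (1 + n * 2) + d ≡ e * 2 * n + (e + d)
  e₁ = ℕ-RingSolver.solve-∀

products-split₃ : ∀ ε e d n → products ε e d (n * 3) ≈
  products ε (e * 3) d n ∙ products ε (e * 3) (e + d) n ∙ products ε (e * 3) (e + (e + d)) n
products-split₃ ε e d zero    = solve 0 (con 1ℤ := con 1ℤ :* con 1ℤ :* con 1ℤ) ≈-refl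
products-split₃ ε e d (suc n) = ≈-trans
  (∙-cong (∙-cong (∙-cong (products-split₃ ε e d n) (factor (e₀ e d n))) (factor (e₁ e d n))) (factor (e₂ e d n)))
  (solve 6 (λ x y z u v w → x :* y :* z :* u :* v :* w := x :* u :* (y :* v) :* (z :* w)) ≈-refl
    (products ε (e * 3) d n) (products ε (e * 3) (e + d) n) (products ε (e * 3) (e + (e + d)) n) _ _ _)
  where
  factor : ∀ {x y} → x ≡ y → ι 1ℤ ⊕ ι ε ∙ q^ x ≈ ι 1ℤ ⊕ ι ε ∙ q^ y
  factor p = ≡⇒≈ (cong (λ x → ι 1ℤ ⊕ ι ε ∙ q^ x) p)
  e₀ : ∀ e d n → e * (n * 3) + d ≡ e * 3 * n + d
  e₀ = ℕ-RingSolver.solve-∀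
  e₁ : ∀ e d n → e * (1 + n * 3) + d ≡ e * 3 * n + (e + d)
  e₁ = ℕ-RingSolver.solve-∀
  e₂ : ∀ e d n → e * (2 + n * 3) + d ≡ e * 3 * n + (e + (e + d))
  e₂ = ℕ-RingSolver.solve-∀

products-square : ∀ e d n → products 1ℤ e d n ∙ products -1ℤ e d n ≈ products -1ℤ (e * 2) (d * 2) n
products-square e d zero    = ∙-identityˡ _
products-square e d (suc n) = begin
  products 1ℤ e d n ∙ (ι 1ℤ ⊕ ι 1ℤ ∙ x) ∙ (products -1ℤ e d n ∙ (ι 1ℤ ⊕ ι -1ℤ ∙ x))
    ≈⟨ solve 3 (λ p r x → p :* (con 1ℤ :+ con 1ℤ :* x) :* (r :* (con 1ℤ :+ con -1ℤ :* x)) := p :* r :* (con 1ℤ :+ con -1ℤ :* (x :* x)))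
         ≈-refl (products 1ℤ e d n) (products -1ℤ e d n) x ⟩
  products 1ℤ e d n ∙ products -1ℤ e d n ∙ (ι 1ℤ ⊕ ι -1ℤ ∙ (x ∙ x))
    ≈⟨ ∙-cong (products-square e d n) (⊕-cong ≈-refl (∙-cong ≈-refl
         (≈-trans (≈-sym (q^-+ (e * n + d) (e * n + d))) (≡⇒≈ (cong q^_ (double e d n)))))) ⟩
  products -1ℤ (e * 2) (d * 2) (suc n) ∎
  where
  open ≈-Reasoning
  x = q^ (e * n + d)
  double : ∀ e d n → e * n + d + (e * n + d) ≡ e * 2 * n + d * 2
  double = ℕ-RingSolver.solve-∀

module _ (ε : ℤ) (e d : ℕ) .{{_ : NonZero e}} .{{_ : NonZero d}} where

  product∞-split₂ : .{{_ : NonZero (e * 2)}} .{{_ : NonZero (e + d)}} →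
    product∞ ε e d ≈ product∞ ε (e * 2) d ∙ product∞ ε (e * 2) (e + d)
  product∞-split₂ = ⟶-unique (⟶-subsequence 2 (products⟶ ε e d))
    (⟶-cong (λ n → ≈-sym (products-split₂ ε e d n))
      (⟶-∙ (products⟶ ε (e * 2) d) (products⟶ ε (e * 2) (e + d))))

  product∞-split₃ : .{{_ : NonZero (e * 3)}} .{{_ : NonZero (e + d)}} .{{_ : NonZero (e + (e + d))}} →
    product∞ ε e d ≈ product∞ ε (e * 3) d ∙ product∞ ε (e * 3) (e + d) ∙ product∞ ε (e * 3) (e + (e + d))
  product∞-split₃ = ⟶-unique (⟶-subsequence 3 (products⟶ ε e d))
    (⟶-cong (λ n → ≈-sym (products-split₃ ε e d n))
      (⟶-∙ (⟶-∙ (products⟶ ε (e * 3) d) (products⟶ ε (e * 3) (e + d))) (products⟶ ε (e * 3) (e + (e + d)))))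

product∞-square : ∀ e d .{{_ : NonZero e}} .{{_ : NonZero d}} .{{_ : NonZero (e * 2)}} .{{_ : NonZero (d * 2)}} →
  product∞ 1ℤ e d ∙ product∞ -1ℤ e d ≈ product∞ -1ℤ (e * 2) (d * 2)
product∞-square e d = ⟶-unique (⟶-∙ (products⟶ 1ℤ e d) (products⟶ -1ℤ e d))
  (⟶-cong (λ n → ≈-sym (products-square e d n)) (products⟶ -1ℤ (e * 2) (d * 2)))

-- Theta functions as products

theta⟶ : ∀ ε → ε ℤ.* ε ≡ 1ℤ → ∀ b c .{{_ : NonZero b}} .{{_ : NonZero c}} .{{_ : NonZero (b + c)}} →
  theta ε b c ⟶ f (b + c) ∙ (product∞ ε (b + c) b ∙ product∞ ε (b + c) c)
theta⟶ ε ε²≡1 b c n = Mod.trans (TripleProduct.triple-product ε ε²≡1 b c n)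
  (∙-cong[] Mod.refl (⟶-∙ (products⟶ ε (b + c) b) (products⟶ ε (b + c) c) n))

-- Here the factor 1 + q^0 of the product contributes 2.
theta⟶₀ : ∀ k .{{_ : NonZero k}} → theta 1ℤ k 0 ⟶ ι (+ 2) ∙ (f k ∙ (product∞ 1ℤ k k ∙ product∞ 1ℤ k k))
theta⟶₀ k@(suc _) n = begin
  theta 1ℤ k 0 n                                      ≈⟨ triple (ℕₚ.+-identityʳ k) ⟩
  f k ∙ (products 1ℤ k k n ∙ products 1ℤ k 0 n)       ≈⟨ ∙-cong[] Mod.refl (∙-cong[] (products⟶ 1ℤ k k n) head-factor) ⟩
  f k ∙ (p ∙ (ι (+ 2) ∙ p))
    ≈⟨ ≈⇒≈[] (solve 3 (λ f p t → f :* (p :* (t :* p)) := t :* (f :* (p :* p))) ≈-refl (f k) p (ι (+ 2))) ⟩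
  ι (+ 2) ∙ (f k ∙ (p ∙ p))                           ∎
  where
  open Mod-Reasoning n
  p = product∞ 1ℤ k k
  -- `k + 0` does not reduce to `k`, and the index also occurs in instance arguments; so the
  -- equation is matched at a variable.
  triple : ∀ {a} .{{_ : NonZero a}} → k + 0 ≡ a → theta 1ℤ k 0 n ≈[ n ] f a ∙ (products 1ℤ a k n ∙ products 1ℤ a 0 n)
  triple refl = TripleProduct.triple-product 1ℤ refl k 0 n
  shift : ∀ n → products 1ℤ k 0 (suc n) ≈ ι (+ 2) ∙ products 1ℤ k k n
  shift zero = ≈-trans (∙-cong ≈-refl (⊕-cong ≈-refl (∙-cong ≈-refl
      (≈-trans (≡⇒≈ (cong q^_ (trans (ℕₚ.+-identityʳ (k * 0)) (ℕₚ.*-zeroʳ k)))) q^0≈1))))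
    (solve 0 (con 1ℤ :* (con 1ℤ :+ con 1ℤ :* con 1ℤ) := con (+ 2) :* con 1ℤ) ≈-refl)
  shift (suc n) = ≈-trans (∙-cong (shift n) (≡⇒≈ (cong (λ x → ι 1ℤ ⊕ ι 1ℤ ∙ q^ x) (e k n)))) (∙-assoc _ _ _)
    where
    e : ∀ k n → k * (1 + n) + 0 ≡ k * n + k
    e = ℕ-RingSolver.solve-∀
  head-factor : products 1ℤ k 0 n ≈[ n ] ι (+ 2) ∙ p
  head-factor = begin
    products 1ℤ k 0 n              ≈⟨ ≈⇒≈[] (≈-sym (∙-identityʳ _)) ⟩
    -- Modulo qⁿ a factor 1 + q^(kn) is appended for free; once `shift` has removed 1 + q^0 = 2,
    -- exactly n factors remain.
    products 1ℤ k 0 n ∙ ι 1ℤ       ≈⟨ ∙-cong[] Mod.refl (Mod.sym (1+O 1ℤ (ℕₚ.≤-trans (ℕₚ.m≤n*m n k) (ℕₚ.m≤m+n (k * n) 0)))) ⟩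
    products 1ℤ k 0 (suc n)        ≈⟨ ≈⇒≈[] (shift n) ⟩
    ι (+ 2) ∙ products 1ℤ k k n    ≈⟨ ∙-cong[] Mod.refl (products⟶ 1ℤ k k n) ⟩
    ι (+ 2) ∙ p                    ∎

-- φ(-q), φ(-q³), ψ(q), ψ(q³), and the theta functions Ω(-q) and A(q) of the 3-dissections of the first two
φ₁ φ₃ ψ₁ ψ₃ Ω A : Series
φ₁ = f 2 ∙ (product∞ -1ℤ 2 1 ∙ product∞ -1ℤ 2 1)
φ₃ = f 6 ∙ (product∞ -1ℤ 6 3 ∙ product∞ -1ℤ 6 3)
ψ₁ = f 1 ∙ (product∞ 1ℤ 1 1 ∙ product∞ 1ℤ 1 1)
ψ₃ = f 3 ∙ (product∞ 1ℤ 3 3 ∙ product∞ 1ℤ 3 3)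
Ω  = f 6 ∙ (product∞ -1ℤ 6 5 ∙ product∞ -1ℤ 6 1)
A  = f 3 ∙ (product∞ 1ℤ 3 2 ∙ product∞ 1ℤ 3 1)

-- Euler's identity and the products φψ and ΩA

module _ {F F′ o s : Series} (F≈oF′ : F ≈ o ∙ F′) (sF≈F′ : s ∙ F ≈ F′) where

  -- In the applications F = f(k) and F′ = f(2k), `o` is the product over the odd multiples of k and
  -- `s` the product of the 1 + q^(kn). The two factors on the left are then the product forms of
  -- φ(-q^k) and ψ(q^k).
  φψ : F′ ∙ (o ∙ o) ∙ (F ∙ (s ∙ s)) ≈ F ∙ F′
  φψ = begin
    F′ ∙ (o ∙ o) ∙ (F ∙ (s ∙ s))
      ≈⟨ solve 4 (λ f f′ o s → f′ :* (o :* o) :* (f :* (s :* s)) := o :* f′ :* (o :* (s :* f)) :* s) ≈-refl F F′ o s ⟩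
    o ∙ F′ ∙ (o ∙ (s ∙ F)) ∙ s   ≈⟨ ∙-cong (∙-cong (≈-sym F≈oF′) (∙-cong ≈-refl sF≈F′)) ≈-refl ⟩
    F ∙ (o ∙ F′) ∙ s             ≈⟨ ∙-cong (∙-cong ≈-refl (≈-sym F≈oF′)) ≈-refl ⟩
    F ∙ F ∙ s                    ≈⟨ solve 2 (λ f s → f :* f :* s := f :* (s :* f)) ≈-refl F s ⟩
    F ∙ (s ∙ F)                  ≈⟨ ∙-cong ≈-refl sF≈F′ ⟩
    F ∙ F′                       ∎
    where open ≈-Reasoning

  -- Euler's identity: partitions into distinct parts and into odd parts are equinumerous.
  os≈1 : F 0 ≡ 1ℤ → o ∙ s ≈ ι 1ℤ
  os≈1 F₀≡1 = ∙-cancelˡ F F₀≡1 $ begin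
    F ∙ (o ∙ s)  ≈⟨ solve 3 (λ f o s → f :* (o :* s) := o :* (s :* f)) ≈-refl F o s ⟩
    o ∙ (s ∙ F)  ≈⟨ ∙-cong ≈-refl sF≈F′ ⟩
    o ∙ F′       ≈⟨ ≈-sym F≈oF′ ⟩
    F            ≈⟨ ≈-sym (∙-identityʳ F) ⟩
    F ∙ ι 1ℤ     ∎
    where open ≈-Reasoning

f₁-odd : f 1 ≈ product∞ -1ℤ 2 1 ∙ f 2
f₁-odd = ≈-trans (f≈product∞ 1) (≈-trans (product∞-split₂ -1ℤ 1 1) (∙-cong ≈-refl (≈-sym (f≈product∞ 2))))

f₃-odd : f 3 ≈ product∞ -1ℤ 6 3 ∙ f 6
f₃-odd = ≈-trans (f≈product∞ 3) (≈-trans (product∞-split₂ -1ℤ 3 3) (∙-cong ≈-refl (≈-sym (f≈product∞ 6))))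

plus-f₁ : product∞ 1ℤ 1 1 ∙ f 1 ≈ f 2
plus-f₁ = ≈-trans (∙-cong ≈-refl (f≈product∞ 1)) (≈-trans (product∞-square 1 1) (≈-sym (f≈product∞ 2)))

plus-f₃ : product∞ 1ℤ 3 3 ∙ f 3 ≈ f 6
plus-f₃ = ≈-trans (∙-cong ≈-refl (f≈product∞ 3)) (≈-trans (product∞-square 3 3) (≈-sym (f≈product∞ 6)))

φ₁ψ₁ : φ₁ ∙ ψ₁ ≈ f 1 ∙ f 2
φ₁ψ₁ = φψ f₁-odd plus-f₁

φ₃ψ₃ : φ₃ ∙ ψ₃ ≈ f 3 ∙ f 6
φ₃ψ₃ = φψ f₃-odd plus-f₃

-- Inserting u₃ v₃ = 1 completes the residue classes, so that `product∞-split₃` fuses the six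
-- products into those of Euler's identity at k = 1. The identity is thus used twice, at k = 3 and
-- at k = 1.
ΩA : Ω ∙ A ≈ f 3 ∙ f 6
ΩA = begin
  f 6 ∙ (u₅ ∙ u₁) ∙ (f 3 ∙ (v₂ ∙ v₁))
    ≈⟨ solve 6 (λ x y a b c d → x :* (a :* b) :* (y :* (c :* d)) := y :* x :* ((b :* a) :* (d :* c))) ≈-refl (f 6) (f 3) u₅ u₁ v₂ v₁ ⟩
  f 3 ∙ f 6 ∙ (u₁ ∙ u₅ ∙ (v₁ ∙ v₂))
    ≈⟨ ∙-cong ≈-refl (≈-sym (≈-trans (∙-cong (os≈1 f₃-odd plus-f₃ refl) ≈-refl) (∙-identityˡ _))) ⟩
  f 3 ∙ f 6 ∙ (u₃ ∙ v₃ ∙ (u₁ ∙ u₅ ∙ (v₁ ∙ v₂)))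
    ≈⟨ solve 7 (λ x a b c d e g → x :* (a :* b :* (c :* d :* (e :* g))) := x :* ((c :* a :* d) :* (e :* g :* b))) ≈-refl
         (f 3 ∙ f 6) u₃ v₃ u₁ u₅ v₁ v₂ ⟩
  f 3 ∙ f 6 ∙ (u₁ ∙ u₃ ∙ u₅ ∙ (v₁ ∙ v₂ ∙ v₃))
    ≈⟨ ∙-cong ≈-refl (∙-cong (≈-sym (product∞-split₃ -1ℤ 2 1)) (≈-sym (product∞-split₃ 1ℤ 1 1))) ⟩
  f 3 ∙ f 6 ∙ (product∞ -1ℤ 2 1 ∙ product∞ 1ℤ 1 1)    ≈⟨ ∙-cong ≈-refl (os≈1 f₁-odd plus-f₁ refl) ⟩
  f 3 ∙ f 6 ∙ ι 1ℤ                                    ≈⟨ ∙-identityʳ _ ⟩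
  f 3 ∙ f 6                                           ∎
  where
  open ≈-Reasoning
  u₁ = product∞ -1ℤ 6 1
  u₃ = product∞ -1ℤ 6 3
  u₅ = product∞ -1ℤ 6 5
  v₁ = product∞ 1ℤ 3 1
  v₂ = product∞ 1ℤ 3 2
  v₃ = product∞ 1ℤ 3 3

-- Trisection: the parts of A(q) are the series ∑ A(3n+r) qⁿ, and cubed A is A(q³)

q : Series
q = q^ 1

part : Fin 3 → Series → Series
part r A n = A (n * 3 + toℕ r)

cubed : Series → Series
cubed A 0 = A 0
cubed A 1 = 0ℤ
cubed A 2 = 0ℤ
cubed A (suc (suc (suc n))) = cubed (tail A) n

part-cong : ∀ r {A B} → A ≈ B → part r A ≈ part r B
part-cong r p = ⟨ (λ n → coeff p (n * 3 + toℕ r)) ⟩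

part-cong[] : ∀ r {n A B} → A ≈[ n * 3 ] B → part r A ≈[ n ] part r B
part-cong[] r p = ⟪ (λ i i<n → below p _ (ℕₚ.<-≤-trans
  (ℕₚ.+-monoʳ-< (i * 3) (Finₚ.toℕ<n r)) (ℕₚ.≤-trans (ℕₚ.≤-reflexive (ℕₚ.+-comm (i * 3) 3)) (ℕₚ.*-monoˡ-≤ 3 i<n)))) ⟫

part-injective : ∀ {A B} → (∀ r → part r A ≈ part r B) → A ≈ B
part-injective {A} {B} p = ⟨ go ⟩
  where
  go : A ≗ B
  go n with n divMod 3
  ... | result k r n≡ = subst (λ n → A n ≡ B n) (sym (trans n≡ (ℕₚ.+-comm (toℕ r) (k * 3)))) (coeff (p r) k)

opaque
  unfolding _⊕_

  part-⊕ : ∀ r A B → part r (A ⊕ B) ≈ part r A ⊕ part r B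
  part-⊕ r A B = ≈-refl

  part-⊝ : ∀ r A → part r (⊝ A) ≈ ⊝ part r A
  part-⊝ r A = ≈-refl

  -- The linearity over series in q³ by which recurrences survive extraction. Between two
  -- coefficients of A the convolution with `cubed A` meets two zeros, so three of its steps make
  -- one step on the right.
  part-cubed-∙ : ∀ r A B → part r (cubed A ∙ B) ≈ A ∙ part r B
  part-cubed-∙ r A B = ⟨ go r A ⟩
    where
    go : ∀ r A n → (cubed A ⊛ B) (n * 3 + toℕ r) ≡ (A ⊛ part r B) n
    go 0F A zero    = refl
    go 1F A zero    = refl
    go 2F A zero    = refl
    go r  A (suc n) = cong (ℤ._+_ (A 0 ℤ.* B (suc n * 3 + toℕ r)))
      (trans (ℤₚ.+-identityˡ _) (trans (ℤₚ.+-identityˡ _) (go r (tail A) n)))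

q∙-suc : ∀ A n → (q ∙ A) (suc n) ≡ A n
q∙-suc A n = q^-∙-coeff 1 A n

part-q₀ : ∀ A → part 0F (q ∙ A) ≈ q ∙ part 2F A
part-q₀ A = ⟨ (λ { zero    → trans (q^suc-∙-zero 0 A) (sym (q^suc-∙-zero 0 (part 2F A)))
                 ; (suc n) → trans (q∙-suc A _) (trans (cong A (trans (cong (_+_ 2) (ℕₚ.+-identityʳ (n * 3))) (ℕₚ.+-comm 2 (n * 3))))
                               (sym (q∙-suc (part 2F A) n))) }) ⟩

part-q₁ : ∀ A → part 1F (q ∙ A) ≈ part 0F A
part-q₁ A = ⟨ (λ n → trans (cong (q ∙ A) (ℕₚ.+-suc (n * 3) 0)) (q∙-suc A _)) ⟩

part-q₂ : ∀ A → part 2F (q ∙ A) ≈ part 1F A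
part-q₂ A = ⟨ (λ n → trans (cong (q ∙ A) (ℕₚ.+-suc (n * 3) 1)) (q∙-suc A _)) ⟩

part-1₀ : part 0F (ι 1ℤ) ≈ ι 1ℤ
part-1₀ = ⟨ (λ { zero → refl ; (suc n) → refl }) ⟩

part-1₁ : part 1F (ι 1ℤ) ≈ ι 0ℤ
part-1₁ = ⟨ (λ { zero → refl ; (suc n) → refl }) ⟩

part-1₂ : part 2F (ι 1ℤ) ≈ ι 0ℤ
part-1₂ = ⟨ (λ { zero → refl ; (suc n) → refl }) ⟩

-- Reading `cubed A` as `cubed A ∙ 1` expresses all its parts as multiples of A; with
-- `part-injective`, the homomorphism laws of `cubed` become ring laws.
part-cubed : ∀ r A → part r (cubed A) ≈ A ∙ part r (ι 1ℤ)
part-cubed r A = ≈-trans (part-cong r (≈-sym (∙-identityʳ (cubed A)))) (part-cubed-∙ r A (ι 1ℤ))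

cubed-cong : ∀ {A B} → A ≈ B → cubed A ≈ cubed B
cubed-cong {A} {B} p = part-injective λ r →
  ≈-trans (part-cubed r A) (≈-trans (∙-cong p ≈-refl) (≈-sym (part-cubed r B)))

cubed-cong[] : ∀ {n A B} → A ≈[ n ] B → cubed A ≈[ n ] cubed B
cubed-cong[] p = ⟪ (λ i i<n → go i λ j j≤i → below p j (ℕₚ.≤-<-trans j≤i i<n)) ⟫
  where
  go : ∀ i {A B} → (∀ j → j ≤ i → A j ≡ B j) → cubed A i ≡ cubed B i
  go 0 p = p 0 z≤n
  go 1 p = refl
  go 2 p = refl
  go (suc (suc (suc i))) p = go i λ j j≤i → p (suc j) (s≤s (ℕₚ.m≤n⇒m≤1+n (ℕₚ.m≤n⇒m≤1+n j≤i)))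

cubed-∙ : ∀ A B → cubed (A ∙ B) ≈ cubed A ∙ cubed B
cubed-∙ A B = part-injective λ r → begin
  part r (cubed (A ∙ B))         ≈⟨ part-cubed r (A ∙ B) ⟩
  A ∙ B ∙ part r (ι 1ℤ)          ≈⟨ ∙-assoc A B _ ⟩
  A ∙ (B ∙ part r (ι 1ℤ))        ≈⟨ ∙-cong ≈-refl (≈-sym (part-cubed r B)) ⟩
  A ∙ part r (cubed B)           ≈⟨ ≈-sym (part-cubed-∙ r A (cubed B)) ⟩
  part r (cubed A ∙ cubed B)     ∎
  where open ≈-Reasoning

cubed-⊕ : ∀ A B → cubed (A ⊕ B) ≈ cubed A ⊕ cubed B
cubed-⊕ A B = part-injective λ r → begin
  part r (cubed (A ⊕ B))                     ≈⟨ part-cubed r (A ⊕ B) ⟩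
  (A ⊕ B) ∙ part r (ι 1ℤ)                    ≈⟨ ∙-distribʳ _ A B ⟩
  A ∙ part r (ι 1ℤ) ⊕ B ∙ part r (ι 1ℤ)      ≈⟨ ⊕-cong (≈-sym (part-cubed r A)) (≈-sym (part-cubed r B)) ⟩
  part r (cubed A) ⊕ part r (cubed B)        ≈⟨ ≈-sym (part-⊕ r (cubed A) (cubed B)) ⟩
  part r (cubed A ⊕ cubed B)                 ∎
  where open ≈-Reasoning

cubed-ι : ∀ k → cubed (ι k) ≈ ι k
cubed-ι k = ⟨ go ⟩
  where
  zeros : ∀ n → cubed (λ _ → 0ℤ) n ≡ 0ℤ
  zeros 0 = refl
  zeros 1 = refl
  zeros 2 = refl
  zeros (suc (suc (suc n))) = zeros n
  go : cubed (ι k) ≗ ι k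
  go 0 = refl
  go 1 = refl
  go 2 = refl
  go (suc (suc (suc n))) = zeros n

cubed-⊝ : ∀ A → cubed (⊝ A) ≈ ⊝ cubed A
cubed-⊝ A = begin
  cubed (⊝ A)               ≈⟨ cubed-cong (minus A) ⟩
  cubed (ι -1ℤ ∙ A)         ≈⟨ ≈-trans (cubed-∙ (ι -1ℤ) A) (∙-cong (cubed-ι -1ℤ) ≈-refl) ⟩
  ι -1ℤ ∙ cubed A           ≈⟨ ≈-sym (minus (cubed A)) ⟩
  ⊝ cubed A                 ∎
  where
  open ≈-Reasoning
  minus : ∀ A → ⊝ A ≈ ι -1ℤ ∙ A
  minus = solve 1 (λ a → :- a := con -1ℤ :* a) ≈-refl

cubed-q^ : ∀ n → cubed (q^ n) ≈ q^ (n * 3)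
cubed-q^ zero    = ≈-trans (cubed-cong q^0≈1) (≈-trans (cubed-ι 1ℤ) (≈-sym q^0≈1))
cubed-q^ (suc n) = ⟨ (λ { 0 → refl ; 1 → refl ; 2 → refl ; (suc (suc (suc i))) → coeff (cubed-q^ n) i }) ⟩

part-ι∙ : ∀ r k A → part r (ι k ∙ A) ≈ ι k ∙ part r A
part-ι∙ r k A = ≈-trans (part-cong r (∙-cong (≈-sym (cubed-ι k)) ≈-refl)) (part-cubed-∙ r (ι k) A)

assemble : Series → Series → Series → Series
assemble a b d = cubed a ⊕ q ∙ cubed b ⊕ q ∙ (q ∙ cubed d)

module _ (a b d : Series) where

  private
    distribute : ∀ r → part r (assemble a b d) ≈ part r (cubed a) ⊕ part r (q ∙ cubed b) ⊕ part r (q ∙ (q ∙ cubed d))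
    distribute r = ≈-trans (part-⊕ r _ _) (⊕-cong (part-⊕ r _ _) ≈-refl)
    same : ∀ a → part 0F (cubed a) ≈ a
    same a = ≈-trans (part-cubed 0F a) (≈-trans (∙-cong ≈-refl part-1₀) (∙-identityʳ a))
    none₁ : ∀ a → part 1F (cubed a) ≈ ι 0ℤ
    none₁ a = ≈-trans (part-cubed 1F a) (≈-trans (∙-cong ≈-refl part-1₁) (∙-zeroʳ a))
    none₂ : ∀ a → part 2F (cubed a) ≈ ι 0ℤ
    none₂ a = ≈-trans (part-cubed 2F a) (≈-trans (∙-cong ≈-refl part-1₂) (∙-zeroʳ a))

  part-assemble₀ : part 0F (assemble a b d) ≈ a
  part-assemble₀ = ≈-trans (distribute 0F) (≈-trans (⊕-cong
      (⊕-cong (same a) (≈-trans (part-q₀ _) (∙-cong ≈-refl (none₂ b))))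
      (≈-trans (part-q₀ _) (∙-cong ≈-refl (≈-trans (part-q₂ _) (none₁ d)))))
    (solve 2 (λ a q → a :+ q :* con 0ℤ :+ q :* con 0ℤ := a) ≈-refl a q))

  part-assemble₁ : part 1F (assemble a b d) ≈ b
  part-assemble₁ = ≈-trans (distribute 1F) (≈-trans (⊕-cong
      (⊕-cong (none₁ a) (≈-trans (part-q₁ _) (same b)))
      (≈-trans (part-q₁ _) (≈-trans (part-q₀ _) (∙-cong ≈-refl (none₂ d)))))
    (solve 2 (λ b q → con 0ℤ :+ b :+ q :* con 0ℤ := b) ≈-refl b q))

  part-assemble₂ : part 2F (assemble a b d) ≈ d
  part-assemble₂ = ≈-trans (distribute 2F) (≈-trans (⊕-cong
      (⊕-cong (none₂ a) (≈-trans (part-q₂ _) (none₁ b)))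
      (≈-trans (part-q₂ _) (≈-trans (part-q₁ _) (same d))))
    (solve 1 (λ d → con 0ℤ :+ con 0ℤ :+ d := d) ≈-refl d))

-- 3-dissections of φ(-q) and ψ(q)

triangular-*3 : ∀ n → triangular (n * 3) ≡ 9 * triangular n + 3 * n
triangular-*3 zero    = refl
triangular-*3 (suc n) = trans (cong (λ t → t + n * 3 + (1 + n * 3) + (2 + n * 3)) (triangular-*3 n)) (identity (triangular n) n)
  where
  identity : ∀ t n → 9 * t + 3 * n + n * 3 + (1 + n * 3) + (2 + n * 3) ≡ 9 * (t + n) + 3 * (1 + n)
  identity = ℕ-RingSolver.solve-∀

neg-power-*3 : ∀ n → -1ℤ ℤ.^ (n * 3) ≡ -1ℤ ℤ.^ n
neg-power-*3 zero    = refl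
neg-power-*3 (suc n) = begin
  -1ℤ ℤ.* (-1ℤ ℤ.* (-1ℤ ℤ.* x))  ≡⟨ cong (-1ℤ ℤ.*_) (sym (ℤₚ.*-assoc -1ℤ -1ℤ x)) ⟩
  -1ℤ ℤ.* (1ℤ ℤ.* x)             ≡⟨ cong (-1ℤ ℤ.*_) (trans (ℤₚ.*-identityˡ x) (neg-power-*3 n)) ⟩
  -1ℤ ℤ.^ suc n                  ∎
  where
  open ≡-Reasoning
  x = -1ℤ ℤ.^ (n * 3)

cubed-monomials : ∀ j k x y → cubed (ι j ∙ q^ x ⊕ ι k ∙ q^ y) ≈ ι j ∙ cubed (q^ x) ⊕ ι k ∙ cubed (q^ y)
cubed-monomials j k x y = ≈-trans (cubed-⊕ _ _) (⊕-cong (monomial j x) (monomial k y))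
  where
  monomial : ∀ j x → cubed (ι j ∙ q^ x) ≈ ι j ∙ cubed (q^ x)
  monomial j x = ≈-trans (cubed-∙ _ _) (∙-cong (cubed-ι j) ≈-refl)

q^-*3 : ∀ {x} e → x ≡ e * 3 → q^ x ≈ cubed (q^ e)
q^-*3 e refl = ≈-sym (cubed-q^ e)

q^-1+*3 : ∀ {x} e → x ≡ 1 + e * 3 → q^ x ≈ q ∙ cubed (q^ e)
q^-1+*3 e refl = ≈-trans (q^-+ 1 (e * 3)) (∙-cong ≈-refl (≈-sym (cubed-q^ e)))

-- The exponents are the squares of 3n, 3n + 1, 3n + 2 and of their partners -3n - 1, -3n - 2, -3n -
-- 3. Squares prime to 3 are 1 modulo 3, and each occurs twice with equal sign, opposite to its sign
-- in the series for Ω: hence the -2.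
φ-summands : ∀ n →
  theta-summand -1ℤ 1 1 (n * 3) ⊕ theta-summand -1ℤ 1 1 (1 + n * 3) ⊕ theta-summand -1ℤ 1 1 (2 + n * 3) ≈
  cubed (theta-summand -1ℤ 3 3 n) ⊕ q ∙ (ι (ℤ.- + 2) ∙ cubed (theta-summand -1ℤ 5 1 n))
φ-summands n = begin
  theta-summand -1ℤ 1 1 (n * 3) ⊕ theta-summand -1ℤ 1 1 (1 + n * 3) ⊕ theta-summand -1ℤ 1 1 (2 + n * 3)
    ≈⟨ ⊕-cong (⊕-cong (⊕-cong (∙-cong s₀ x₀) (∙-cong s₁ x₁)) (⊕-cong (∙-cong s₁ x₁) (∙-cong s₂ x₂)))
              (⊕-cong (∙-cong s₂ x₂) (∙-cong s₃ x₃)) ⟩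
  κ ∙ c₀ ⊕ μ ∙ κ ∙ (q ∙ c₁) ⊕ (μ ∙ κ ∙ (q ∙ c₁) ⊕ μ ∙ (μ ∙ κ) ∙ (q ∙ c₂)) ⊕ (μ ∙ (μ ∙ κ) ∙ (q ∙ c₂) ⊕ μ ∙ (μ ∙ (μ ∙ κ)) ∙ c₃)
    ≈⟨ solve 6 (λ k q c₀ c₁ c₂ c₃ → let m = con -1ℤ in
         k :* c₀ :+ m :* k :* (q :* c₁) :+ (m :* k :* (q :* c₁) :+ m :* (m :* k) :* (q :* c₂))
           :+ (m :* (m :* k) :* (q :* c₂) :+ m :* (m :* (m :* k)) :* c₃)
         := k :* c₀ :+ m :* k :* c₃ :+ q :* (con (ℤ.- + 2) :* (k :* c₁ :+ m :* k :* c₂))) ≈-refl κ q c₀ c₁ c₂ c₃ ⟩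
  κ ∙ c₀ ⊕ μ ∙ κ ∙ c₃ ⊕ q ∙ (ι (ℤ.- + 2) ∙ (κ ∙ c₁ ⊕ μ ∙ κ ∙ c₂))
    ≈⟨ ⊕-cong (⊕-cong ≈-refl (∙-cong (≈-sym (ι-* -1ℤ s)) ≈-refl))
              (∙-cong ≈-refl (∙-cong ≈-refl (⊕-cong ≈-refl (∙-cong (≈-sym (ι-* -1ℤ s)) ≈-refl)))) ⟩
  κ ∙ c₀ ⊕ ι (-1ℤ ℤ.^ suc n) ∙ c₃ ⊕ q ∙ (ι (ℤ.- + 2) ∙ (κ ∙ c₁ ⊕ ι (-1ℤ ℤ.^ suc n) ∙ c₂))
    ≈⟨ ≈-sym (⊕-cong (cubed-monomials s (-1ℤ ℤ.^ suc n) (exponent 6 3 n) (exponent 6 3 (suc n)))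
         (∙-cong ≈-refl (∙-cong ≈-refl (cubed-monomials s (-1ℤ ℤ.^ suc n) (exponent 6 5 n) (exponent 6 1 (suc n)))))) ⟩
  cubed (theta-summand -1ℤ 3 3 n) ⊕ q ∙ (ι (ℤ.- + 2) ∙ cubed (theta-summand -1ℤ 5 1 n))  ∎
  where
  open ≈-Reasoning
  s  = -1ℤ ℤ.^ n
  κ  = ι s
  μ  = ι -1ℤ
  c₀ = cubed (q^ exponent 6 3 n)
  c₁ = cubed (q^ exponent 6 5 n)
  c₂ = cubed (q^ exponent 6 1 (suc n))
  c₃ = cubed (q^ exponent 6 3 (suc n))
  next : ∀ j {A} → ι j ≈ A → ι (-1ℤ ℤ.* j) ≈ μ ∙ A
  next j p = ≈-trans (ι-* -1ℤ j) (∙-cong ≈-refl p)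
  s₀ : ι (-1ℤ ℤ.^ (n * 3)) ≈ κ
  s₀ = ≡⇒≈ (cong ι (neg-power-*3 n))
  s₁ = next (-1ℤ ℤ.^ (n * 3)) s₀
  s₂ = next (-1ℤ ℤ.^ (1 + n * 3)) s₁
  s₃ = next (-1ℤ ℤ.^ (2 + n * 3)) s₂
  e₀ : ∀ t n → 2 * (9 * t + 3 * n) + 1 * (n * 3) ≡ (6 * t + 3 * n) * 3
  e₀ = ℕ-RingSolver.solve-∀
  e₁ : ∀ t n → 2 * (9 * t + 3 * n + n * 3) + 1 * (1 + n * 3) ≡ 1 + (6 * t + 5 * n) * 3
  e₁ = ℕ-RingSolver.solve-∀
  e₂ : ∀ t n → 2 * (9 * t + 3 * n + n * 3 + (1 + n * 3)) + 1 * (2 + n * 3) ≡ 1 + (6 * (t + n) + 1 * (1 + n)) * 3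
  e₂ = ℕ-RingSolver.solve-∀
  e₃ : ∀ t n → 2 * (9 * t + 3 * n + n * 3 + (1 + n * 3) + (2 + n * 3)) + 1 * (3 + n * 3) ≡ (6 * (t + n) + 3 * (1 + n)) * 3
  e₃ = ℕ-RingSolver.solve-∀
  x₀ : q^ exponent 2 1 (n * 3) ≈ c₀
  x₀ = q^-*3 (exponent 6 3 n) (trans (cong (λ t → 2 * t + 1 * (n * 3)) (triangular-*3 n)) (e₀ (triangular n) n))
  x₁ : q^ exponent 2 1 (1 + n * 3) ≈ q ∙ c₁
  x₁ = q^-1+*3 (exponent 6 5 n) (trans (cong (λ t → 2 * (t + n * 3) + 1 * (1 + n * 3)) (triangular-*3 n)) (e₁ (triangular n) n))
  x₂ : q^ exponent 2 1 (2 + n * 3) ≈ q ∙ c₂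
  x₂ = q^-1+*3 (exponent 6 1 (suc n)) (trans (cong (λ t → 2 * (t + n * 3 + (1 + n * 3)) + 1 * (2 + n * 3)) (triangular-*3 n)) (e₂ (triangular n) n))
  x₃ : q^ exponent 2 1 (3 + n * 3) ≈ c₃
  x₃ = q^-*3 (exponent 6 3 (suc n)) (trans (cong (λ t → 2 * (t + n * 3 + (1 + n * 3) + (2 + n * 3)) + 1 * (3 + n * 3)) (triangular-*3 n))
         (e₃ (triangular n) n))

-- The exponents are the triangular numbers j(j+1)/2, each listed at j and at -j - 1. They are 1
-- modulo 3 for j = 3n + 1 and multiples of 3 for j = 3n and 3n + 2. The repetition becomes the
-- factor 2 for the multiples of 3; in the other class it stays inside the theta series with c = 0.
ψ-summands : ∀ n →
  theta-summand 1ℤ 1 0 (n * 3) ⊕ theta-summand 1ℤ 1 0 (1 + n * 3) ⊕ theta-summand 1ℤ 1 0 (2 + n * 3) ≈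
  ι (+ 2) ∙ cubed (theta-summand 1ℤ 2 1 n) ⊕ q ∙ cubed (theta-summand 1ℤ 3 0 n)
ψ-summands n = begin
  theta-summand 1ℤ 1 0 (n * 3) ⊕ theta-summand 1ℤ 1 0 (1 + n * 3) ⊕ theta-summand 1ℤ 1 0 (2 + n * 3)
    ≈⟨ ⊕-cong (⊕-cong (⊕-cong (∙-cong (one^ (n * 3)) x₀) (∙-cong (one^ (1 + n * 3)) y₀))
                      (⊕-cong (∙-cong (one^ (1 + n * 3)) x₁) (∙-cong (one^ (2 + n * 3)) y₁)))
              (⊕-cong (∙-cong (one^ (2 + n * 3)) x₂) (∙-cong (one^ (3 + n * 3)) y₂)) ⟩
  ι 1ℤ ∙ c₀ ⊕ ι 1ℤ ∙ c₀ ⊕ (ι 1ℤ ∙ (q ∙ c₁) ⊕ ι 1ℤ ∙ (q ∙ c₁′)) ⊕ (ι 1ℤ ∙ c₂ ⊕ ι 1ℤ ∙ c₂)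
    ≈⟨ solve 5 (λ q c₀ c₁ c₁′ c₂ → let o = con 1ℤ in
         o :* c₀ :+ o :* c₀ :+ (o :* (q :* c₁) :+ o :* (q :* c₁′)) :+ (o :* c₂ :+ o :* c₂)
         := con (+ 2) :* (o :* c₀ :+ o :* c₂) :+ q :* (o :* c₁ :+ o :* c₁′)) ≈-refl q c₀ c₁ c₁′ c₂ ⟩
  ι (+ 2) ∙ (ι 1ℤ ∙ c₀ ⊕ ι 1ℤ ∙ c₂) ⊕ q ∙ (ι 1ℤ ∙ c₁ ⊕ ι 1ℤ ∙ c₁′)
    ≈⟨ ⊕-cong (∙-cong ≈-refl (⊕-cong (∙-cong (≈-sym (one^ n)) ≈-refl) (∙-cong (≈-sym (one^ (suc n))) ≈-refl)))
              (∙-cong ≈-refl (⊕-cong (∙-cong (≈-sym (one^ n)) ≈-refl) (∙-cong (≈-sym (one^ (suc n))) ≈-refl))) ⟩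
  ι (+ 2) ∙ (ι (1ℤ ℤ.^ n) ∙ c₀ ⊕ ι (1ℤ ℤ.^ suc n) ∙ c₂) ⊕ q ∙ (ι (1ℤ ℤ.^ n) ∙ c₁ ⊕ ι (1ℤ ℤ.^ suc n) ∙ c₁′)
    ≈⟨ ≈-sym (⊕-cong (∙-cong ≈-refl (cubed-monomials (1ℤ ℤ.^ n) (1ℤ ℤ.^ suc n) (exponent 3 2 n) (exponent 3 1 (suc n))))
         (∙-cong ≈-refl (cubed-monomials (1ℤ ℤ.^ n) (1ℤ ℤ.^ suc n) (exponent 3 3 n) (exponent 3 0 (suc n))))) ⟩
  ι (+ 2) ∙ cubed (theta-summand 1ℤ 2 1 n) ⊕ q ∙ cubed (theta-summand 1ℤ 3 0 n)  ∎
  where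
  open ≈-Reasoning
  c₀  = cubed (q^ exponent 3 2 n)
  c₁  = cubed (q^ exponent 3 3 n)
  c₁′ = cubed (q^ exponent 3 0 (suc n))
  c₂  = cubed (q^ exponent 3 1 (suc n))
  one^ : ∀ j → ι (1ℤ ℤ.^ j) ≈ ι 1ℤ
  one^ j = ≡⇒≈ (cong ι (ℤₚ.^-zeroˡ j))
  e₀ : ∀ t n → 1 * (9 * t + 3 * n) + 1 * (n * 3) ≡ (3 * t + 2 * n) * 3
  e₀ = ℕ-RingSolver.solve-∀
  e₀′ : ∀ t n → 1 * (9 * t + 3 * n + n * 3) + 0 * (1 + n * 3) ≡ (3 * t + 2 * n) * 3
  e₀′ = ℕ-RingSolver.solve-∀
  e₁ : ∀ t n → 1 * (9 * t + 3 * n + n * 3) + 1 * (1 + n * 3) ≡ 1 + (3 * t + 3 * n) * 3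
  e₁ = ℕ-RingSolver.solve-∀
  e₁′ : ∀ t n → 1 * (9 * t + 3 * n + n * 3 + (1 + n * 3)) + 0 * (2 + n * 3) ≡ 1 + (3 * (t + n) + 0 * (1 + n)) * 3
  e₁′ = ℕ-RingSolver.solve-∀
  e₂ : ∀ t n → 1 * (9 * t + 3 * n + n * 3 + (1 + n * 3)) + 1 * (2 + n * 3) ≡ (3 * (t + n) + 1 * (1 + n)) * 3
  e₂ = ℕ-RingSolver.solve-∀
  e₂′ : ∀ t n → 1 * (9 * t + 3 * n + n * 3 + (1 + n * 3) + (2 + n * 3)) + 0 * (3 + n * 3) ≡ (3 * (t + n) + 1 * (1 + n)) * 3
  e₂′ = ℕ-RingSolver.solve-∀
  x₀ : q^ exponent 1 1 (n * 3) ≈ c₀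
  x₀ = q^-*3 (exponent 3 2 n) (trans (cong (λ t → 1 * t + 1 * (n * 3)) (triangular-*3 n)) (e₀ (triangular n) n))
  y₀ : q^ exponent 1 0 (1 + n * 3) ≈ c₀
  y₀ = q^-*3 (exponent 3 2 n) (trans (cong (λ t → 1 * (t + n * 3) + 0 * (1 + n * 3)) (triangular-*3 n)) (e₀′ (triangular n) n))
  x₁ : q^ exponent 1 1 (1 + n * 3) ≈ q ∙ c₁
  x₁ = q^-1+*3 (exponent 3 3 n) (trans (cong (λ t → 1 * (t + n * 3) + 1 * (1 + n * 3)) (triangular-*3 n)) (e₁ (triangular n) n))
  y₁ : q^ exponent 1 0 (2 + n * 3) ≈ q ∙ c₁′
  y₁ = q^-1+*3 (exponent 3 0 (suc n)) (trans (cong (λ t → 1 * (t + n * 3 + (1 + n * 3)) + 0 * (2 + n * 3)) (triangular-*3 n)) (e₁′ (triangular n) n))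
  x₂ : q^ exponent 1 1 (2 + n * 3) ≈ c₂
  x₂ = q^-*3 (exponent 3 1 (suc n)) (trans (cong (λ t → 1 * (t + n * 3 + (1 + n * 3)) + 1 * (2 + n * 3)) (triangular-*3 n)) (e₂ (triangular n) n))
  y₂ : q^ exponent 1 0 (3 + n * 3) ≈ c₂
  y₂ = q^-*3 (exponent 3 1 (suc n)) (trans (cong (λ t → 1 * (t + n * 3 + (1 + n * 3) + (2 + n * 3)) + 0 * (3 + n * 3)) (triangular-*3 n))
         (e₂′ (triangular n) n))

φ-dissection-finite : ∀ n → theta -1ℤ 1 1 (n * 3) ≈ cubed (theta -1ℤ 3 3 n) ⊕ q ∙ (ι (ℤ.- + 2) ∙ cubed (theta -1ℤ 5 1 n))
φ-dissection-finite zero = ≈-sym (≈-trans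
  (⊕-cong (cubed-ι 0ℤ) (∙-cong ≈-refl (∙-cong ≈-refl (cubed-ι 0ℤ))))
  (solve 1 (λ q → con 0ℤ :+ q :* (con (ℤ.- + 2) :* con 0ℤ) := con 0ℤ) ≈-refl q))
φ-dissection-finite (suc n) = begin
  theta -1ℤ 1 1 (n * 3) ⊕ S₀ ⊕ S₁ ⊕ S₂
    ≈⟨ solve 4 (λ t x y z → t :+ x :+ y :+ z := t :+ (x :+ y :+ z)) ≈-refl (theta -1ℤ 1 1 (n * 3)) S₀ S₁ S₂ ⟩
  theta -1ℤ 1 1 (n * 3) ⊕ (S₀ ⊕ S₁ ⊕ S₂)    ≈⟨ ⊕-cong (φ-dissection-finite n) (φ-summands n) ⟩
  cubed (theta -1ℤ 3 3 n) ⊕ q ∙ (ι (ℤ.- + 2) ∙ cubed (theta -1ℤ 5 1 n))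
    ⊕ (cubed (theta-summand -1ℤ 3 3 n) ⊕ q ∙ (ι (ℤ.- + 2) ∙ cubed (theta-summand -1ℤ 5 1 n)))
    ≈⟨ solve 5 (λ q a b x y → a :+ q :* (con (ℤ.- + 2) :* b) :+ (x :+ q :* (con (ℤ.- + 2) :* y))
         := (a :+ x) :+ q :* (con (ℤ.- + 2) :* (b :+ y))) ≈-refl q
         (cubed (theta -1ℤ 3 3 n)) (cubed (theta -1ℤ 5 1 n)) (cubed (theta-summand -1ℤ 3 3 n)) (cubed (theta-summand -1ℤ 5 1 n)) ⟩
  (cubed (theta -1ℤ 3 3 n) ⊕ cubed (theta-summand -1ℤ 3 3 n))
    ⊕ q ∙ (ι (ℤ.- + 2) ∙ (cubed (theta -1ℤ 5 1 n) ⊕ cubed (theta-summand -1ℤ 5 1 n)))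
    ≈⟨ ⊕-cong (≈-sym (cubed-⊕ _ _)) (∙-cong ≈-refl (∙-cong ≈-refl (≈-sym (cubed-⊕ _ _)))) ⟩
  cubed (theta -1ℤ 3 3 (suc n)) ⊕ q ∙ (ι (ℤ.- + 2) ∙ cubed (theta -1ℤ 5 1 (suc n)))  ∎
  where
  open ≈-Reasoning
  S₀ = theta-summand -1ℤ 1 1 (n * 3)
  S₁ = theta-summand -1ℤ 1 1 (1 + n * 3)
  S₂ = theta-summand -1ℤ 1 1 (2 + n * 3)

ψ-dissection-finite : ∀ n → theta 1ℤ 1 0 (n * 3) ≈ ι (+ 2) ∙ cubed (theta 1ℤ 2 1 n) ⊕ q ∙ cubed (theta 1ℤ 3 0 n)
ψ-dissection-finite zero = ≈-sym (≈-trans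
  (⊕-cong (∙-cong ≈-refl (cubed-ι 0ℤ)) (∙-cong ≈-refl (cubed-ι 0ℤ)))
  (solve 1 (λ q → con (+ 2) :* con 0ℤ :+ q :* con 0ℤ := con 0ℤ) ≈-refl q))
ψ-dissection-finite (suc n) = begin
  theta 1ℤ 1 0 (n * 3) ⊕ S₀ ⊕ S₁ ⊕ S₂
    ≈⟨ solve 4 (λ t x y z → t :+ x :+ y :+ z := t :+ (x :+ y :+ z)) ≈-refl (theta 1ℤ 1 0 (n * 3)) S₀ S₁ S₂ ⟩
  theta 1ℤ 1 0 (n * 3) ⊕ (S₀ ⊕ S₁ ⊕ S₂)    ≈⟨ ⊕-cong (ψ-dissection-finite n) (ψ-summands n) ⟩
  ι (+ 2) ∙ cubed (theta 1ℤ 2 1 n) ⊕ q ∙ cubed (theta 1ℤ 3 0 n)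
    ⊕ (ι (+ 2) ∙ cubed (theta-summand 1ℤ 2 1 n) ⊕ q ∙ cubed (theta-summand 1ℤ 3 0 n))
    ≈⟨ solve 5 (λ q a b x y → con (+ 2) :* a :+ q :* b :+ (con (+ 2) :* x :+ q :* y)
         := con (+ 2) :* (a :+ x) :+ q :* (b :+ y)) ≈-refl q
         (cubed (theta 1ℤ 2 1 n)) (cubed (theta 1ℤ 3 0 n)) (cubed (theta-summand 1ℤ 2 1 n)) (cubed (theta-summand 1ℤ 3 0 n)) ⟩
  ι (+ 2) ∙ (cubed (theta 1ℤ 2 1 n) ⊕ cubed (theta-summand 1ℤ 2 1 n))
    ⊕ q ∙ (cubed (theta 1ℤ 3 0 n) ⊕ cubed (theta-summand 1ℤ 3 0 n))
    ≈⟨ ⊕-cong (∙-cong ≈-refl (≈-sym (cubed-⊕ _ _))) (∙-cong ≈-refl (≈-sym (cubed-⊕ _ _))) ⟩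
  ι (+ 2) ∙ cubed (theta 1ℤ 2 1 (suc n)) ⊕ q ∙ cubed (theta 1ℤ 3 0 (suc n))  ∎
  where
  open ≈-Reasoning
  S₀ = theta-summand 1ℤ 1 0 (n * 3)
  S₁ = theta-summand 1ℤ 1 0 (1 + n * 3)
  S₂ = theta-summand 1ℤ 1 0 (2 + n * 3)

φ-dissection : φ₁ ≈ cubed φ₃ ⊕ q ∙ (ι (ℤ.- + 2) ∙ cubed Ω)
φ-dissection = ⟶-unique (⟶-subsequence 3 (theta⟶ -1ℤ refl 1 1)) λ n → Mod.trans (≈⇒≈[] (φ-dissection-finite n))
  (⊕-cong[] (cubed-cong[] (theta⟶ -1ℤ refl 3 3 n))
            (∙-cong[] Mod.refl (∙-cong[] Mod.refl (cubed-cong[] (theta⟶ -1ℤ refl 5 1 n)))))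

-- The theta series with c = 0 converge to twice ψ, so the finite identity yields the doubled
-- statement, and 2 is cancelled coefficientwise.
ψ-dissection : ψ₁ ≈ cubed A ⊕ q ∙ cubed ψ₃
ψ-dissection = ι-cancel (+ 2) $ begin
  ι (+ 2) ∙ ψ₁                                       ≈⟨ limits ⟩
  ι (+ 2) ∙ cubed A ⊕ q ∙ cubed (ι (+ 2) ∙ ψ₃)
    ≈⟨ ⊕-cong ≈-refl (∙-cong ≈-refl (≈-trans (cubed-∙ _ _) (∙-cong (cubed-ι (+ 2)) ≈-refl))) ⟩
  ι (+ 2) ∙ cubed A ⊕ q ∙ (ι (+ 2) ∙ cubed ψ₃)
    ≈⟨ solve 3 (λ q a p → con (+ 2) :* a :+ q :* (con (+ 2) :* p) := con (+ 2) :* (a :+ q :* p)) ≈-refl q (cubed A) (cubed ψ₃) ⟩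
  ι (+ 2) ∙ (cubed A ⊕ q ∙ cubed ψ₃)                 ∎
  where
  open ≈-Reasoning
  limits : ι (+ 2) ∙ ψ₁ ≈ ι (+ 2) ∙ cubed A ⊕ q ∙ cubed (ι (+ 2) ∙ ψ₃)
  limits = ⟶-unique (⟶-subsequence 3 (theta⟶₀ 1)) λ n → Mod.trans (≈⇒≈[] (ψ-dissection-finite n))
    (⊕-cong[] (∙-cong[] Mod.refl (cubed-cong[] (theta⟶ 1ℤ refl 2 1 n)))
              (∙-cong[] Mod.refl (cubed-cong[] (theta⟶₀ 3 n))))

-- The 3-dissection of F

F P : Series
F = f 1 ∙ f 2
P = f 3 ∙ f 6

F-dissection : F ≈ assemble (φ₃ ∙ A) (⊝ P) (ι (ℤ.- + 2) ∙ (Ω ∙ ψ₃))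
F-dissection = begin
  F            ≈⟨ ≈-sym φ₁ψ₁ ⟩
  φ₁ ∙ ψ₁      ≈⟨ ∙-cong φ-dissection ψ-dissection ⟩
  (cubed φ₃ ⊕ q ∙ (ι (ℤ.- + 2) ∙ cubed Ω)) ∙ (cubed A ⊕ q ∙ cubed ψ₃)
    ≈⟨ solve 5 (λ q φ ω a ψ → (φ :+ q :* (con (ℤ.- + 2) :* ω)) :* (a :+ q :* ψ)
         := φ :* a :+ q :* (φ :* ψ :+ con (ℤ.- + 2) :* (ω :* a)) :+ q :* (q :* (con (ℤ.- + 2) :* (ω :* ψ)))) ≈-refl
         q (cubed φ₃) (cubed Ω) (cubed A) (cubed ψ₃) ⟩
  cubed φ₃ ∙ cubed A ⊕ q ∙ (cubed φ₃ ∙ cubed ψ₃ ⊕ ι (ℤ.- + 2) ∙ (cubed Ω ∙ cubed A)) ⊕ q ∙ (q ∙ (ι (ℤ.- + 2) ∙ (cubed Ω ∙ cubed ψ₃)))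
    ≈⟨ ⊕-cong (⊕-cong (≈-sym (cubed-∙ φ₃ A)) (∙-cong ≈-refl middle))
              (∙-cong ≈-refl (∙-cong ≈-refl (≈-sym (≈-trans (cubed-∙ _ _) (∙-cong (cubed-ι (ℤ.- + 2)) (cubed-∙ Ω ψ₃)))))) ⟩
  assemble (φ₃ ∙ A) (⊝ P) (ι (ℤ.- + 2) ∙ (Ω ∙ ψ₃))  ∎
  where
  open ≈-Reasoning
  -- φ₃ψ₃ and ΩA are the same series P, whence P - 2P = -P.
  middle : cubed φ₃ ∙ cubed ψ₃ ⊕ ι (ℤ.- + 2) ∙ (cubed Ω ∙ cubed A) ≈ cubed (⊝ P)
  middle = begin
    cubed φ₃ ∙ cubed ψ₃ ⊕ ι (ℤ.- + 2) ∙ (cubed Ω ∙ cubed A)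
      ≈⟨ ⊕-cong (≈-trans (≈-sym (cubed-∙ φ₃ ψ₃)) (cubed-cong φ₃ψ₃))
                (∙-cong ≈-refl (≈-trans (≈-sym (cubed-∙ Ω A)) (cubed-cong ΩA))) ⟩
    cubed P ⊕ ι (ℤ.- + 2) ∙ cubed P   ≈⟨ solve 1 (λ p → p :+ con (ℤ.- + 2) :* p := :- p) ≈-refl (cubed P) ⟩
    ⊝ cubed P                         ≈⟨ ≈-sym (cubed-⊝ P) ⟩
    cubed (⊝ P)                       ∎

F-part₀ : part 0F F ≈ φ₃ ∙ A
F-part₀ = ≈-trans (part-cong 0F F-dissection) (part-assemble₀ _ _ _)

F-part₁ : part 1F F ≈ ⊝ P
F-part₁ = ≈-trans (part-cong 1F F-dissection) (part-assemble₁ _ _ _)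

F-part₂ : part 2F F ≈ ι (ℤ.- + 2) ∙ (Ω ∙ ψ₃)
F-part₂ = ≈-trans (part-cong 2F F-dissection) (part-assemble₂ _ _ _)

-- Regrouped crosswise, the outer coefficients contain the same two products φ₃ψ₃ and ΩA that met in
-- the middle one.
F-parts₀₂ : part 0F F ∙ part 2F F ≈ ι (ℤ.- + 2) ∙ (P ∙ P)
F-parts₀₂ = begin
  part 0F F ∙ part 2F F                         ≈⟨ ∙-cong F-part₀ F-part₂ ⟩
  φ₃ ∙ A ∙ (ι (ℤ.- + 2) ∙ (Ω ∙ ψ₃))
    ≈⟨ solve 4 (λ φ a ω ψ → φ :* a :* (con (ℤ.- + 2) :* (ω :* ψ)) := con (ℤ.- + 2) :* (φ :* ψ :* (ω :* a))) ≈-refl φ₃ A Ω ψ₃ ⟩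
  ι (ℤ.- + 2) ∙ (φ₃ ∙ ψ₃ ∙ (Ω ∙ A))             ≈⟨ ∙-cong ≈-refl (∙-cong φ₃ψ₃ ΩA) ⟩
  ι (ℤ.- + 2) ∙ (P ∙ P)                         ∎
  where open ≈-Reasoning

-- The norm from ℤ[[q]] to ℤ[[q³]], with q³ renamed to q

norm : Series → Series → Series → Series
norm a b d = a ∙ a ∙ a ⊕ q ∙ (b ∙ b ∙ b) ⊕ q ∙ q ∙ (d ∙ d ∙ d) ⊕ ⊝ (ι (+ 3) ∙ q ∙ (a ∙ b ∙ d))

N : Series → Series
N A = norm (part 0F A) (part 1F A) (part 2F A)

norm-cong : ∀ {a a′ b b′ d d′} → a ≈ a′ → b ≈ b′ → d ≈ d′ → norm a b d ≈ norm a′ b′ d′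
norm-cong p r s = ⊕-cong (⊕-cong (⊕-cong (∙-cong (∙-cong p p) p) (∙-cong ≈-refl (∙-cong (∙-cong r r) r)))
  (∙-cong ≈-refl (∙-cong (∙-cong s s) s))) (⊝-cong (∙-cong ≈-refl (∙-cong (∙-cong p r) s)))

norm-cong[] : ∀ {n a a′ b b′ d d′} → a ≈[ n ] a′ → b ≈[ n ] b′ → d ≈[ n ] d′ → norm a b d ≈[ n ] norm a′ b′ d′
norm-cong[] p r s = ⊕-cong[] (⊕-cong[] (⊕-cong[] (∙-cong[] (∙-cong[] p p) p) (∙-cong[] Mod.refl (∙-cong[] (∙-cong[] r r) r)))
  (∙-cong[] Mod.refl (∙-cong[] (∙-cong[] s s) s))) (⊝-cong[] (∙-cong[] Mod.refl (∙-cong[] (∙-cong[] p r) s)))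

N-cong[] : ∀ {n A B} → A ≈[ n * 3 ] B → N A ≈[ n ] N B
N-cong[] p = norm-cong[] (part-cong[] 0F p) (part-cong[] 1F p) (part-cong[] 2F p)

1-q^ : ℕ → Series
1-q^ e = ι 1ℤ ⊕ ι -1ℤ ∙ q^ e

data NonMultiple : ℕ → Set where
  1+3* : ∀ i → NonMultiple (1 + i * 3)
  2+3* : ∀ i → NonMultiple (2 + i * 3)

cube-q^ : ∀ i → q^ i ∙ q^ i ∙ q^ i ≈ q^ (i * 3)
cube-q^ i = ≈-trans (∙-cong (≈-sym (q^-+ i i)) ≈-refl) (≈-trans (≈-sym (q^-+ (i + i) i)) (≡⇒≈ (cong q^_ (triple i))))
  where
  triple : ∀ i → i + i + i ≡ i * 3
  triple = ℕ-RingSolver.solve-∀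

module _ (X : Series) where

  private
    a = part 0F X
    b = part 1F X
    d = part 2F X

  part-minus : ∀ r x Y → part r (X ⊕ ⊝ (cubed x ∙ Y)) ≈ part r X ⊕ ⊝ (x ∙ part r Y)
  part-minus r x Y = ≈-trans (part-⊕ r _ _)
    (⊕-cong ≈-refl (≈-trans (part-⊝ r _) (⊝-cong (part-cubed-∙ r x Y))))

  -- A series in q³ acts as a scalar, so the cubic form picks up its third power.
  N-multiple : ∀ i → N (X ∙ 1-q^ (i * 3)) ≈ N X ∙ (1-q^ i ∙ 1-q^ i ∙ 1-q^ i)
  N-multiple i = begin
    N (X ∙ 1-q^ (i * 3))
      ≈⟨ norm-cong (parts 0F) (parts 1F) (parts 2F) ⟩
    norm (a ∙ 1-q^ i) (b ∙ 1-q^ i) (d ∙ 1-q^ i)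
      ≈⟨ solve 5 (λ q a b d u → let n = λ a b d → a :* a :* a :+ q :* (b :* b :* b) :+ q :* q :* (d :* d :* d) :- con (+ 3) :* q :* (a :* b :* d)
           in n (a :* u) (b :* u) (d :* u) := n a b d :* (u :* u :* u)) ≈-refl q a b d (1-q^ i) ⟩
    N X ∙ (1-q^ i ∙ 1-q^ i ∙ 1-q^ i)  ∎
    where
    open ≈-Reasoning
    parts : ∀ r → part r (X ∙ 1-q^ (i * 3)) ≈ part r X ∙ 1-q^ i
    parts r = begin
      part r (X ∙ 1-q^ (i * 3))
        ≈⟨ part-cong r (solve 2 (λ a x → a :* (con 1ℤ :+ con -1ℤ :* x) := a :- x :* a) ≈-refl X (q^ (i * 3))) ⟩
      part r (X ⊕ ⊝ (q^ (i * 3) ∙ X))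
        ≈⟨ part-cong r (⊕-cong ≈-refl (⊝-cong (∙-cong (≈-sym (cubed-q^ i)) ≈-refl))) ⟩
      part r (X ⊕ ⊝ (cubed (q^ i) ∙ X))    ≈⟨ part-minus r (q^ i) X ⟩
      part r X ⊕ ⊝ (q^ i ∙ part r X)
        ≈⟨ solve 2 (λ a x → a :- x :* a := a :* (con 1ℤ :+ con -1ℤ :* x)) ≈-refl (part r X) (q^ i) ⟩
      part r X ∙ 1-q^ i                    ∎

  -- For e prime to 3 the conjugates of 1 - q^e are the three 1 - ω^s q^e, with product 1 - q^(3e),
  -- which reads 1 - q^e after the renaming. Multiplicativity of the norm at such a factor is a
  -- polynomial identity in the parts of X.
  N-nonmultiple : ∀ {e} → NonMultiple e → N (X ∙ 1-q^ e) ≈ N X ∙ 1-q^ e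
  N-nonmultiple (1+3* i) = begin
    N (X ∙ 1-q^ (1 + i * 3))
      ≈⟨ norm-cong
           (≈-trans (parts 0F) (⊕-cong ≈-refl (⊝-cong (∙-cong ≈-refl (part-q₀ X)))))
           (≈-trans (parts 1F) (⊕-cong ≈-refl (⊝-cong (∙-cong ≈-refl (part-q₁ X)))))
           (≈-trans (parts 2F) (⊕-cong ≈-refl (⊝-cong (∙-cong ≈-refl (part-q₂ X))))) ⟩
    norm (a ⊕ ⊝ (x ∙ (q ∙ d))) (b ⊕ ⊝ (x ∙ a)) (d ⊕ ⊝ (x ∙ b))
      ≈⟨ solve 5 (λ q a b d x → let n = λ a b d → a :* a :* a :+ q :* (b :* b :* b) :+ q :* q :* (d :* d :* d) :- con (+ 3) :* q :* (a :* b :* d)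
           in n (a :- x :* (q :* d)) (b :- x :* a) (d :- x :* b) := n a b d :* (con 1ℤ :+ con -1ℤ :* (q :* (x :* x :* x)))) ≈-refl q a b d x ⟩
    N X ∙ (ι 1ℤ ⊕ ι -1ℤ ∙ (q ∙ (x ∙ x ∙ x)))
      ≈⟨ ∙-cong ≈-refl (⊕-cong ≈-refl (∙-cong ≈-refl (≈-trans (∙-cong ≈-refl (cube-q^ i)) (≈-sym (q^-+ 1 (i * 3)))))) ⟩
    N X ∙ 1-q^ (1 + i * 3)  ∎
    where
    open ≈-Reasoning
    x = q^ i
    parts : ∀ r → part r (X ∙ 1-q^ (1 + i * 3)) ≈ part r X ⊕ ⊝ (x ∙ part r (q ∙ X))
    parts r = ≈-trans (part-cong r (≈-trans
        (∙-cong ≈-refl (⊕-cong ≈-refl (∙-cong ≈-refl (≈-trans (q^-+ 1 (i * 3)) (∙-cong ≈-refl (≈-sym (cubed-q^ i)))))))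
        (solve 3 (λ a q x → a :* (con 1ℤ :+ con -1ℤ :* (q :* x)) := a :- x :* (q :* a)) ≈-refl X q (cubed x))))
      (part-minus r x (q ∙ X))
  N-nonmultiple (2+3* i) = begin
    N (X ∙ 1-q^ (2 + i * 3))
      ≈⟨ norm-cong
           (≈-trans (parts 0F) (⊕-cong ≈-refl (⊝-cong (∙-cong ≈-refl (≈-trans (part-q₀ (q ∙ X)) (∙-cong ≈-refl (part-q₂ X)))))))
           (≈-trans (parts 1F) (⊕-cong ≈-refl (⊝-cong (∙-cong ≈-refl (≈-trans (part-q₁ (q ∙ X)) (part-q₀ X))))))
           (≈-trans (parts 2F) (⊕-cong ≈-refl (⊝-cong (∙-cong ≈-refl (≈-trans (part-q₂ (q ∙ X)) (part-q₁ X)))))) ⟩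
    norm (a ⊕ ⊝ (x ∙ (q ∙ b))) (b ⊕ ⊝ (x ∙ (q ∙ d))) (d ⊕ ⊝ (x ∙ a))
      ≈⟨ solve 5 (λ q a b d x → let n = λ a b d → a :* a :* a :+ q :* (b :* b :* b) :+ q :* q :* (d :* d :* d) :- con (+ 3) :* q :* (a :* b :* d)
           in n (a :- x :* (q :* b)) (b :- x :* (q :* d)) (d :- x :* a) := n a b d :* (con 1ℤ :+ con -1ℤ :* (q :* q :* (x :* x :* x)))) ≈-refl q a b d x ⟩
    N X ∙ (ι 1ℤ ⊕ ι -1ℤ ∙ (q ∙ q ∙ (x ∙ x ∙ x)))
      ≈⟨ ∙-cong ≈-refl (⊕-cong ≈-refl (∙-cong ≈-refl
           (≈-trans (∙-cong (≈-sym (q^-+ 1 1)) (cube-q^ i)) (≈-sym (q^-+ 2 (i * 3)))))) ⟩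
    N X ∙ 1-q^ (2 + i * 3)  ∎
    where
    open ≈-Reasoning
    x = q^ i
    parts : ∀ r → part r (X ∙ 1-q^ (2 + i * 3)) ≈ part r X ⊕ ⊝ (x ∙ part r (q ∙ (q ∙ X)))
    parts r = ≈-trans (part-cong r (≈-trans
        (∙-cong ≈-refl (⊕-cong ≈-refl (∙-cong ≈-refl (≈-trans (q^-+ 2 (i * 3)) (∙-cong (q^-+ 1 1) (≈-sym (cubed-q^ i)))))))
        (solve 3 (λ a q x → a :* (con 1ℤ :+ con -1ℤ :* (q :* q :* x)) := a :- x :* (q :* (q :* a))) ≈-refl X q (cubed x))))
      (part-minus r x (q ∙ (q ∙ X)))

-- For k prime to 3 this is N(f k) f(3k) = (f k)⁴, up to truncation and the cofactor X.
N-products : ∀ k → (∀ n → NonMultiple (k * (n * 3) + k)) → (∀ n → NonMultiple (k * (1 + n * 3) + k)) → ∀ X n →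
  N (X ∙ products -1ℤ k k (n * 3)) ∙ products -1ℤ (k * 3) (k * 3) n ≈
  N X ∙ (products -1ℤ k k (n * 3) ∙ (products -1ℤ k k n ∙ products -1ℤ k k n ∙ products -1ℤ k k n))
N-products k k₁ k₂ X zero = ≈-trans (∙-cong (norm-cong (unit 0F) (unit 1F) (unit 2F)) ≈-refl)
  (solve 1 (λ x → x :* con 1ℤ := x :* (con 1ℤ :* (con 1ℤ :* con 1ℤ :* con 1ℤ))) ≈-refl (N X))
  where
  unit : ∀ r → part r (X ∙ ι 1ℤ) ≈ part r X
  unit r = part-cong r (∙-identityʳ X)
N-products k k₁ k₂ X (suc n) = begin
  N (X ∙ (p ∙ u ∙ v ∙ 1-q^ (k * (2 + n * 3) + k))) ∙ (s ∙ 1-q^ (k * 3 * n + k * 3))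
    ≡⟨ cong₂ (λ x y → N (X ∙ (p ∙ u ∙ v ∙ 1-q^ x)) ∙ (s ∙ 1-q^ y)) (e₂ k n) (e₃ k n) ⟩
  N (X ∙ (p ∙ u ∙ v ∙ y)) ∙ (s ∙ y)      ≈⟨ ∙-cong (N-cong (solve 5 (λ x p u v y → x :* (p :* u :* v :* y) := x :* p :* u :* v :* y) ≈-refl X p u v y)) ≈-refl ⟩
  N (X ∙ p ∙ u ∙ v ∙ y) ∙ (s ∙ y)
    ≈⟨ ∙-cong (≈-trans (N-multiple (X ∙ p ∙ u ∙ v) (k * n + k)) (∙-cong
         (≈-trans (N-nonmultiple (X ∙ p ∙ u) (k₂ n)) (∙-cong (N-nonmultiple (X ∙ p) (k₁ n)) ≈-refl)) ≈-refl)) ≈-refl ⟩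
  N (X ∙ p) ∙ u ∙ v ∙ (t ∙ t ∙ t) ∙ (s ∙ y)
    ≈⟨ solve 6 (λ n u v t s y → n :* u :* v :* (t :* t :* t) :* (s :* y) := n :* s :* (u :* v :* y :* (t :* t :* t))) ≈-refl
         (N (X ∙ p)) u v t s y ⟩
  N (X ∙ p) ∙ s ∙ (u ∙ v ∙ y ∙ (t ∙ t ∙ t))          ≈⟨ ∙-cong (N-products k k₁ k₂ X n) ≈-refl ⟩
  N X ∙ (p ∙ (r ∙ r ∙ r)) ∙ (u ∙ v ∙ y ∙ (t ∙ t ∙ t))
    ≈⟨ solve 7 (λ n p r u v y t → n :* (p :* (r :* r :* r)) :* (u :* v :* y :* (t :* t :* t))
         := n :* (p :* u :* v :* y :* (r :* t :* (r :* t) :* (r :* t)))) ≈-refl (N X) p r u v y t ⟩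
  N X ∙ (p ∙ u ∙ v ∙ y ∙ (r ∙ t ∙ (r ∙ t) ∙ (r ∙ t)))
    ≡⟨ cong (λ x → N X ∙ (p ∙ u ∙ v ∙ 1-q^ x ∙ (r ∙ t ∙ (r ∙ t) ∙ (r ∙ t)))) (sym (e₂ k n)) ⟩
  N X ∙ (p ∙ u ∙ v ∙ 1-q^ (k * (2 + n * 3) + k) ∙ (r ∙ t ∙ (r ∙ t) ∙ (r ∙ t)))  ∎
  where
  open ≈-Reasoning
  N-cong : ∀ {A B} → A ≈ B → N A ≈ N B
  N-cong p = norm-cong (part-cong 0F p) (part-cong 1F p) (part-cong 2F p)
  p = products -1ℤ k k (n * 3)
  r = products -1ℤ k k n
  s = products -1ℤ (k * 3) (k * 3) n
  t = 1-q^ (k * n + k)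
  u = 1-q^ (k * (n * 3) + k)
  v = 1-q^ (k * (1 + n * 3) + k)
  y = 1-q^ ((k * n + k) * 3)
  e₂ : ∀ k n → k * (2 + n * 3) + k ≡ (k * n + k) * 3
  e₂ = ℕ-RingSolver.solve-∀
  e₃ : ∀ k n → k * 3 * n + k * 3 ≡ (k * n + k) * 3
  e₃ = ℕ-RingSolver.solve-∀

-- `N-products` is applied for k = 2 with the products for k = 1 as cofactor, then for k = 1. Under
-- `N` the products have 3n factors because passing to parts divides the precision by 3.
N-F : N F ∙ P ≈ F ∙ F ∙ F ∙ F
N-F = ⟶-unique left right
  where
  p₁ = products -1ℤ 1 1
  p₂ = products -1ℤ 2 2
  products⟶f : ∀ k .{{_ : NonZero k}} → products -1ℤ k k ⟶ f k
  products⟶f k n = Mod.trans (products⟶ -1ℤ k k n) (≈⇒≈[] (≈-sym (f≈product∞ k)))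
  f₁ = products⟶f 1
  f₂ = products⟶f 2
  nonmultiple₁ : ∀ {x} i → x ≡ 1 + i * 3 → NonMultiple x
  nonmultiple₁ i refl = 1+3* i
  nonmultiple₂ : ∀ {x} i → x ≡ 2 + i * 3 → NonMultiple x
  nonmultiple₂ i refl = 2+3* i
  r₁ : ∀ n → 1 * (n * 3) + 1 ≡ 1 + n * 3
  r₁ = ℕ-RingSolver.solve-∀
  r₂ : ∀ n → 1 * (1 + n * 3) + 1 ≡ 2 + n * 3
  r₂ = ℕ-RingSolver.solve-∀
  r₃ : ∀ n → 2 * (n * 3) + 2 ≡ 2 + (n * 2) * 3
  r₃ = ℕ-RingSolver.solve-∀
  r₄ : ∀ n → 2 * (1 + n * 3) + 2 ≡ 1 + (1 + n * 2) * 3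
  r₄ = ℕ-RingSolver.solve-∀
  N-1 : N (ι 1ℤ) ≈ ι 1ℤ
  N-1 = ≈-trans (norm-cong part-1₀ part-1₁ part-1₂)
    (solve 1 (λ q → con 1ℤ :* con 1ℤ :* con 1ℤ :+ q :* (con 0ℤ :* con 0ℤ :* con 0ℤ) :+ q :* q :* (con 0ℤ :* con 0ℤ :* con 0ℤ)
      :- con (+ 3) :* q :* (con 1ℤ :* con 0ℤ :* con 0ℤ) := con 1ℤ) ≈-refl q)
  truncated : ∀ n → N (ι 1ℤ ∙ p₁ (n * 3) ∙ p₂ (n * 3)) ∙ (products -1ℤ 3 3 n ∙ products -1ℤ 6 6 n) ≈
    p₁ (n * 3) ∙ (p₁ n ∙ p₁ n ∙ p₁ n) ∙ (p₂ (n * 3) ∙ (p₂ n ∙ p₂ n ∙ p₂ n))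
  truncated n = begin
    N (ι 1ℤ ∙ p₁ (n * 3) ∙ p₂ (n * 3)) ∙ (s₃ ∙ s₆)
      ≈⟨ solve 3 (λ n s t → n :* (s :* t) := n :* t :* s) ≈-refl _ s₃ s₆ ⟩
    N (ι 1ℤ ∙ p₁ (n * 3) ∙ p₂ (n * 3)) ∙ s₆ ∙ s₃
      ≈⟨ ∙-cong (N-products 2 (λ n → nonmultiple₂ (n * 2) (r₃ n)) (λ n → nonmultiple₁ (1 + n * 2) (r₄ n)) _ n) ≈-refl ⟩
    N (ι 1ℤ ∙ p₁ (n * 3)) ∙ c₂ ∙ s₃
      ≈⟨ solve 3 (λ n c s → n :* c :* s := n :* s :* c) ≈-refl _ c₂ s₃ ⟩
    N (ι 1ℤ ∙ p₁ (n * 3)) ∙ s₃ ∙ c₂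
      ≈⟨ ∙-cong (N-products 1 (λ n → nonmultiple₁ n (r₁ n)) (λ n → nonmultiple₂ n (r₂ n)) _ n) ≈-refl ⟩
    N (ι 1ℤ) ∙ c₁ ∙ c₂     ≈⟨ ∙-cong (≈-trans (∙-cong N-1 ≈-refl) (∙-identityˡ c₁)) ≈-refl ⟩
    c₁ ∙ c₂                ∎
    where
    open ≈-Reasoning
    s₃ = products -1ℤ 3 3 n
    s₆ = products -1ℤ 6 6 n
    c₁ = p₁ (n * 3) ∙ (p₁ n ∙ p₁ n ∙ p₁ n)
    c₂ = p₂ (n * 3) ∙ (p₂ n ∙ p₂ n ∙ p₂ n)
  left : (λ n → N (ι 1ℤ ∙ p₁ (n * 3) ∙ p₂ (n * 3)) ∙ (products -1ℤ 3 3 n ∙ products -1ℤ 6 6 n)) ⟶ N F ∙ P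
  left n = ∙-cong[] (N-cong[] (Mod.trans (∙-cong[] (≈⇒≈[] (∙-identityˡ _)) Mod.refl) (∙-cong[] (f₁ (n * 3)) (f₂ (n * 3)))))
    (∙-cong[] (products⟶f 3 n) (products⟶f 6 n))
  right : (λ n → N (ι 1ℤ ∙ p₁ (n * 3) ∙ p₂ (n * 3)) ∙ (products -1ℤ 3 3 n ∙ products -1ℤ 6 6 n)) ⟶ F ∙ F ∙ F ∙ F
  right n = Mod.trans (≈⇒≈[] (truncated n)) (Mod.trans
    (⟶-∙ (⟶-∙ (⟶-subsequence 3 f₁) (⟶-∙ (⟶-∙ f₁ f₁) f₁)) (⟶-∙ (⟶-subsequence 3 f₂) (⟶-∙ (⟶-∙ f₂ f₂) f₂)) n)
    (≈⇒≈[] (solve 2 (λ x y → x :* (x :* x :* x) :* (y :* (y :* y :* y)) := x :* y :* (x :* y) :* (x :* y) :* (x :* y)) ≈-refl (f 1) (f 2))))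

-- The cubic equation of F

cubed-products : ∀ e n → cubed (products -1ℤ e e n) ≈ products -1ℤ (e * 3) (e * 3) n
cubed-products e zero    = cubed-ι 1ℤ
cubed-products e (suc n) = ≈-trans (cubed-∙ _ _) (∙-cong (cubed-products e n) (≈-trans (cubed-⊕ _ _)
  (⊕-cong (cubed-ι 1ℤ) (≈-trans (cubed-∙ _ _) (∙-cong (cubed-ι -1ℤ)
    (≈-trans (cubed-q^ (e * n + e)) (≡⇒≈ (cong q^_ (identity e n)))))))))
  where
  identity : ∀ e n → (e * n + e) * 3 ≡ e * 3 * n + e * 3
  identity = ℕ-RingSolver.solve-∀

cubed-f : ∀ k .{{_ : NonZero k}} .{{_ : NonZero (k * 3)}} → cubed (f k) ≈ f (k * 3)
cubed-f k = ⟶-unique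
  (λ n → cubed-cong[] (Mod.trans (products⟶ -1ℤ k k n) (≈⇒≈[] (≈-sym (f≈product∞ k)))))
  (λ n → Mod.trans (≈⇒≈[] (cubed-products k n))
    (Mod.trans (products⟶ -1ℤ (k * 3) (k * 3) n) (≈⇒≈[] (≈-sym (f≈product∞ (k * 3))))))

cubed-F : cubed F ≈ P
cubed-F = ≈-trans (cubed-∙ (f 1) (f 2)) (∙-cong (cubed-f 1) (cubed-f 2))

cubed-P : cubed P ≈ f 9 ∙ f 18
cubed-P = ≈-trans (cubed-∙ (f 3) (f 6)) (∙-cong (cubed-f 3) (cubed-f 6))

cubed-q : cubed q ≈ q ∙ q ∙ q
cubed-q = ≈-trans (cubed-q^ 1) (≈-trans (q^-+ 2 1) (∙-cong (q^-+ 1 1) ≈-refl))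

assemble-parts : ∀ X → X ≈ assemble (part 0F X) (part 1F X) (part 2F X)
assemble-parts X = part-injective λ { 0F → ≈-sym (part-assemble₀ _ _ _)
                                    ; 1F → ≈-sym (part-assemble₁ _ _ _)
                                    ; 2F → ≈-sym (part-assemble₂ _ _ _) }

private
  a = part 0F F
  b = part 1F F
  d = part 2F F
  â = cubed a
  b̂ = cubed b
  d̂ = cubed d
  R = cubed P

cubic : F ∙ F ∙ F ⊕ ι (+ 3) ∙ q ∙ R ∙ F ∙ F ⊕ ι (+ 9) ∙ q ∙ q ∙ R ∙ R ∙ F ≈ cubed (N F)
cubic = begin
  F ∙ F ∙ F ⊕ ι (+ 3) ∙ q ∙ R ∙ F ∙ F ⊕ ι (+ 9) ∙ q ∙ q ∙ R ∙ R ∙ F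
    ≈⟨ ⊕-cong (⊕-cong (∙-cong (∙-cong F≈ F≈) F≈) (∙-cong (∙-cong (∙-cong ≈-refl R≈) F≈) F≈)) (∙-cong (∙-cong (∙-cong ≈-refl R≈) R≈) F≈) ⟩
  F̂ ∙ F̂ ∙ F̂ ⊕ ι (+ 3) ∙ q ∙ ⊝ b̂ ∙ F̂ ∙ F̂ ⊕ ι (+ 9) ∙ q ∙ q ∙ ⊝ b̂ ∙ ⊝ b̂ ∙ F̂
    -- With R = -b̂ the left side exceeds the norm by 3q²F(âd̂ + 2b̂²), and the bracket is zero
    -- because ad = -2P² and b = -P.
    ≈⟨ solve 4 (λ q a b d → let f = a :+ q :* b :+ q :* (q :* d) ; c = q :* q :* q in
         f :* f :* f :+ con (+ 3) :* q :* (:- b) :* f :* f :+ con (+ 9) :* q :* q :* (:- b) :* (:- b) :* f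
         := a :* a :* a :+ c :* (b :* b :* b) :+ c :* c :* (d :* d :* d) :- con (+ 3) :* c :* (a :* b :* d)
            :+ con (+ 3) :* q :* q :* f :* (a :* d :+ con (+ 2) :* (b :* b))) ≈-refl q â b̂ d̂ ⟩
  n̂ (q ∙ q ∙ q) ⊕ ι (+ 3) ∙ q ∙ q ∙ F̂ ∙ (â ∙ d̂ ⊕ ι (+ 2) ∙ (b̂ ∙ b̂))
    ≈⟨ ⊕-cong (≈-sym n̂-cong) (∙-cong ≈-refl vanishes) ⟩
  n̂ (cubed q) ⊕ ι (+ 3) ∙ q ∙ q ∙ F̂ ∙ ι 0ℤ
    ≈⟨ solve 2 (λ x y → x :+ y :* con 0ℤ := x) ≈-refl (n̂ (cubed q)) (ι (+ 3) ∙ q ∙ q ∙ F̂) ⟩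
  n̂ (cubed q)
    ≈⟨ ≈-sym cubed-norm ⟩
  cubed (N F) ∎
  where
  open ≈-Reasoning
  F̂ = assemble a b d
  F≈ : F ≈ F̂
  F≈ = assemble-parts F
  R≈ : R ≈ ⊝ b̂
  R≈ = begin
    R                    ≈⟨ solve 1 (λ r → r := :- (:- r)) ≈-refl R ⟩
    ⊝ (⊝ R)              ≈⟨ ⊝-cong (≈-sym (cubed-⊝ P)) ⟩
    ⊝ cubed (⊝ P)        ≈⟨ ⊝-cong (cubed-cong (≈-sym F-part₁)) ⟩
    ⊝ b̂                  ∎
  n̂ : Series → Series
  n̂ c = â ∙ â ∙ â ⊕ c ∙ (b̂ ∙ b̂ ∙ b̂) ⊕ c ∙ c ∙ (d̂ ∙ d̂ ∙ d̂) ⊕ ⊝ (ι (+ 3) ∙ c ∙ (â ∙ b̂ ∙ d̂))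
  n̂-cong : n̂ (cubed q) ≈ n̂ (q ∙ q ∙ q)
  n̂-cong = ⊕-cong (⊕-cong (⊕-cong ≈-refl (∙-cong cubed-q ≈-refl)) (∙-cong (∙-cong cubed-q cubed-q) ≈-refl))
    (⊝-cong (∙-cong (∙-cong ≈-refl cubed-q) ≈-refl))
  cubed-3 : ∀ x y z → cubed (x ∙ y ∙ z) ≈ cubed x ∙ cubed y ∙ cubed z
  cubed-3 x y z = ≈-trans (cubed-∙ _ z) (∙-cong (cubed-∙ x y) ≈-refl)
  cubed-norm : cubed (N F) ≈ n̂ (cubed q)
  cubed-norm = ≈-trans (cubed-⊕ _ _) (⊕-cong (≈-trans (cubed-⊕ _ _) (⊕-cong (≈-trans (cubed-⊕ _ _)
      (⊕-cong (cubed-3 a a a) (≈-trans (cubed-∙ q _) (∙-cong ≈-refl (cubed-3 b b b)))))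
      (≈-trans (cubed-∙ (q ∙ q) _) (∙-cong (cubed-∙ q q) (cubed-3 d d d)))))
    (≈-trans (cubed-⊝ _) (⊝-cong (≈-trans (cubed-∙ _ _)
      (∙-cong (≈-trans (cubed-∙ _ q) (∙-cong (cubed-ι (+ 3)) ≈-refl)) (cubed-3 a b d))))))
  vanishes : â ∙ d̂ ⊕ ι (+ 2) ∙ (b̂ ∙ b̂) ≈ ι 0ℤ
  vanishes = begin
    â ∙ d̂ ⊕ ι (+ 2) ∙ (b̂ ∙ b̂)
      ≈⟨ ⊕-cong (≈-trans (≈-sym (cubed-∙ a d)) (≈-trans (cubed-cong F-parts₀₂)
           (≈-trans (cubed-∙ _ _) (∙-cong (cubed-ι (ℤ.- + 2)) (≈-trans (cubed-∙ P P) (∙-cong R≈ R≈)))))) ≈-refl ⟩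
    ι (ℤ.- + 2) ∙ (⊝ b̂ ∙ ⊝ b̂) ⊕ ι (+ 2) ∙ (b̂ ∙ b̂)
      ≈⟨ solve 1 (λ b → con (ℤ.- + 2) :* ((:- b) :* (:- b)) :+ con (+ 2) :* (b :* b) := con 0ℤ) ≈-refl b̂ ⟩
    ι 0ℤ ∎

-- The coefficient is b² + 2ad = P² - 4P². It enters the extract of K/F, in which F² survives.
part₂-F² : part 2F (F ∙ F) ≈ ι (ℤ.- + 3) ∙ (P ∙ P)
part₂-F² = begin
  part 2F (F ∙ F)     ≈⟨ part-cong 2F (≈-trans (∙-cong (assemble-parts F) (assemble-parts F)) square) ⟩
  part 2F (assemble x y z)     ≈⟨ part-assemble₂ x y z ⟩
  b ∙ b ⊕ ι (+ 2) ∙ (a ∙ d)    ≈⟨ ⊕-cong (∙-cong F-part₁ F-part₁) (∙-cong ≈-refl F-parts₀₂) ⟩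
  ⊝ P ∙ ⊝ P ⊕ ι (+ 2) ∙ (ι (ℤ.- + 2) ∙ (P ∙ P))
    ≈⟨ solve 1 (λ p → (:- p) :* (:- p) :+ con (+ 2) :* (con (ℤ.- + 2) :* (p :* p)) := con (ℤ.- + 3) :* (p :* p)) ≈-refl P ⟩
  ι (ℤ.- + 3) ∙ (P ∙ P) ∎
  where
  open ≈-Reasoning
  x = a ∙ a ⊕ q ∙ (ι (+ 2) ∙ (b ∙ d))
  y = ι (+ 2) ∙ (a ∙ b) ⊕ q ∙ (d ∙ d)
  z = b ∙ b ⊕ ι (+ 2) ∙ (a ∙ d)
  double : ∀ u v → ι (+ 2) ∙ (cubed u ∙ cubed v) ≈ cubed (ι (+ 2) ∙ (u ∙ v))
  double u v = ≈-sym (≈-trans (cubed-∙ _ _) (∙-cong (cubed-ι (+ 2)) (cubed-∙ u v)))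
  square : assemble a b d ∙ assemble a b d ≈ assemble x y z
  square = begin
    assemble a b d ∙ assemble a b d
      ≈⟨ solve 4 (λ q a b d → let f = a :+ q :* b :+ q :* (q :* d) ; c = q :* q :* q in
           f :* f := a :* a :+ c :* (con (+ 2) :* (b :* d)) :+ q :* (con (+ 2) :* (a :* b) :+ c :* (d :* d))
             :+ q :* (q :* (b :* b :+ con (+ 2) :* (a :* d)))) ≈-refl q â b̂ d̂ ⟩
    â ∙ â ⊕ q ∙ q ∙ q ∙ (ι (+ 2) ∙ (b̂ ∙ d̂)) ⊕ q ∙ (ι (+ 2) ∙ (â ∙ b̂) ⊕ q ∙ q ∙ q ∙ (d̂ ∙ d̂))
      ⊕ q ∙ (q ∙ (b̂ ∙ b̂ ⊕ ι (+ 2) ∙ (â ∙ d̂)))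
      ≈⟨ ⊕-cong (⊕-cong
           (≈-trans (⊕-cong (≈-sym (cubed-∙ a a)) (≈-trans (∙-cong (≈-sym cubed-q) (double b d)) (≈-sym (cubed-∙ q _)))) (≈-sym (cubed-⊕ _ _)))
           (∙-cong ≈-refl (≈-trans (⊕-cong (double a b) (≈-trans (∙-cong (≈-sym cubed-q) (≈-sym (cubed-∙ d d))) (≈-sym (cubed-∙ q _)))) (≈-sym (cubed-⊕ _ _)))))
           (∙-cong ≈-refl (∙-cong ≈-refl (≈-trans (⊕-cong (≈-sym (cubed-∙ b b)) (double a d)) (≈-sym (cubed-⊕ _ _))))) ⟩
    assemble x y z ∎

F-constant : F 0 ≡ 1ℤ
F-constant = ∙-constant (f 1) (f 2)

P-constant : P 0 ≡ 1ℤ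
P-constant = ∙-constant (f 3) (f 6)

-- Powers of 1/F and the recurrence of their extracts

G : Series
G = inverse F

FG≈1 : F ∙ G ≈ ι 1ℤ
FG≈1 = ∙-inverse F F-constant

ξ t : Series
ξ = P ∙ G
t = ξ ↑ 4

-- Dividing N X = P³ Y by N = F⁴ / P.
divide-norm : ∀ {X Y} → N F ∙ X ≈ P ∙ P ∙ P ∙ Y → X ≈ t ∙ Y
divide-norm {X} {Y} p = begin
  X                                          ≈⟨ solve 1 (λ x → x := con 1ℤ :* con 1ℤ :* con 1ℤ :* con 1ℤ :* x) ≈-refl X ⟩
  ι 1ℤ ∙ ι 1ℤ ∙ ι 1ℤ ∙ ι 1ℤ ∙ X
    ≈⟨ ∙-cong (∙-cong (∙-cong (∙-cong (≈-sym FG≈1) (≈-sym FG≈1)) (≈-sym FG≈1)) (≈-sym FG≈1)) ≈-refl ⟩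
  F ∙ G ∙ (F ∙ G) ∙ (F ∙ G) ∙ (F ∙ G) ∙ X
    ≈⟨ solve 3 (λ f g x → f :* g :* (f :* g) :* (f :* g) :* (f :* g) :* x := f :* f :* f :* f :* (g :* g :* g :* g :* x)) ≈-refl F G X ⟩
  F ∙ F ∙ F ∙ F ∙ (G ∙ G ∙ G ∙ G ∙ X)        ≈⟨ ∙-cong (≈-sym N-F) ≈-refl ⟩
  N F ∙ P ∙ (G ∙ G ∙ G ∙ G ∙ X)
    ≈⟨ solve 4 (λ n p g x → n :* p :* (g :* g :* g :* g :* x) := p :* (g :* g :* g :* g) :* (n :* x)) ≈-refl (N F) P G X ⟩
  P ∙ (G ∙ G ∙ G ∙ G) ∙ (N F ∙ X)            ≈⟨ ∙-cong ≈-refl p ⟩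
  P ∙ (G ∙ G ∙ G ∙ G) ∙ (P ∙ P ∙ P ∙ Y)
    ≈⟨ solve 3 (λ p g y → p :* (g :* g :* g :* g) :* (p :* p :* p :* y)
         := p :* g :* (p :* g :* (p :* g :* (p :* g :* con 1ℤ))) :* y) ≈-refl P G Y ⟩
  t ∙ Y                                      ∎
  where open ≈-Reasoning

-- With ζ = q R / F one has w j = q^j / F^(j+1) = ζ^(j+1) / (q R^(j+1)); so q H j is the extract of ζ^(j+1).

w h H : ℕ → Series
w j = (q ∙ G) ↑ j ∙ G
h j = part 2F (w j)
H j = P ↑ suc j ∙ h j

private
  K = cubed (N F)

-- The cubic is divided by F, F² and F³ in turn. The last version drives the recurrence; in the
-- first two, positive powers of F remain, and their known parts enter rows 1 and 2.
cubic-G : K ∙ G ≈ F ∙ F ⊕ ι (+ 3) ∙ R ∙ (q ∙ F) ⊕ ι (+ 9) ∙ (R ∙ (R ∙ (q ∙ (q ∙ ι 1ℤ))))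
cubic-G = begin
  K ∙ G         ≈⟨ ∙-cong (≈-sym cubic) ≈-refl ⟩
  (F ∙ F ∙ F ⊕ ι (+ 3) ∙ q ∙ R ∙ F ∙ F ⊕ ι (+ 9) ∙ q ∙ q ∙ R ∙ R ∙ F) ∙ G
    ≈⟨ solve 4 (λ f g q r → (f :* f :* f :+ con (+ 3) :* q :* r :* f :* f :+ con (+ 9) :* q :* q :* r :* r :* f) :* g
         := (f :* f :+ con (+ 3) :* r :* (q :* f) :+ con (+ 9) :* (r :* (r :* (q :* (q :* con 1ℤ))))) :* (f :* g)) ≈-refl F G q R ⟩
  (F ∙ F ⊕ ι (+ 3) ∙ R ∙ (q ∙ F) ⊕ ι (+ 9) ∙ (R ∙ (R ∙ (q ∙ (q ∙ ι 1ℤ))))) ∙ (F ∙ G)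
    ≈⟨ ≈-trans (∙-cong ≈-refl FG≈1) (∙-identityʳ _) ⟩
  F ∙ F ⊕ ι (+ 3) ∙ R ∙ (q ∙ F) ⊕ ι (+ 9) ∙ (R ∙ (R ∙ (q ∙ (q ∙ ι 1ℤ)))) ∎
  where open ≈-Reasoning

cubic-G² : K ∙ (G ∙ G) ≈ F ⊕ ι (+ 3) ∙ R ∙ q ⊕ ι (+ 9) ∙ R ∙ R ∙ q ∙ q ∙ G
cubic-G² = begin
  K ∙ (G ∙ G)   ≈⟨ ≈-trans (≈-sym (∙-assoc K G G)) (∙-cong cubic-G ≈-refl) ⟩
  (F ∙ F ⊕ ι (+ 3) ∙ R ∙ (q ∙ F) ⊕ ι (+ 9) ∙ (R ∙ (R ∙ (q ∙ (q ∙ ι 1ℤ))))) ∙ G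
    ≈⟨ solve 4 (λ f g q r → (f :* f :+ con (+ 3) :* r :* (q :* f) :+ con (+ 9) :* (r :* (r :* (q :* (q :* con 1ℤ))))) :* g
         := (f :+ con (+ 3) :* r :* q) :* (f :* g) :+ con (+ 9) :* r :* r :* q :* q :* g) ≈-refl F G q R ⟩
  (F ⊕ ι (+ 3) ∙ R ∙ q) ∙ (F ∙ G) ⊕ ι (+ 9) ∙ R ∙ R ∙ q ∙ q ∙ G
    ≈⟨ ⊕-cong (≈-trans (∙-cong ≈-refl FG≈1) (∙-identityʳ _)) ≈-refl ⟩
  F ⊕ ι (+ 3) ∙ R ∙ q ⊕ ι (+ 9) ∙ R ∙ R ∙ q ∙ q ∙ G ∎
  where open ≈-Reasoning

cubic-G³ : K ∙ (G ∙ G ∙ G) ≈ ι 1ℤ ⊕ ι (+ 3) ∙ R ∙ (q ∙ G) ⊕ ι (+ 9) ∙ R ∙ R ∙ (q ∙ G ∙ (q ∙ G))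
cubic-G³ = begin
  K ∙ (G ∙ G ∙ G)   ≈⟨ ≈-trans (≈-sym (∙-assoc K (G ∙ G) G)) (∙-cong cubic-G² ≈-refl) ⟩
  (F ⊕ ι (+ 3) ∙ R ∙ q ⊕ ι (+ 9) ∙ R ∙ R ∙ q ∙ q ∙ G) ∙ G
    ≈⟨ solve 4 (λ f g q r → (f :+ con (+ 3) :* r :* q :+ con (+ 9) :* r :* r :* q :* q :* g) :* g
         := f :* g :+ con (+ 3) :* r :* (q :* g) :+ con (+ 9) :* r :* r :* (q :* g :* (q :* g))) ≈-refl F G q R ⟩
  F ∙ G ⊕ ι (+ 3) ∙ R ∙ (q ∙ G) ⊕ ι (+ 9) ∙ R ∙ R ∙ (q ∙ G ∙ (q ∙ G))   ≈⟨ ⊕-cong (⊕-cong FG≈1 ≈-refl) ≈-refl ⟩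
  ι 1ℤ ⊕ ι (+ 3) ∙ R ∙ (q ∙ G) ⊕ ι (+ 9) ∙ R ∙ R ∙ (q ∙ G ∙ (q ∙ G)) ∎
  where open ≈-Reasoning

part₂-qF : part 2F (q ∙ F) ≈ ⊝ P
part₂-qF = ≈-trans (part-q₂ F) F-part₁

part₂-q² : part 2F (q ∙ (q ∙ ι 1ℤ)) ≈ ι 1ℤ
part₂-q² = ≈-trans (part-q₂ _) (≈-trans (part-q₁ _) part-1₀)

part-3R : ∀ r X → part r (ι (+ 3) ∙ R ∙ X) ≈ ι (+ 3) ∙ P ∙ part r X
part-3R r X = ≈-trans (part-cong r (∙-assoc _ R X)) (≈-trans (part-ι∙ r (+ 3) (R ∙ X))
  (≈-trans (∙-cong ≈-refl (part-cubed-∙ r P X)) (≈-sym (∙-assoc _ P _))))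

part-9RR : ∀ r X → part r (ι (+ 9) ∙ (R ∙ (R ∙ X))) ≈ ι (+ 9) ∙ (P ∙ (P ∙ part r X))
part-9RR r X = ≈-trans (part-ι∙ r (+ 9) _) (∙-cong ≈-refl
  (≈-trans (part-cubed-∙ r P _) (∙-cong ≈-refl (part-cubed-∙ r P X))))

N-h₀ : N F ∙ h 0 ≈ ι (+ 3) ∙ (P ∙ P)
N-h₀ = begin
  N F ∙ h 0                 ≈⟨ ∙-cong ≈-refl (part-cong 2F (∙-identityˡ G)) ⟩
  N F ∙ part 2F G           ≈⟨ ≈-sym (part-cubed-∙ 2F (N F) G) ⟩
  part 2F (K ∙ G)           ≈⟨ part-cong 2F cubic-G ⟩
  part 2F (F ∙ F ⊕ ι (+ 3) ∙ R ∙ (q ∙ F) ⊕ ι (+ 9) ∙ (R ∙ (R ∙ (q ∙ (q ∙ ι 1ℤ)))))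
    ≈⟨ ≈-trans (part-⊕ 2F _ _) (⊕-cong (≈-trans (part-⊕ 2F _ _)
         (⊕-cong part₂-F² (≈-trans (part-3R 2F _) (∙-cong ≈-refl part₂-qF))))
         (≈-trans (part-9RR 2F _) (∙-cong ≈-refl (∙-cong ≈-refl (∙-cong ≈-refl part₂-q²))))) ⟩
  ι (ℤ.- + 3) ∙ (P ∙ P) ⊕ ι (+ 3) ∙ P ∙ ⊝ P ⊕ ι (+ 9) ∙ (P ∙ (P ∙ ι 1ℤ))
    -- -3 - 3 + 9 = 3 is the origin of `m 1 1`.
    ≈⟨ solve 1 (λ p → con (ℤ.- + 3) :* (p :* p) :+ con (+ 3) :* p :* (:- p) :+ con (+ 9) :* (p :* (p :* con 1ℤ))
         := con (+ 3) :* (p :* p)) ≈-refl P ⟩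
  ι (+ 3) ∙ (P ∙ P) ∎
  where open ≈-Reasoning

N-h₁ : N F ∙ h 1 ≈ ι (+ 2) ∙ P ⊕ q ∙ (ι (+ 9) ∙ (P ∙ (P ∙ h 0)))
N-h₁ = begin
  N F ∙ h 1                 ≈⟨ ≈-sym (part-cubed-∙ 2F (N F) (w 1)) ⟩
  part 2F (K ∙ w 1)         ≈⟨ part-cong 2F rearranged ⟩
  part 2F (q ∙ F ⊕ ι (+ 3) ∙ R ∙ (q ∙ (q ∙ ι 1ℤ)) ⊕ cubed q ∙ (ι (+ 9) ∙ (R ∙ (R ∙ w 0))))
    ≈⟨ ≈-trans (part-⊕ 2F _ _) (⊕-cong (≈-trans (part-⊕ 2F _ _)
         (⊕-cong part₂-qF (≈-trans (part-3R 2F _) (∙-cong ≈-refl part₂-q²))))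
         (≈-trans (part-cubed-∙ 2F q _) (∙-cong ≈-refl (part-9RR 2F (w 0))))) ⟩
  ⊝ P ⊕ ι (+ 3) ∙ P ∙ ι 1ℤ ⊕ q ∙ (ι (+ 9) ∙ (P ∙ (P ∙ h 0)))
    -- -1 + 3 = 2 is the origin of `m 2 1`.
    ≈⟨ ⊕-cong (solve 1 (λ p → :- p :+ con (+ 3) :* p :* con 1ℤ := con (+ 2) :* p) ≈-refl P) ≈-refl ⟩
  ι (+ 2) ∙ P ⊕ q ∙ (ι (+ 9) ∙ (P ∙ (P ∙ h 0))) ∎
  where
  open ≈-Reasoning
  rearranged : K ∙ w 1 ≈ q ∙ F ⊕ ι (+ 3) ∙ R ∙ (q ∙ (q ∙ ι 1ℤ)) ⊕ cubed q ∙ (ι (+ 9) ∙ (R ∙ (R ∙ w 0)))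
  rearranged = begin
    K ∙ (q ∙ G ∙ ι 1ℤ ∙ G)   ≈⟨ solve 3 (λ k q g → k :* (q :* g :* con 1ℤ :* g) := q :* (k :* (g :* g))) ≈-refl K q G ⟩
    q ∙ (K ∙ (G ∙ G))        ≈⟨ ∙-cong ≈-refl cubic-G² ⟩
    q ∙ (F ⊕ ι (+ 3) ∙ R ∙ q ⊕ ι (+ 9) ∙ R ∙ R ∙ q ∙ q ∙ G)
      ≈⟨ solve 4 (λ q f r g → q :* (f :+ con (+ 3) :* r :* q :+ con (+ 9) :* r :* r :* q :* q :* g)
           := q :* f :+ con (+ 3) :* r :* (q :* (q :* con 1ℤ)) :+ q :* q :* q :* (con (+ 9) :* (r :* (r :* (con 1ℤ :* g))))) ≈-refl q F R G ⟩
    q ∙ F ⊕ ι (+ 3) ∙ R ∙ (q ∙ (q ∙ ι 1ℤ)) ⊕ q ∙ q ∙ q ∙ (ι (+ 9) ∙ (R ∙ (R ∙ w 0)))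
      ≈⟨ ⊕-cong ≈-refl (∙-cong (≈-sym cubed-q) ≈-refl) ⟩
    q ∙ F ⊕ ι (+ 3) ∙ R ∙ (q ∙ (q ∙ ι 1ℤ)) ⊕ cubed q ∙ (ι (+ 9) ∙ (R ∙ (R ∙ w 0))) ∎

-- The isolated 1 is the extract of q², and becomes `m 3 1`.
N-h₂ : N F ∙ h 2 ≈ ι 1ℤ ⊕ q ∙ (ι (+ 3) ∙ P ∙ h 0 ⊕ ι (+ 9) ∙ (P ∙ (P ∙ h 1)))
N-h₂ = begin
  N F ∙ h 2                 ≈⟨ ≈-sym (part-cubed-∙ 2F (N F) (w 2)) ⟩
  part 2F (K ∙ w 2)         ≈⟨ part-cong 2F rearranged ⟩
  part 2F (q ∙ (q ∙ ι 1ℤ) ⊕ cubed q ∙ (ι (+ 3) ∙ R ∙ w 0 ⊕ ι (+ 9) ∙ (R ∙ (R ∙ w 1))))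
    ≈⟨ ≈-trans (part-⊕ 2F _ _) (⊕-cong part₂-q² (≈-trans (part-cubed-∙ 2F q _) (∙-cong ≈-refl
         (≈-trans (part-⊕ 2F _ _) (⊕-cong (part-3R 2F (w 0)) (part-9RR 2F (w 1))))))) ⟩
  ι 1ℤ ⊕ q ∙ (ι (+ 3) ∙ P ∙ h 0 ⊕ ι (+ 9) ∙ (P ∙ (P ∙ h 1))) ∎
  where
  open ≈-Reasoning
  rearranged : K ∙ w 2 ≈ q ∙ (q ∙ ι 1ℤ) ⊕ cubed q ∙ (ι (+ 3) ∙ R ∙ w 0 ⊕ ι (+ 9) ∙ (R ∙ (R ∙ w 1)))
  rearranged = begin
    K ∙ (q ∙ G ∙ (q ∙ G ∙ ι 1ℤ) ∙ G)
      ≈⟨ solve 3 (λ k q g → k :* (q :* g :* (q :* g :* con 1ℤ) :* g) := q :* q :* (k :* (g :* g :* g))) ≈-refl K q G ⟩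
    q ∙ q ∙ (K ∙ (G ∙ G ∙ G))    ≈⟨ ∙-cong ≈-refl cubic-G³ ⟩
    q ∙ q ∙ (ι 1ℤ ⊕ ι (+ 3) ∙ R ∙ (q ∙ G) ⊕ ι (+ 9) ∙ R ∙ R ∙ (q ∙ G ∙ (q ∙ G)))
      ≈⟨ solve 3 (λ q r g → q :* q :* (con 1ℤ :+ con (+ 3) :* r :* (q :* g) :+ con (+ 9) :* r :* r :* (q :* g :* (q :* g)))
           := q :* (q :* con 1ℤ) :+ q :* q :* q :* (con (+ 3) :* r :* (con 1ℤ :* g) :+ con (+ 9) :* (r :* (r :* (q :* g :* con 1ℤ :* g))))) ≈-refl q R G ⟩
    q ∙ (q ∙ ι 1ℤ) ⊕ q ∙ q ∙ q ∙ (ι (+ 3) ∙ R ∙ w 0 ⊕ ι (+ 9) ∙ (R ∙ (R ∙ w 1)))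
      ≈⟨ ⊕-cong ≈-refl (∙-cong (≈-sym cubed-q) ≈-refl) ⟩
    q ∙ (q ∙ ι 1ℤ) ⊕ cubed q ∙ (ι (+ 3) ∙ R ∙ w 0 ⊕ ι (+ 9) ∙ (R ∙ (R ∙ w 1))) ∎

-- From here on every term carries a factor q³ that leaves the extraction, so no constant is left
-- over: hence `m i 1` is 0 for i ≥ 4.
N-h₃ : ∀ j → N F ∙ h (3 + j) ≈ q ∙ (h j ⊕ ι (+ 3) ∙ P ∙ h (1 + j) ⊕ ι (+ 9) ∙ (P ∙ (P ∙ h (2 + j))))
N-h₃ j = begin
  N F ∙ h (3 + j)           ≈⟨ ≈-sym (part-cubed-∙ 2F (N F) (w (3 + j))) ⟩
  part 2F (K ∙ w (3 + j))   ≈⟨ part-cong 2F rearranged ⟩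
  part 2F (cubed q ∙ (w j ⊕ ι (+ 3) ∙ R ∙ w (1 + j) ⊕ ι (+ 9) ∙ (R ∙ (R ∙ w (2 + j)))))
    ≈⟨ ≈-trans (part-cubed-∙ 2F q _) (∙-cong ≈-refl (≈-trans (part-⊕ 2F _ _)
         (⊕-cong (≈-trans (part-⊕ 2F _ _) (⊕-cong ≈-refl (part-3R 2F (w (1 + j))))) (part-9RR 2F (w (2 + j)))))) ⟩
  q ∙ (h j ⊕ ι (+ 3) ∙ P ∙ h (1 + j) ⊕ ι (+ 9) ∙ (P ∙ (P ∙ h (2 + j)))) ∎
  where
  open ≈-Reasoning
  x = (q ∙ G) ↑ j
  rearranged : K ∙ w (3 + j) ≈ cubed q ∙ (w j ⊕ ι (+ 3) ∙ R ∙ w (1 + j) ⊕ ι (+ 9) ∙ (R ∙ (R ∙ w (2 + j))))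
  rearranged = begin
    K ∙ (q ∙ G ∙ (q ∙ G ∙ (q ∙ G ∙ x)) ∙ G)
      ≈⟨ solve 4 (λ k q g x → k :* (q :* g :* (q :* g :* (q :* g :* x)) :* g) := q :* q :* q :* (k :* (g :* g :* g)) :* (x :* g)) ≈-refl K q G x ⟩
    q ∙ q ∙ q ∙ (K ∙ (G ∙ G ∙ G)) ∙ (x ∙ G)    ≈⟨ ∙-cong (∙-cong (≈-sym cubed-q) cubic-G³) ≈-refl ⟩
    cubed q ∙ (ι 1ℤ ⊕ ι (+ 3) ∙ R ∙ (q ∙ G) ⊕ ι (+ 9) ∙ R ∙ R ∙ (q ∙ G ∙ (q ∙ G))) ∙ (x ∙ G)
      ≈⟨ solve 5 (λ c q r g x → c :* (con 1ℤ :+ con (+ 3) :* r :* (q :* g) :+ con (+ 9) :* r :* r :* (q :* g :* (q :* g))) :* (x :* g)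
           := c :* (x :* g :+ con (+ 3) :* r :* (q :* g :* x :* g) :+ con (+ 9) :* (r :* (r :* (q :* g :* (q :* g :* x) :* g))))) ≈-refl
           (cubed q) q R G x ⟩
    cubed q ∙ (w j ⊕ ι (+ 3) ∙ R ∙ w (1 + j) ⊕ ι (+ 9) ∙ (R ∙ (R ∙ w (2 + j)))) ∎

H₀ : H 0 ≈ t ∙ ι (+ 3)
H₀ = divide-norm $ begin
  N F ∙ (P ∙ ι 1ℤ ∙ h 0)   ≈⟨ solve 3 (λ n p h → n :* (p :* con 1ℤ :* h) := p :* (n :* h)) ≈-refl (N F) P (h 0) ⟩
  P ∙ (N F ∙ h 0)          ≈⟨ ∙-cong ≈-refl N-h₀ ⟩
  P ∙ (ι (+ 3) ∙ (P ∙ P))  ≈⟨ solve 1 (λ p → p :* (con (+ 3) :* (p :* p)) := p :* p :* p :* con (+ 3)) ≈-refl P ⟩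
  P ∙ P ∙ P ∙ ι (+ 3)      ∎
  where open ≈-Reasoning

H₁ : H 1 ≈ t ∙ (ι (+ 2) ⊕ q ∙ (ι (+ 9) ∙ H 0))
H₁ = divide-norm $ begin
  N F ∙ (P ∙ (P ∙ ι 1ℤ) ∙ h 1)   ≈⟨ solve 3 (λ n p h → n :* (p :* (p :* con 1ℤ) :* h) := p :* p :* (n :* h)) ≈-refl (N F) P (h 1) ⟩
  P ∙ P ∙ (N F ∙ h 1)            ≈⟨ ∙-cong ≈-refl N-h₁ ⟩
  P ∙ P ∙ (ι (+ 2) ∙ P ⊕ q ∙ (ι (+ 9) ∙ (P ∙ (P ∙ h 0))))
    ≈⟨ solve 3 (λ p q h → p :* p :* (con (+ 2) :* p :+ q :* (con (+ 9) :* (p :* (p :* h))))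
         := p :* p :* p :* (con (+ 2) :+ q :* (con (+ 9) :* (p :* con 1ℤ :* h)))) ≈-refl P q (h 0) ⟩
  P ∙ P ∙ P ∙ (ι (+ 2) ⊕ q ∙ (ι (+ 9) ∙ H 0))  ∎
  where open ≈-Reasoning

H₂ : H 2 ≈ t ∙ (ι 1ℤ ⊕ q ∙ (ι (+ 3) ∙ H 0 ⊕ ι (+ 9) ∙ H 1))
H₂ = divide-norm $ begin
  N F ∙ (P ∙ (P ∙ (P ∙ ι 1ℤ)) ∙ h 2)
    ≈⟨ solve 3 (λ n p h → n :* (p :* (p :* (p :* con 1ℤ)) :* h) := p :* p :* p :* (n :* h)) ≈-refl (N F) P (h 2) ⟩
  P ∙ P ∙ P ∙ (N F ∙ h 2)        ≈⟨ ∙-cong ≈-refl N-h₂ ⟩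
  P ∙ P ∙ P ∙ (ι 1ℤ ⊕ q ∙ (ι (+ 3) ∙ P ∙ h 0 ⊕ ι (+ 9) ∙ (P ∙ (P ∙ h 1))))
    ≈⟨ ∙-cong ≈-refl (solve 4 (λ p q h k → con 1ℤ :+ q :* (con (+ 3) :* p :* h :+ con (+ 9) :* (p :* (p :* k)))
         := con 1ℤ :+ q :* (con (+ 3) :* (p :* con 1ℤ :* h) :+ con (+ 9) :* (p :* (p :* con 1ℤ) :* k))) ≈-refl P q (h 0) (h 1)) ⟩
  P ∙ P ∙ P ∙ (ι 1ℤ ⊕ q ∙ (ι (+ 3) ∙ H 0 ⊕ ι (+ 9) ∙ H 1))  ∎
  where open ≈-Reasoning

-- Scaling by powers of P turns the coefficients into the integers 1, 3, 9 of the recurrence for `m`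
-- and leaves the P³ that `divide-norm` converts into `t`.
H₃ : ∀ j → H (3 + j) ≈ t ∙ (q ∙ (H j ⊕ ι (+ 3) ∙ H (1 + j) ⊕ ι (+ 9) ∙ H (2 + j)))
H₃ j = divide-norm $ begin
  N F ∙ (P ∙ (P ∙ (P ∙ x)) ∙ h (3 + j))
    ≈⟨ solve 4 (λ n p x h → n :* (p :* (p :* (p :* x)) :* h) := p :* p :* p :* x :* (n :* h)) ≈-refl (N F) P x (h (3 + j)) ⟩
  P ∙ P ∙ P ∙ x ∙ (N F ∙ h (3 + j))        ≈⟨ ∙-cong ≈-refl (N-h₃ j) ⟩
  P ∙ P ∙ P ∙ x ∙ (q ∙ (h j ⊕ ι (+ 3) ∙ P ∙ h (1 + j) ⊕ ι (+ 9) ∙ (P ∙ (P ∙ h (2 + j)))))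
    ≈⟨ solve 6 (λ p x q h k l → p :* p :* p :* x :* (q :* (h :+ con (+ 3) :* p :* k :+ con (+ 9) :* (p :* (p :* l))))
         := p :* p :* p :* (q :* (x :* h :+ con (+ 3) :* (p :* x :* k) :+ con (+ 9) :* (p :* (p :* x) :* l)))) ≈-refl
         P x q (h j) (h (1 + j)) (h (2 + j)) ⟩
  P ∙ P ∙ P ∙ (q ∙ (H j ⊕ ι (+ 3) ∙ H (1 + j) ⊕ ι (+ 9) ∙ H (2 + j)))  ∎
  where
  open ≈-Reasoning
  x = P ↑ suc j

-- Linear combinations

linear : ℕ → (ℕ → ℤ) → (ℕ → Series) → Series
linear zero    y S = ι 0ℤ
linear (suc N) y S = ι (y 0) ∙ S 0 ⊕ linear N (y ∘ suc) (S ∘ suc)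

linear-cong : ∀ N {y y′ S S′} → (∀ i → i < N → y i ≡ y′ i) → (∀ i → i < N → S i ≈ S′ i) → linear N y S ≈ linear N y′ S′
linear-cong zero    y≡ S≈ = ≈-refl
linear-cong (suc N) y≡ S≈ = ⊕-cong (∙-cong (≡⇒≈ (cong ι (y≡ 0 (s≤s z≤n)))) (S≈ 0 (s≤s z≤n)))
  (linear-cong N (λ i i<N → y≡ (suc i) (s≤s i<N)) (λ i i<N → S≈ (suc i) (s≤s i<N)))

linear-zero : ∀ N y S → (∀ i → y i ≡ 0ℤ) → linear N y S ≈ ι 0ℤ
linear-zero zero    y S y≡0 = ≈-refl
linear-zero (suc N) y S y≡0 = ≈-trans (⊕-cong (∙-cong (≡⇒≈ (cong ι (y≡0 0))) ≈-refl) (linear-zero N _ (S ∘ suc) (y≡0 ∘ suc)))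
  (solve 1 (λ s → con 0ℤ :* s :+ con 0ℤ := con 0ℤ) ≈-refl (S 0))

linear-drop : ∀ k N y S → (∀ i → i < k → y i ≡ 0ℤ) → linear (k + N) y S ≈ linear N (y ∘ (_+_ k)) (S ∘ (_+_ k))
linear-drop zero    N y S y≡0 = ≈-refl
linear-drop (suc k) N y S y≡0 = ≈-trans
  (⊕-cong (∙-cong (≡⇒≈ (cong ι (y≡0 0 (s≤s z≤n)))) ≈-refl) (linear-drop k N _ (S ∘ suc) (λ i i<k → y≡0 (suc i) (s≤s i<k))))
  (solve 2 (λ s x → con 0ℤ :* s :+ x := x) ≈-refl (S 0) _)

linear-+ : ∀ N y z S → linear N (λ i → y i ℤ.+ z i) S ≈ linear N y S ⊕ linear N z S
linear-+ zero    y z S = ≈-sym (⊕-identityˡ _)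
linear-+ (suc N) y z S = ≈-trans (⊕-cong (∙-cong (ι-+ (y 0) (z 0)) ≈-refl) (linear-+ N (y ∘ suc) (z ∘ suc) (S ∘ suc)))
  (solve 5 (λ a b s x y → (a :+ b) :* s :+ (x :+ y) := a :* s :+ x :+ (b :* s :+ y)) ≈-refl
    (ι (y 0)) (ι (z 0)) (S 0) (linear N (y ∘ suc) (S ∘ suc)) (linear N (z ∘ suc) (S ∘ suc)))

linear-scale : ∀ N k y S → linear N (λ i → k ℤ.* y i) S ≈ ι k ∙ linear N y S
linear-scale zero    k y S = ≈-sym (∙-zeroʳ (ι k))
linear-scale (suc N) k y S = ≈-trans (⊕-cong (∙-cong (ι-* k (y 0)) ≈-refl) (linear-scale N k (y ∘ suc) (S ∘ suc)))
  (solve 4 (λ k a s x → k :* a :* s :+ k :* x := k :* (a :* s :+ x)) ≈-refl (ι k) (ι (y 0)) (S 0) (linear N (y ∘ suc) (S ∘ suc)))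

linear-∙ : ∀ N y X S → linear N y (λ i → X ∙ S i) ≈ X ∙ linear N y S
linear-∙ zero    y X S = ≈-sym (∙-zeroʳ X)
linear-∙ (suc N) y X S = ≈-trans (⊕-cong ≈-refl (linear-∙ N (y ∘ suc) X (S ∘ suc)))
  (solve 4 (λ k a s x → a :* (k :* s) :+ k :* x := k :* (a :* s :+ x)) ≈-refl X (ι (y 0)) (S 0) (linear N (y ∘ suc) (S ∘ suc)))

linear-linear : ∀ M N (y : ℕ → ℤ) (d : ℕ → ℕ → ℤ) S →
  linear M y (λ i → linear N (d i) S) ≈ linear N (λ j → ∑[ i < M ] (y (toℕ i) ℤ.* d (toℕ i) j)) S
linear-linear zero    N y d S = ≈-sym (linear-zero N (λ _ → 0ℤ) S (λ _ → refl))
linear-linear (suc M) N y d S = ≈-sym (≈-trans (linear-+ N (λ j → y 0 ℤ.* d 0 j) (λ j → ∑[ i < M ] (y (suc (toℕ i)) ℤ.* d (suc (toℕ i)) j)) S)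
  (⊕-cong (linear-scale N (y 0) (d 0) S) (≈-sym (linear-linear M N (y ∘ suc) (d ∘ suc) S))))

part-linear : ∀ r N y S → part r (linear N y S) ≈ linear N y (part r ∘ S)
part-linear r zero    y S = zeros r
  where
  zeros : ∀ r → part r (ι 0ℤ) ≈ ι 0ℤ
  zeros r = ⟨ (λ n → trans (ι-zero (n * 3 + toℕ r)) (sym (ι-zero n))) ⟩
part-linear r (suc N) y S = ≈-trans (part-⊕ r _ _) (⊕-cong (part-ι∙ r (y 0) (S 0)) (part-linear r N (y ∘ suc) (S ∘ suc)))

linear-coeff : ∀ N y S n → linear N y S n ≡ ∑[ i < N ] (y (toℕ i) ℤ.* S (toℕ i) n)
linear-coeff zero    y S zero    = refl
linear-coeff zero    y S (suc n) = refl
linear-coeff (suc N) y S n = trans (⊕-coeff _ _ n) (cong₂ ℤ._+_ (ι-∙ (y 0) (S 0) n) (linear-coeff N (y ∘ suc) (S ∘ suc) n))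

-- Expansions in the series q^j ξ^(4(j+1))

S : ℕ → Series
S j = q^ j ∙ ξ ↑ (4 * suc j)

S₀ : S 0 ≈ t
S₀ = ≈-trans (∙-cong q^0≈1 ≈-refl) (∙-identityˡ t)

S-+ : ∀ i j → S (i + j) ≈ q^ i ∙ ξ ↑ (4 * i) ∙ S j
S-+ i j = begin
  q^ (i + j) ∙ ξ ↑ (4 * suc (i + j))               ≡⟨ cong (λ k → q^ (i + j) ∙ ξ ↑ k) (identity i j) ⟩
  q^ (i + j) ∙ ξ ↑ (4 * i + 4 * suc j)             ≈⟨ ∙-cong (q^-+ i j) (↑-+ ξ (4 * i) (4 * suc j)) ⟩
  q^ i ∙ q^ j ∙ (ξ ↑ (4 * i) ∙ ξ ↑ (4 * suc j))
    ≈⟨ solve 4 (λ a b x y → a :* b :* (x :* y) := a :* x :* (b :* y)) ≈-refl (q^ i) (q^ j) (ξ ↑ (4 * i)) (ξ ↑ (4 * suc j)) ⟩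
  q^ i ∙ ξ ↑ (4 * i) ∙ S j                         ∎
  where
  open ≈-Reasoning
  identity : ∀ i j → 4 * (1 + (i + j)) ≡ 4 * i + 4 * (1 + j)
  identity = ℕ-RingSolver.solve-∀

row : ℕ → ℕ → ℤ
row k j = m k (suc j)

S-shift : ∀ N y → linear N y (S ∘ suc) ≈ t ∙ (q ∙ linear N y S)
S-shift N y = ≈-trans (linear-cong N {y} {y} (λ _ _ → refl) (λ j _ → S-+ 1 j)) (≈-trans (linear-∙ N y (q ∙ t) S)
  (solve 3 (λ q t x → q :* t :* x := t :* (q :* x)) ≈-refl q t (linear N y S)))

-- The padding N lets rows of different lengths be added at a common length: the three preceding
-- rows are called with padding 2 + N, 1 + N and N.
H-linear : ∀ k N → H k ≈ linear (suc k + N) (row (suc k)) S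
H-linear 0 N = begin
  H 0                     ≈⟨ H₀ ⟩
  t ∙ ι (+ 3)             ≈⟨ solve 1 (λ t → t :* con (+ 3) := con (+ 3) :* t :+ con 0ℤ) ≈-refl t ⟩
  ι (+ 3) ∙ t ⊕ ι 0ℤ      ≈⟨ ⊕-cong (∙-cong ≈-refl (≈-sym S₀)) (≈-sym (linear-zero N (row 1 ∘ suc) (S ∘ suc) (λ _ → refl))) ⟩
  linear (1 + N) (row 1) S  ∎
  where open ≈-Reasoning
H-linear 1 N = begin
  H 1                     ≈⟨ H₁ ⟩
  t ∙ (ι (+ 2) ⊕ q ∙ (ι (+ 9) ∙ H 0))
    ≈⟨ solve 3 (λ t q h → t :* (con (+ 2) :+ q :* (con (+ 9) :* h)) := con (+ 2) :* t :+ t :* (q :* (con (+ 9) :* h))) ≈-refl t q (H 0) ⟩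
  ι (+ 2) ∙ t ⊕ t ∙ (q ∙ (ι (+ 9) ∙ H 0))
    ≈⟨ ⊕-cong (∙-cong ≈-refl (≈-sym S₀)) (∙-cong ≈-refl (∙-cong ≈-refl
         (≈-trans (∙-cong ≈-refl (H-linear 0 N)) (≈-sym (linear-scale (suc N) (+ 9) (row 1) S))))) ⟩
  ι (+ 2) ∙ S 0 ⊕ t ∙ (q ∙ linear (suc N) (λ j → + 9 ℤ.* row 1 j) S)
    -- The rows agree by computation: `m 2 2` is 9 · 3.
    ≈⟨ ⊕-cong ≈-refl (≈-trans (≈-sym (S-shift (suc N) (λ j → + 9 ℤ.* row 1 j)))
         (linear-cong (suc N) {y = λ j → + 9 ℤ.* row 1 j} {y′ = row 2 ∘ suc} {S = S ∘ suc} (λ { 0 _ → refl ; (suc j) _ → refl }) (λ _ _ → ≈-refl))) ⟩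
  linear (2 + N) (row 2) S  ∎
  where open ≈-Reasoning
H-linear 2 N = begin
  H 2                     ≈⟨ H₂ ⟩
  t ∙ (ι 1ℤ ⊕ q ∙ (ι (+ 3) ∙ H 0 ⊕ ι (+ 9) ∙ H 1))
    ≈⟨ solve 3 (λ t q x → t :* (con 1ℤ :+ q :* x) := con 1ℤ :* t :+ t :* (q :* x)) ≈-refl t q _ ⟩
  ι 1ℤ ∙ t ⊕ t ∙ (q ∙ (ι (+ 3) ∙ H 0 ⊕ ι (+ 9) ∙ H 1))
    ≈⟨ ⊕-cong (∙-cong ≈-refl (≈-sym S₀)) (∙-cong ≈-refl (∙-cong ≈-refl (≈-trans (⊕-cong
         (≈-trans (∙-cong ≈-refl (H-linear 0 (suc N))) (≈-sym (linear-scale (2 + N) (+ 3) (row 1) S)))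
         (≈-trans (∙-cong ≈-refl (H-linear 1 N)) (≈-sym (linear-scale (2 + N) (+ 9) (row 2) S))))
         (≈-sym (linear-+ (2 + N) (λ j → + 3 ℤ.* row 1 j) (λ j → + 9 ℤ.* row 2 j) S))))) ⟩
  ι 1ℤ ∙ S 0 ⊕ t ∙ (q ∙ linear (2 + N) y S)
    -- Likewise `m 3 2` is 3 · 3 + 9 · 2 and `m 3 3` is 9 · 27.
    ≈⟨ ⊕-cong ≈-refl (≈-trans (≈-sym (S-shift (2 + N) y)) (linear-cong (2 + N) {y = y} {y′ = row 3 ∘ suc} {S = S ∘ suc}
         (λ { 0 _ → refl ; 1 _ → refl ; (suc (suc j)) _ → refl }) (λ _ _ → ≈-refl))) ⟩
  linear (3 + N) (row 3) S  ∎
  where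
  open ≈-Reasoning
  y : ℕ → ℤ
  y j = + 3 ℤ.* row 1 j ℤ.+ + 9 ℤ.* row 2 j
H-linear (suc (suc (suc k))) N = begin
  H (3 + k)               ≈⟨ H₃ k ⟩
  t ∙ (q ∙ (H k ⊕ ι (+ 3) ∙ H (1 + k) ⊕ ι (+ 9) ∙ H (2 + k)))
    ≈⟨ ∙-cong ≈-refl (∙-cong ≈-refl (≈-trans (⊕-cong (⊕-cong (resize (row (1 + k)) (cong suc (trans (ℕₚ.+-suc k (1 + N)) (cong suc (ℕₚ.+-suc k N)))) (H-linear k (2 + N)))
         (≈-trans (∙-cong ≈-refl (resize (row (2 + k)) (cong (_+_ 2) (ℕₚ.+-suc k N)) (H-linear (suc k) (1 + N)))) (≈-sym (linear-scale M (+ 3) (row (2 + k)) S))))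
         (≈-trans (∙-cong ≈-refl (H-linear (suc (suc k)) N)) (≈-sym (linear-scale M (+ 9) (row (3 + k)) S)))) collect)) ⟩
  t ∙ (q ∙ linear M (row (4 + k) ∘ suc) S)    ≈⟨ ≈-sym (S-shift M (row (4 + k) ∘ suc)) ⟩
  linear M (row (4 + k) ∘ suc) (S ∘ suc)
    ≈⟨ solve 2 (λ s x → x := con 0ℤ :* s :+ x) ≈-refl (S 0) _ ⟩
  linear (suc M) (row (4 + k)) S              ∎
  where
  open ≈-Reasoning
  M = 3 + k + N
  resize : ∀ {X n} y → n ≡ M → X ≈ linear n y S → X ≈ linear M y S
  resize y refl p = p
  collect : linear M (row (1 + k)) S ⊕ linear M (λ j → + 3 ℤ.* row (2 + k) j) S ⊕ linear M (λ j → + 9 ℤ.* row (3 + k) j) S ≈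
    linear M (row (4 + k) ∘ suc) S
  collect = ≈-trans (solve 3 (λ x y z → x :+ y :+ z := z :+ y :+ x) ≈-refl _ _ _)
    (≈-sym (≈-trans (linear-+ M (λ j → + 9 ℤ.* row (3 + k) j ℤ.+ + 3 ℤ.* row (2 + k) j) (row (1 + k)) S)
      (⊕-cong (linear-+ M (λ j → + 9 ℤ.* row (3 + k) j) (λ j → + 3 ℤ.* row (2 + k) j) S) ≈-refl)))

-- ζ³ is divisible by T, so the extract of ζ^k starts no earlier than T^(k/3). In row 4i this clears
-- the columns up to i, so the shift by i in `c` discards nothing.
m-left-zero : ∀ k j → 3 * j < k → m k j ≡ 0ℤ
m-left-zero 1 0 _ = refl
m-left-zero 2 0 _ = refl
m-left-zero 3 0 _ = refl
m-left-zero (suc (suc (suc (suc k)))) 0 _ = refl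
m-left-zero 1 (suc j) p = ⊥-elim (ℕₚ.<⇒≱ p (ℕₚ.≤-trans (s≤s z≤n) (ℕₚ.*-monoʳ-≤ 3 (s≤s (z≤n {j})))))
m-left-zero 2 (suc j) p = ⊥-elim (ℕₚ.<⇒≱ p (ℕₚ.≤-trans (s≤s (s≤s z≤n)) (ℕₚ.*-monoʳ-≤ 3 (s≤s (z≤n {j})))))
m-left-zero 3 (suc j) p = ⊥-elim (ℕₚ.<⇒≱ p (ℕₚ.*-monoʳ-≤ 3 (s≤s (z≤n {j}))))
m-left-zero (suc (suc (suc (suc k)))) 1 _ = refl
m-left-zero (suc (suc (suc (suc k)))) (suc (suc j)) p = cong₂ ℤ._+_
  (cong₂ (λ x y → + 9 ℤ.* x ℤ.+ + 3 ℤ.* y)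
    (m-left-zero (3 + k) (suc j) (ℕₚ.m≤n⇒m≤1+n (ℕₚ.m≤n⇒m≤1+n p′)))
    (m-left-zero (2 + k) (suc j) (ℕₚ.m≤n⇒m≤1+n p′)))
  (m-left-zero (1 + k) (suc j) p′)
  where
  p′ : 3 * suc j < 1 + k
  p′ = ℕₚ.+-cancelˡ-< 3 _ _ (subst (_< 4 + k) (ℕₚ.*-suc 3 (suc j)) p)

↑-∙ : ∀ X Y n → (X ∙ Y) ↑ n ≈ X ↑ n ∙ Y ↑ n
↑-∙ X Y zero    = ≈-sym (∙-identityˡ _)
↑-∙ X Y (suc n) = ≈-trans (∙-cong ≈-refl (↑-∙ X Y n))
  (solve 4 (λ x y a b → x :* y :* (a :* b) := x :* a :* (y :* b)) ≈-refl X Y (X ↑ n) (Y ↑ n))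

↑-cong : ∀ {X Y} n → X ≈ Y → X ↑ n ≈ Y ↑ n
↑-cong zero    p = ≈-refl
↑-cong (suc n) p = ∙-cong p (↑-cong n p)

cubed-↑ : ∀ X n → cubed (X ↑ n) ≈ cubed X ↑ n
cubed-↑ X zero    = cubed-ι 1ℤ
cubed-↑ X (suc n) = ≈-trans (cubed-∙ X _) (∙-cong ≈-refl (cubed-↑ X n))

q-↑ : ∀ n → q ↑ n ≈ q^ n
q-↑ n = ≈-trans (q^-↑ 1 n) (≡⇒≈ (cong q^_ (ℕₚ.*-identityˡ n)))

↑-constant : ∀ X n → X 0 ≡ 1ℤ → (X ↑ n) 0 ≡ 1ℤ
↑-constant X zero    p = refl
↑-constant X (suc n) p = trans (∙-constant X _) (cong₂ ℤ._*_ p (↑-constant X n p))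

ξ-constant : ξ 0 ≡ 1ℤ
ξ-constant = trans (∙-constant P G) (cong (ℤ._* 1ℤ) P-constant)

-- In ξ^k = (P/F)^k with k = 4(i + 1) the numerator is a series in q³ and leaves the extraction as
-- F^k. Multiplied by q^(i+1) ξ^k, the extract becomes `H (k ∸ 1)`, since F^k G^k = 1. The expansion
-- of the latter has no terms before `S (suc i)`, and `S-+` exhibits the multiplier in all the
-- others, so it cancels.
part₂-S : ∀ i N → part 2F (S i) ≈ linear (3 * suc i + N) (λ j → c (suc i) (suc j)) S
part₂-S i N = ∙-cancelˡ (ξ ↑ k) (↑-constant ξ k ξ-constant) $ q^-cancel (suc i) $ begin
  q^ suc i ∙ (ξ ↑ k ∙ part 2F (S i))
    ≈⟨ ∙-cong ≈-refl (∙-cong (↑-∙ P G k) part₂-S′) ⟩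
  q^ suc i ∙ (P ↑ k ∙ G ↑ k ∙ (F ↑ k ∙ y))
    ≈⟨ solve 5 (λ q p g f y → q :* (p :* g :* (f :* y)) := f :* g :* (p :* (q :* y))) ≈-refl (q^ suc i) (P ↑ k) (G ↑ k) (F ↑ k) y ⟩
  F ↑ k ∙ G ↑ k ∙ (P ↑ k ∙ (q^ suc i ∙ y))
    ≈⟨ ∙-cong (≈-trans (≈-sym (↑-∙ F G k)) (≈-trans (↑-cong k FG≈1) (1↑ k))) (∙-cong ≈-refl (≈-sym (part-cubed-∙ 2F (q^ suc i) _))) ⟩
  ι 1ℤ ∙ (P ↑ k ∙ part 2F (cubed (q^ suc i) ∙ (q^ i ∙ G ↑ k)))
    ≈⟨ ≈-trans (∙-identityˡ _) (∙-cong ≈-refl (part-cong 2F w-last)) ⟩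
  H (k ∸ 1)                              ≈⟨ H-linear (k ∸ 1) N ⟩
  linear (k + N) (row k) S               ≡⟨ cong (λ n → linear n (row k) S) (ℕₚ.+-assoc (suc i) (3 * suc i) N) ⟩
  linear (suc i + M) (row k) S           ≈⟨ linear-drop (suc i) M (row k) S (λ j j≤i → m-left-zero k (suc j) (small j j≤i)) ⟩
  linear M (row k ∘ (_+_ (suc i))) (S ∘ (_+_ (suc i)))
    ≈⟨ linear-cong M {S = S ∘ (_+_ (suc i))} (λ j _ → cong (m k) (sym (ℕₚ.+-suc (suc i) j))) (λ j _ → S-+ (suc i) j) ⟩
  linear M (λ j → c (suc i) (suc j)) (λ j → q^ suc i ∙ ξ ↑ k ∙ S j)
    ≈⟨ ≈-trans (linear-∙ M (λ j → c (suc i) (suc j)) (q^ suc i ∙ ξ ↑ k) S) (∙-assoc _ _ _) ⟩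
  q^ suc i ∙ (ξ ↑ k ∙ linear M (λ j → c (suc i) (suc j)) S) ∎
  where
  open ≈-Reasoning
  k = 4 * suc i
  M = 3 * suc i + N
  y = part 2F (q^ i ∙ G ↑ k)
  1↑ : ∀ n → ι 1ℤ ↑ n ≈ ι 1ℤ
  1↑ zero    = ≈-refl
  1↑ (suc n) = ≈-trans (∙-identityˡ _) (1↑ n)
  part₂-S′ : part 2F (S i) ≈ F ↑ k ∙ y
  part₂-S′ = ≈-trans (part-cong 2F (begin
      q^ i ∙ ξ ↑ k                   ≈⟨ ∙-cong ≈-refl (↑-∙ P G k) ⟩
      q^ i ∙ (P ↑ k ∙ G ↑ k)         ≈⟨ solve 3 (λ q p g → q :* (p :* g) := p :* (q :* g)) ≈-refl (q^ i) (P ↑ k) (G ↑ k) ⟩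
      P ↑ k ∙ (q^ i ∙ G ↑ k)         ≈⟨ ∙-cong (≈-trans (↑-cong k (≈-sym cubed-F)) (≈-sym (cubed-↑ F k))) ≈-refl ⟩
      cubed (F ↑ k) ∙ (q^ i ∙ G ↑ k) ∎))
    (part-cubed-∙ 2F (F ↑ k) _)
  exponents : ∀ i → (1 + i) * 3 + i ≡ i + 3 * (1 + i)
  exponents = ℕ-RingSolver.solve-∀
  -- The exponent 3(i + 1) + i is k - 1, one less than the number of factors G, as `w` requires.
  w-last : cubed (q^ suc i) ∙ (q^ i ∙ G ↑ k) ≈ w (k ∸ 1)
  w-last = begin
    cubed (q^ suc i) ∙ (q^ i ∙ (G ∙ G ↑ (k ∸ 1)))
      ≈⟨ solve 4 (λ x y g z → x :* (y :* (g :* z)) := x :* y :* z :* g) ≈-refl (cubed (q^ suc i)) (q^ i) G (G ↑ (k ∸ 1)) ⟩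
    cubed (q^ suc i) ∙ q^ i ∙ G ↑ (k ∸ 1) ∙ G
      ≈⟨ ∙-cong (∙-cong (≈-trans (∙-cong (cubed-q^ (suc i)) ≈-refl) (≈-trans (≈-sym (q^-+ (suc i * 3) i))
           (≈-trans (≡⇒≈ (cong q^_ (exponents i))) (≈-sym (q-↑ (k ∸ 1)))))) ≈-refl) ≈-refl ⟩
    q ↑ (k ∸ 1) ∙ G ↑ (k ∸ 1) ∙ G
      ≈⟨ ∙-cong (≈-sym (↑-∙ q G (k ∸ 1))) ≈-refl ⟩
    w (k ∸ 1) ∎
  small : ∀ j → j < suc i → 3 * suc j < k
  small j j≤i = ℕₚ.≤-<-trans (ℕₚ.*-monoʳ-≤ 3 j≤i) (s≤s (ℕₚ.m≤n+m (3 * suc i) i))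

-- Rows as series and the induction on α

row-series : Row → Series
row-series y = linear (bound y) (λ i → entry y (suc i)) S

-- Extraction acts on rows as the matrix C. Each extract of `S i` is padded to the length
-- `3 * bound y`, which is the bound of the product row.
part₂-row-series : ∀ y → part 2F (row-series y) ≈ row-series (y ·C)
part₂-row-series y = begin
  part 2F (row-series y)   ≈⟨ part-linear 2F (bound y) _ S ⟩
  linear (bound y) (λ i → entry y (suc i)) (part 2F ∘ S)
    ≈⟨ linear-cong (bound y) {S = part 2F ∘ S} {S′ = λ i → linear (3 * bound y) (λ j → c (suc i) (suc j)) S} (λ _ _ → refl) (λ i i<b →
         subst (λ n → part 2F (S i) ≈ linear n (λ j → c (suc i) (suc j)) S) (ℕₚ.m+[n∸m]≡n (ℕₚ.*-monoʳ-≤ 3 i<b)) (part₂-S i _)) ⟩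
  linear (bound y) (λ i → entry y (suc i)) (λ i → linear (3 * bound y) (λ j → c (suc i) (suc j)) S)
    ≈⟨ linear-linear (bound y) (3 * bound y) (λ i → entry y (suc i)) (λ i j → c (suc i) (suc j)) S ⟩
  row-series (y ·C)        ∎
  where open ≈-Reasoning

a₉≈ : a₉ ≈ cubed P ∙ G
a₉≈ = ≈-sym (≈-trans (∙-cong cubed-P ≈-refl) (≡⇒≈ (trans (∙≡⊛ (f 9 ∙ f 18) G)
  (cong₂ _⊛_ (∙≡⊛ (f 9) (f 18)) (cong inverse (∙≡⊛ (f 1) (f 2)))))))

a₉-progression : ∀ α → (λ n → a₉ (3 ^ (α + 1) * n + 3 ^ (α + 1) ∸ 1)) ≈ row-series (Y α)
a₉-progression zero = begin
  (λ n → a₉ (3 * n + 3 ∸ 1))   ≈⟨ ⟨ (λ n → cong a₉ (trans (ℕₚ.+-∸-assoc (3 * n) {3} {1} (s≤s z≤n)) (cong (_+ 2) (ℕₚ.*-comm 3 n)))) ⟩ ⟩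
  part 2F a₉                   ≈⟨ part-cong 2F a₉≈ ⟩
  part 2F (cubed P ∙ G)        ≈⟨ part-cubed-∙ 2F P G ⟩
  P ∙ part 2F G                ≈⟨ ∙-cong (≈-sym (∙-identityʳ P)) (part-cong 2F (≈-sym (∙-identityˡ G))) ⟩
  -- The first row of `m` and the row `Y 0` both have the single nonzero entry 3.
  H 0                          ≈⟨ H-linear 0 0 ⟩
  row-series (Y 0)             ∎
  where open ≈-Reasoning
a₉-progression (suc α) = begin
  -- The new argument 3x(n + 1) - 1 is that of the old progression at 3n + 2, which is why the same
  -- residue class is extracted every time.
  (λ n → a₉ (3 * x * n + 3 * x ∸ 1))   ≈⟨ ⟨ (λ n → cong (λ k → a₉ (k ∸ 1)) (identity x n)) ⟩ ⟩
  part 2F (λ n → a₉ (x * n + x ∸ 1))   ≈⟨ part-cong 2F (a₉-progression α) ⟩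
  part 2F (row-series (Y α))           ≈⟨ part₂-row-series (Y α) ⟩
  row-series (Y (suc α))               ∎
  where
  open ≈-Reasoning
  x = 3 ^ (α + 1)
  identity : ∀ x n → 3 * x * n + 3 * x ≡ x * (n * 3 + 2) + x
  identity = ℕ-RingSolver.solve-∀

ξ-power : ∀ n → ((f 3 ⊛ f 6) ⊘ (f 1 ⊛ f 2)) ^ˢ n ≈ ξ ↑ n
ξ-power zero    = q^0≈1
ξ-power (suc n) = ≈-trans (≡⇒≈ (sym (∙≡⊛ _ _))) (∙-cong (≡⇒≈ (sym (trans (∙≡⊛ P G)
  (cong₂ _⊛_ (∙≡⊛ (f 3) (f 6)) (cong inverse (∙≡⊛ (f 1) (f 2))))))) (ξ-power n))

theorem3p2 : ∀ (α : ℕ) →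
    (λ n → a₉ (3 ^ (α + 1) * n + 3 ^ (α + 1) ∸ 1))
    ≗ combination (Y α) (λ i →
    q^ (i ∸ 1) ⊛ ((f 3 ⊛ f 6) ⊘ (f 1 ⊛ f 2)) ^ˢ (4 * i))
theorem3p2 α n = begin
  a₉ (3 ^ (α + 1) * n + 3 ^ (α + 1) ∸ 1)   ≡⟨ coeff (a₉-progression α) n ⟩
  row-series (Y α) n                       ≡⟨ linear-coeff (bound (Y α)) _ S n ⟩
  ∑[ i < bound (Y α) ] (entry (Y α) (suc (toℕ i)) ℤ.* S (toℕ i) n)
    ≡⟨ sum-cong-≗ {bound (Y α)} (λ i → cong (entry (Y α) (suc (toℕ i)) ℤ.*_) (S-coeff (toℕ i))) ⟩
  combination (Y α) (λ i → q^ (i ∸ 1) ⊛ ((f 3 ⊛ f 6) ⊘ (f 1 ⊛ f 2)) ^ˢ (4 * i)) n  ∎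
  where
  open ≡-Reasoning
  S-coeff : ∀ i → S i n ≡ (q^ i ⊛ ((f 3 ⊛ f 6) ⊘ (f 1 ⊛ f 2)) ^ˢ (4 * suc i)) n
  S-coeff i = coeff (≈-trans (∙-cong (≈-refl {q^ i}) (≈-sym (ξ-power (4 * suc i)))) (≡⇒≈ (∙≡⊛ _ _))) n
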